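{- Let $G$ be a finite abelian group, let $n\geq 2$, and let $S$ be a sequence of terms from $G$ with $|S|=|G|+n$ and $\mathsf h(S)\leq n$. Suppose that for every proper subgroup $H<G$ and every $\alpha\in G$, there are at least $|G/H|-1$ terms of $S$ (counted with multiplicity) lying outside the coset $\alpha+H$. Then $\Sigma_{|G|}(S)=G$ whenever \begin{itemize} \item[1.] $n\geq \exp(G)$, or \item[2.] $n\geq \exp(G)-1$, $G\cong H\oplus C_{\exp(G)}$, and either $|H|$ or $\exp(G)$ is prime, or \item[3.] $n\geq \frac{|G|}{p}-1$ and $G$ is cyclic, where $p$ is the smallest prime divisor of $|G|$, or \item[4.] $n\geq 2$ and either $\exp(G)\leq 3$, or $|G|<12$, or $\exp(G)=4$ and $|G|=16$. \end{itemize}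
   Context: A sequence $S=g_1\cdot\ldots\cdot g_\ell$ of terms from $G$ is a finite unordered list with repetition allowed (an element of the free abelian monoid on $G$); $|S|=\ell$ is its length. For $g\in G$, $\mathsf v_g(S)$ is the multiplicity of $g$ in $S$, and $\mathsf h(S)=\max_g \mathsf v_g(S)$. For a subsequence $T\mid S$, $\sigma(T)$ is the sum of its terms, and $\Sigma_n(S)=\{\sigma(T): T\mid S,\ |T|=n\}$ is the set of $n$-term subsequence sums. $\exp(G)$ is the exponent of $G$ and $C_m$ a cyclic group of order $m$. -}

module Defs where

open import Level using (0ℓ)
open import Data.Nat using (ℕ; zero; suc; _+_; _*_; _∸_; _≤_; _<_; NonZero; z≤n; s≤s)
open import Data.Nat.DivMod using (_/_; _%_; m%n<n)
open import Data.Nat.Primality using (Prime)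
open import Data.Nat.Divisibility using (_∣_)
open import Data.Fin as Fin using (Fin; toℕ; fromℕ<)
open import Data.Fin.Properties as FinP using ()
open import Data.List using (List; []; _∷_; length; allFin; map)
open import Data.List.Membership.Propositional using (_∈_)
open import Data.List.Membership.Propositional.Properties using (∈-allFin)
open import Data.List.Relation.Unary.Any using (here; there)
open import Data.List.Relation.Binary.Sublist.Propositional using (_⊆_)
open import Data.Product using (Σ; ∃; _×_; _,_; proj₁; proj₂)
open import Data.Empty using (⊥)
open import Function.Bundles using (_↔_; Inverse)
open import Relation.Nullary using (¬_; Dec; yes; no)
open import Relation.Unary using (Pred; Decidable)
open import Relation.Binary.PropositionalEquality using (_≡_; refl; cong; sym; trans; subst)
open import Algebra.Structures using (IsAbelianGroup)

countP : {A : Set} {P : A → Set} → Decidable P → List A → ℕ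
countP P? [] = 0
countP P? (x ∷ xs) with P? x
... | yes _ = suc (countP P? xs)
... | no  _ = countP P? xs

countP-pos : {A : Set} {P : A → Set} (P? : Decidable P) {x : A} {xs : List A} →
             x ∈ xs → P x → NonZero (countP P? xs)
countP-pos P? {x} {y ∷ xs} (here refl) px with P? y
... | yes _ = _
... | no ¬p = Data.Empty.⊥-elim (¬p px)
  where import Data.Empty
countP-pos P? {x} {y ∷ xs} (there m) px with P? y
... | yes _ = _
... | no  _ = countP-pos P? m px

record FiniteAbelianGroup : Set₁ where
  infixl 7 _∙_
  field
    Carrier        : Set
    _∙_            : Carrier → Carrier → Carrier
    ε              : Carrier
    _⁻¹            : Carrier → Carrier
    isAbelianGroup : IsAbelianGroup _≡_ _∙_ ε _⁻¹
    order          : ℕ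
    enum           : Fin order ↔ Carrier

  open Inverse enum public using (to; from; strictlyInverseˡ; strictlyInverseʳ)

  _≟_ : (x y : Carrier) → Dec (x ≡ y)
  x ≟ y with from x FinP.≟ from y
  ... | yes e = yes (trans (sym (strictlyInverseˡ x))
                      (trans (cong to e) (strictlyInverseˡ y)))
  ... | no ne = no (λ e → ne (cong from e))

  _·_ : ℕ → Carrier → Carrier
  zero  · g = ε
  suc k · g = g ∙ (k · g)

  -- Sequences over G are lists of elements (order irrelevant).

  σ : List Carrier → Carrier
  σ []       = ε
  σ (x ∷ xs) = x ∙ σ xs

  v : Carrier → List Carrier → ℕ
  v g S = countP (λ x → x ≟ g) S

  h≤ : List Carrier → ℕ → Set
  h≤ S n = ∀ g → v g S ≤ n

  -- g ∈ Σ_k(S): g is the sum of a k-term subsequence of S.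
  -- (subsequences of S, as multisets, are exactly the sublists of S)
  _∈Σ[_]_ : Carrier → ℕ → List Carrier → Set
  g ∈Σ[ k ] S = ∃ λ T → T ⊆ S × length T ≡ k × σ T ≡ g

  record Subgroup : Set₁ where
    field
      P      : Carrier → Set
      P?     : Decidable P
      ε∈     : P ε
      ∙-closed  : ∀ {x y} → P x → P y → P (x ∙ y)
      ⁻¹-closed : ∀ {x} → P x → P (x ⁻¹)

    card : ℕ
    card = countP (λ i → P? (to i)) (allFin order)

    instance
      card-nonZero : NonZero card
      card-nonZero = countP-pos (λ i → P? (to i)) (∈-allFin (from ε))
                       (subst P (sym (strictlyInverseˡ ε)) ε∈)

    index : ℕ
    index = order / card

    Proper : Set
    Proper = ∃ λ g → ¬ P g

    inCoset? : (α : Carrier) → Decidable (λ x → P ((α ⁻¹) ∙ x))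
    inCoset? α x = P? ((α ⁻¹) ∙ x)

    outside : Carrier → List Carrier → ℕ
    outside α S = countP (λ x → Relation.Nullary.¬? (inCoset? α x)) S

  IsExponent : ℕ → Set
  IsExponent e = 1 ≤ e × (∀ g → e · g ≡ ε)
               × (∀ m → 1 ≤ m → (∀ g → m · g ≡ ε) → e ≤ m)

  Cyclic : Set
  Cyclic = ∃ λ c → ∀ x → ∃ λ k → k · c ≡ x

open FiniteAbelianGroup public

_+ₘ_ : {e : ℕ} → Fin e → Fin e → Fin e
_+ₘ_ {suc k} a b = fromℕ< (m%n<n (toℕ a + toℕ b) (suc k))

_≅_⊕C[_] : FiniteAbelianGroup → FiniteAbelianGroup → ℕ → Set
G ≅ H ⊕C[ e ] =
  Σ ((Carrier H × Fin e) ↔ Carrier G) λ φ →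
    ∀ h a h' b → Inverse.to φ (_∙_ H h h' , a +ₘ b)
                 ≡ _∙_ G (Inverse.to φ (h , a)) (Inverse.to φ (h' , b))

IsSmallestPrimeDivisor : ℕ → ℕ → Set
IsSmallestPrimeDivisor p N = Prime p × p ∣ N × (∀ q → Prime q → q ∣ N → p ≤ q)

{-# OPTIONS --safe #-}

-- Passing to complements, it suffices to show that X = Σ_n(S) is all of G.  The
-- DeVos-Goddyn-Mohar theorem gives a period H of X with
--     |X| + n |H| ≥ |H| + Σ_{g ∈ G} min (n, number of terms of S in g + H),
-- so that, if X ≠ G, the union A of the H-cosets with at least n terms satisfies
-- n |A| > |G| and consists of at least two cosets; the latter is where the hypothesis
-- on proper cosets enters.  Cases 3 and 4 and the case of prime exponent now follow by
-- counting.  Otherwise it remains to see that the n-fold sumset of A, together with the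
-- few terms outside A, fills G.  If A lies in a coset of a proper subgroup U, Kneser's
-- theorem fills that coset and the terms outside it reach G/U.  If not, let J ≥ H be a
-- maximal subgroup with |A + J| < |J| + |A|.  Modulo J, an analogue of Vosper's theorem
-- shows that either adding A increases a set by at least |A|, or G/J is cyclic; both give
-- nA + J = G, and since two distinct J-fibres of A together have more than |J| elements,
-- the J-cosets can be filled as well.
module Submission where

import Algebra.Properties.CommutativeMonoid.Sum as MonoidSum
open import Algebra.Structures using (IsAbelianGroup)
open import Data.Bool using (Bool; true; false; not; _∧_; _∨_; _xor_)
open import Data.Bool.Properties using () renaming (_≟_ to _≟ᵇ_)
open import Data.Empty using (⊥; ⊥-elim)
open import Data.Fin using (Fin; toℕ; fromℕ<) renaming (zero to fzero; suc to fsuc)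
open import Data.Fin.Permutation using (Permutation; permutation; ↔⇒≡)
open import Data.Fin.Properties using (any?; toℕ<n; toℕ-fromℕ<; *↔×)
open import Data.List using (List; []; _∷_; _++_; length; replicate; tabulate)
open import Data.List.Properties using (length-++; length-replicate)
open import Data.List.Relation.Binary.Sublist.Propositional using (_⊆_; []; _∷_; _∷ʳ_; minimum; ⊆-trans)
open import Data.List.Relation.Unary.All using (All; []; _∷_)
import Data.List.Relation.Unary.All as All
import Data.List.Relation.Unary.All.Properties as AllP
open import Data.List.Relation.Unary.Any using (Any; here; there)
import Data.List.Relation.Unary.Any as Any
open import Data.Nat hiding (_≟_)
open import Data.Nat.Coprimality using (prime⇒coprime; coprime-Bézout)
open import Data.Nat.DivMod using (m≡m%n+[m/n]*n; m%n<n)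
open import Data.Nat.Divisibility using (_∣_; divides; ∣⇒≤; ∣-trans; m∣m*n)
open import Data.Nat.GCD using (module Bézout)
open import Data.Nat.Primality using (Prime; prime⇒nonZero; prime⇒irreducible)
open import Data.Nat.Primality.Factorisation using (factorise)
open import Data.Nat.Properties hiding (_≟_)
open import Data.Nat.Tactic.RingSolver using (solve-∀)
open import Data.Product using (Σ; ∃; _×_; _,_; proj₁; proj₂)
open import Data.Product.Function.NonDependent.Propositional using (_×-↔_)
open import Data.Sum using (_⊎_; inj₁; inj₂)
open import Data.Vec using (Vec; []; _∷_)
import Data.Vec as Vec
import Defs as D
open import Function using (_∘_)
open import Function.Properties.Inverse using (↔-refl; ↔-sym; ↔-trans)
import Relation.Binary.Reflection as Reflection
open import Relation.Binary.PropositionalEquality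
open import Relation.Nullary using (¬_; ¬?; Dec; yes; no)
open import Relation.Nullary.Decidable using (⌊_⌋)

-- Quotient groups are never formed. A subset of G/J is a J-periodic subset of G, its cardinality
-- carries the factor |J|, and the theorems of Kneser, DeVos-Goddyn-Mohar and Vosper are all stated
-- relative to a subgroup J. A strict inequality between sizes of J-periodic sets gains |J|; this
-- rounding takes the place of integrality in the quotient. A coset in A holds n terms, as many as
-- the whole sum needs, so summands may be prescribed anywhere in A up to elements of H. Hence
-- sumsets of A can stand in for subsequence sums. Two obstacles shape the last step. Adding a
-- progression modulo J gains one J-coset less than its length; this matters only when G/J is
-- cyclic, and the first two items, prime exponent aside, are used to get |G/J| ≤ n there. Moreover
-- a J-fibre of A with at most |J|/2 elements need not fill cosets when added to itself, so a sum of
-- n equal classes with such a fibre has to be rewritten with a summand from another class.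

open MonoidSum +-0-commutativeMonoid using (sum; sum-cong-≗; ∑-distrib-+; sum-permute)

-- A linear consequence: b ≥ a follows from a sum l ≤ r of hypotheses once
-- b + l exceeds a + r by an explicit natural number s.
linear : ∀ {l r} a b s → l ≤ r → a + r + s ≡ b + l → a ≤ b
linear {l} {r} a b s l≤r eq = +-cancelʳ-≤ r a b (begin
  a + r      ≤⟨ m≤m+n (a + r) s ⟩
  a + r + s  ≡⟨ eq ⟩
  b + l      ≤⟨ +-monoʳ-≤ b l≤r ⟩
  b + r      ∎)
  where open ≤-Reasoning

linear⊥ : ∀ {l r} s → l ≤ r → l ≡ suc (r + s) → ⊥
linear⊥ {l} {r} s l≤r eq = <-irrefl refl (≤-trans (s≤s (m≤m+n r s)) (≤-trans (≤-reflexive (sym eq)) l≤r))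

bit : Bool → ℕ
bit true  = 1
bit false = 0

bit≤1 : ∀ b → bit b ≤ 1
bit≤1 true  = ≤-refl
bit≤1 false = z≤n

true≢false : ∀ {b} → b ≡ true → b ≡ false → ⊥
true≢false refl ()

∧-true : ∀ {a b} → a ∧ b ≡ true → a ≡ true × b ≡ true
∧-true {true} {true} _ = refl , refl

∧-intro : ∀ {a b} → a ≡ true → b ≡ true → a ∧ b ≡ true
∧-intro refl refl = refl

∨-true : ∀ {a b} → a ∨ b ≡ true → a ≡ true ⊎ b ≡ true
∨-true {true}  _ = inj₁ refl
∨-true {false} p = inj₂ p

∨-introˡ : ∀ {a} b → a ≡ true → a ∨ b ≡ true
∨-introˡ b refl = refl

∨-introʳ : ∀ a {b} → b ≡ true → a ∨ b ≡ true
∨-introʳ true  _ = refl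
∨-introʳ false p = p

not-true : ∀ {a} → not a ≡ true → a ≡ false
not-true {false} _ = refl

-- Equations in a finite abelian group

module Group (G : D.FiniteAbelianGroup) where

  open D.FiniteAbelianGroup G public using (_∙_; ε; _⁻¹; isAbelianGroup; order; to; from; strictlyInverseˡ; strictlyInverseʳ; _≟_; _·_; σ) renaming (Carrier to C)
  open IsAbelianGroup isAbelianGroup public
    using (assoc; comm; identityˡ; identityʳ; inverseˡ; inverseʳ)

  ·-+ : ∀ m k x → (m + k) · x ≡ (m · x) ∙ (k · x)
  ·-+ zero    k x = sym (identityˡ _)
  ·-+ (suc m) k x = trans (cong (x ∙_) (·-+ m k x)) (sym (assoc _ _ _))

  interchange : ∀ a b c d → (a ∙ b) ∙ (c ∙ d) ≡ (a ∙ c) ∙ (b ∙ d)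
  interchange a b c d = begin
    (a ∙ b) ∙ (c ∙ d)  ≡⟨ assoc a b (c ∙ d) ⟩
    a ∙ (b ∙ (c ∙ d))  ≡⟨ cong (a ∙_) (sym (assoc b c d)) ⟩
    a ∙ ((b ∙ c) ∙ d)  ≡⟨ cong (λ z → a ∙ (z ∙ d)) (comm b c) ⟩
    a ∙ ((c ∙ b) ∙ d)  ≡⟨ cong (a ∙_) (assoc c b d) ⟩
    a ∙ (c ∙ (b ∙ d))  ≡⟨ sym (assoc a c (b ∙ d)) ⟩
    (a ∙ c) ∙ (b ∙ d)  ∎
    where open ≡-Reasoning

  -- A decision procedure for equations in abelian groups: an expression is
  -- normalised to a difference of two disjoint multisets of variables.
  module Expressions where
    infixl 7 _⊞_ _⊟_

    data Expr (n : ℕ) : Set where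
      var : Fin n → Expr n
      _⊞_ : Expr n → Expr n → Expr n
      neg : Expr n → Expr n
      nil : Expr n

    _⊟_ : ∀ {n} → Expr n → Expr n → Expr n
    a ⊟ b = a ⊞ neg b

    ⟦_⟧ : ∀ {n} → Expr n → Vec C n → C
    ⟦ var i ⟧ ρ = Vec.lookup ρ i
    ⟦ a ⊞ b ⟧ ρ = ⟦ a ⟧ ρ ∙ ⟦ b ⟧ ρ
    ⟦ neg a ⟧ ρ = (⟦ a ⟧ ρ) ⁻¹
    ⟦ nil ⟧ ρ   = ε

    value : ∀ {n} → Vec ℕ n → Vec C n → C
    value []       []      = ε
    value (k ∷ ks) (x ∷ ρ) = (k · x) ∙ value ks ρ

    value-0 : ∀ {n} (ρ : Vec C n) → value (Vec.replicate n 0) ρ ≡ ε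
    value-0 []      = refl
    value-0 (x ∷ ρ) = trans (identityˡ _) (value-0 ρ)

    value-+ : ∀ {n} (ks ls : Vec ℕ n) ρ → value (Vec.zipWith _+_ ks ls) ρ ≡ value ks ρ ∙ value ls ρ
    value-+ []       []       []      = sym (identityˡ _)
    value-+ (k ∷ ks) (l ∷ ls) (x ∷ ρ) =
      trans (cong₂ _∙_ (·-+ k l x) (value-+ ks ls ρ)) (interchange _ _ _ _)

    unit : ∀ {n} → Fin n → Vec ℕ n
    unit {suc n} fzero    = 1 ∷ Vec.replicate n 0
    unit {suc n} (fsuc i) = 0 ∷ unit i

    value-unit : ∀ {n} i (ρ : Vec C n) → value (unit i) ρ ≡ Vec.lookup ρ i
    value-unit fzero    (x ∷ ρ) = trans (cong₂ _∙_ (identityʳ x) (value-0 ρ)) (identityʳ x)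
    value-unit (fsuc i) (x ∷ ρ) = trans (identityˡ _) (value-unit i ρ)

    reduce : ∀ {n} → Vec ℕ n → Vec ℕ n → Vec ℕ n
    reduce ks ls = Vec.zipWith _∸_ ks ls

    positive negative : ∀ {n} → Expr n → Vec ℕ n
    positive (var i) = unit i
    positive (a ⊞ b) = Vec.zipWith _+_ (positive a) (positive b)
    positive (neg a) = negative a
    positive nil     = Vec.replicate _ 0
    negative (var i) = Vec.replicate _ 0
    negative (a ⊞ b) = Vec.zipWith _+_ (negative a) (negative b)
    negative (neg a) = positive a
    negative nil     = Vec.replicate _ 0

    ⟦_⇓⟧ : ∀ {n} → Expr n → Vec C n → C
    ⟦ a ⇓⟧ ρ = value (reduce (positive a) (negative a)) ρ ∙ (value (reduce (negative a) (positive a)) ρ) ⁻¹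

    cancel : ∀ {x y z w} → x ∙ y ≡ z ∙ w → x ∙ w ⁻¹ ≡ z ∙ y ⁻¹
    cancel {x} {y} {z} {w} eq = begin
      x ∙ w ⁻¹                      ≡⟨ sym (trans (cong ((x ∙ w ⁻¹) ∙_) (inverseʳ y)) (identityʳ _)) ⟩
      (x ∙ w ⁻¹) ∙ (y ∙ y ⁻¹)       ≡⟨ interchange x (w ⁻¹) y (y ⁻¹) ⟩
      (x ∙ y) ∙ (w ⁻¹ ∙ y ⁻¹)       ≡⟨ cong (_∙ (w ⁻¹ ∙ y ⁻¹)) eq ⟩
      (z ∙ w) ∙ (w ⁻¹ ∙ y ⁻¹)       ≡⟨ assoc z w _ ⟩
      z ∙ (w ∙ (w ⁻¹ ∙ y ⁻¹))       ≡⟨ cong (z ∙_) (sym (assoc w _ _)) ⟩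
      z ∙ ((w ∙ w ⁻¹) ∙ y ⁻¹)       ≡⟨ cong (λ u → z ∙ (u ∙ y ⁻¹)) (inverseʳ w) ⟩
      z ∙ (ε ∙ y ⁻¹)                ≡⟨ cong (z ∙_) (identityˡ _) ⟩
      z ∙ y ⁻¹                      ∎
      where open ≡-Reasoning

    reduce-+ : ∀ {n} (ks ls : Vec ℕ n) → Vec.zipWith _+_ (reduce ks ls) ls ≡ Vec.zipWith _+_ ks (reduce ls ks)
    reduce-+ []       []       = refl
    reduce-+ (k ∷ ks) (l ∷ ls) =
      cong₂ _∷_ (both k l) (reduce-+ ks ls)
      where
      both : ∀ k l → k ∸ l + l ≡ k + (l ∸ k)
      both zero    l       = cong (_+ l) (0∸n≡0 l)
      both (suc k) zero    = refl
      both (suc k) (suc l) = trans (+-suc (k ∸ l) l) (cong suc (both k l))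

    raw : ∀ {n} → Expr n → Vec C n → C
    raw a ρ = value (positive a) ρ ∙ (value (negative a) ρ) ⁻¹

    raw-correct : ∀ {n} (a : Expr n) ρ → raw a ρ ≡ ⟦ a ⟧ ρ
    raw-correct (var i) ρ =
      trans (cong₂ (λ u w → u ∙ w ⁻¹) (value-unit i ρ) (value-0 ρ))
            (trans (cancel (cong (Vec.lookup ρ i ∙_) (refl {x = ε})) ) (trans (cong (Vec.lookup ρ i ∙_) ε⁻¹) (identityʳ _)))
      where
      ε⁻¹ : ε ⁻¹ ≡ ε
      ε⁻¹ = trans (sym (identityˡ _)) (inverseʳ ε)
    raw-correct (a ⊞ b) ρ = begin
      value (Vec.zipWith _+_ pa pb) ρ ∙ value (Vec.zipWith _+_ na nb) ρ ⁻¹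
        ≡⟨ cong₂ (λ u w → u ∙ w ⁻¹) (value-+ pa pb ρ) (value-+ na nb ρ) ⟩
      (P ∙ P′) ∙ (N ∙ N′) ⁻¹
        ≡⟨ cancel (sym (rearrange)) ⟩
      (raw a ρ ∙ raw b ρ) ∙ ε ⁻¹
        ≡⟨ trans (cong ((raw a ρ ∙ raw b ρ) ∙_) ε⁻¹) (identityʳ _) ⟩
      raw a ρ ∙ raw b ρ
        ≡⟨ cong₂ _∙_ (raw-correct a ρ) (raw-correct b ρ) ⟩
      ⟦ a ⟧ ρ ∙ ⟦ b ⟧ ρ ∎
      where
      open ≡-Reasoning
      pa = positive a
      pb = positive b
      na = negative a
      nb = negative b
      P  = value pa ρ
      P′ = value pb ρ
      N  = value na ρ
      N′ = value nb ρ
      ε⁻¹ : ε ⁻¹ ≡ ε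
      ε⁻¹ = trans (sym (identityˡ _)) (inverseʳ ε)
      undo : ∀ p q → (p ∙ q ⁻¹) ∙ q ≡ p
      undo p q = trans (assoc p _ q) (trans (cong (p ∙_) (inverseˡ q)) (identityʳ p))
      rearrange : (raw a ρ ∙ raw b ρ) ∙ (N ∙ N′) ≡ (P ∙ P′) ∙ ε
      rearrange = trans (interchange _ _ _ _) (trans (cong₂ _∙_ (undo P N) (undo P′ N′)) (sym (identityʳ _)))
    raw-correct (neg a) ρ = begin
      N ∙ P ⁻¹              ≡⟨ sym (identityˡ _) ⟩
      ε ∙ (N ∙ P ⁻¹)        ≡⟨ cong (_∙ (N ∙ P ⁻¹)) (sym (inverseˡ (raw a ρ))) ⟩
      (raw a ρ ⁻¹ ∙ raw a ρ) ∙ (N ∙ P ⁻¹)  ≡⟨ assoc _ _ _ ⟩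
      raw a ρ ⁻¹ ∙ ((P ∙ N ⁻¹) ∙ (N ∙ P ⁻¹))
        ≡⟨ cong (raw a ρ ⁻¹ ∙_) (trans (interchange P _ N _) (trans (cong (_∙ (N ⁻¹ ∙ P ⁻¹)) (comm P N)) (trans (interchange N P (N ⁻¹) (P ⁻¹)) (trans (cong₂ _∙_ (inverseʳ N) (inverseʳ P)) (identityʳ ε))))) ⟩
      raw a ρ ⁻¹ ∙ ε        ≡⟨ identityʳ _ ⟩
      raw a ρ ⁻¹            ≡⟨ cong _⁻¹ (raw-correct a ρ) ⟩
      ⟦ a ⟧ ρ ⁻¹            ∎
      where
      open ≡-Reasoning
      P = value (positive a) ρ
      N = value (negative a) ρ
    raw-correct nil ρ = trans (cong (λ u → u ∙ u ⁻¹) (value-0 ρ)) (inverseʳ ε)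

    correct : ∀ {n} (a : Expr n) ρ → ⟦ a ⇓⟧ ρ ≡ ⟦ a ⟧ ρ
    correct a ρ = trans (cancel (trans (sym (value-+ (reduce (positive a) (negative a)) (negative a) ρ))
                                (trans (cong (λ ks → value ks ρ) (reduce-+ (positive a) (negative a)))
                                       (value-+ (positive a) (reduce (negative a) (positive a)) ρ))))
                        (raw-correct a ρ)

  open Expressions public using (_⊞_; _⊟_; neg; nil)
  open Expressions
  open Reflection (setoid C) var ⟦_⟧ ⟦_⇓⟧ correct public using (solve; _⊜_)

-- Subsets and subgroups

sum-mono : ∀ {n} {f g : Fin n → ℕ} → (∀ i → f i ≤ g i) → sum f ≤ sum g
sum-mono {zero}  _ = z≤n
sum-mono {suc n} p = +-mono-≤ (p fzero) (sum-mono (p ∘ fsuc))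

sum-single : ∀ {n} (f : Fin n → ℕ) i → f i ≤ sum f
sum-single {suc n} f fzero    = m≤m+n _ _
sum-single {suc n} f (fsuc i) = m≤n⇒m≤o+n (f fzero) (sum-single (f ∘ fsuc) i)

sum-const : ∀ n k → sum {n} (λ _ → k) ≡ n * k
sum-const zero    k = refl
sum-const (suc n) k = cong (k +_) (sum-const n k)

sum-positive : ∀ {n} (f : Fin n → ℕ) → 1 ≤ sum f → ∃ λ i → 1 ≤ f i
sum-positive {suc n} f p with f fzero in eq
... | suc k = fzero , ≤-trans (s≤s z≤n) (≤-reflexive (sym eq))
... | zero with sum-positive (f ∘ fsuc) p
...   | i , q = fsuc i , q

module FiniteSets (G : D.FiniteAbelianGroup) where

  open Group G public

  ∑ : (C → ℕ) → ℕ
  ∑ f = sum (f ∘ to)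

  ∑-mono : ∀ {f g} → (∀ x → f x ≤ g x) → ∑ f ≤ ∑ g
  ∑-mono p = sum-mono (p ∘ to)

  ∑-cong : ∀ {f g} → (∀ x → f x ≡ g x) → ∑ f ≡ ∑ g
  ∑-cong p = sum-cong-≗ (p ∘ to)

  ∑-+ : ∀ f g → ∑ (λ x → f x + g x) ≡ ∑ f + ∑ g
  ∑-+ f g = ∑-distrib-+ (f ∘ to) (g ∘ to)

  ∑-const : ∀ k → ∑ (λ _ → k) ≡ order * k
  ∑-const k = sum-const order k

  ∑-* : ∀ k f → ∑ (λ x → k * f x) ≡ k * ∑ f
  ∑-* zero    f = trans (∑-const 0) (*-zeroʳ order)
  ∑-* (suc k) f = trans (∑-+ f (λ x → k * f x)) (cong (∑ f +_) (∑-* k f))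

  ∑-single : ∀ f x → f x ≤ ∑ f
  ∑-single f x = ≤-trans (≤-reflexive (cong f (sym (strictlyInverseˡ x)))) (sum-single (f ∘ to) (from x))

  ∑-positive : ∀ f → 1 ≤ ∑ f → ∃ λ x → 1 ≤ f x
  ∑-positive f p with sum-positive (f ∘ to) p
  ... | i , q = to i , q

  ∑-bijection : ∀ f (φ ψ : C → C) → (∀ x → φ (ψ x) ≡ x) → (∀ x → ψ (φ x) ≡ x) → ∑ (f ∘ φ) ≡ ∑ f
  ∑-bijection f φ ψ φψ ψφ = sym (trans (sum-permute (f ∘ to) π) (sum-cong-≗ {order} {λ i → f (to (from (φ (to i))))} {λ i → f (φ (to i))} λ i → cong f (strictlyInverseˡ _)))
    where
    π : Permutation order order
    π = permutation (λ i → from (φ (to i))) (λ i → from (ψ (to i)))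
          (λ i → trans (cong (from ∘ φ) (strictlyInverseˡ _)) (trans (cong from (φψ _)) (strictlyInverseʳ i)))
          (λ i → trans (cong (from ∘ ψ) (strictlyInverseˡ _)) (trans (cong from (ψφ _)) (strictlyInverseʳ i)))

  ∑-translate : ∀ f a → ∑ (λ x → f (a ∙ x)) ≡ ∑ f
  ∑-translate f a = ∑-bijection f (a ∙_) (a ⁻¹ ∙_)
    (λ x → solve 2 (λ a x → (a ⊞ (neg a ⊞ x)) ⊜ x) refl a x)
    (λ x → solve 2 (λ a x → (neg a ⊞ (a ⊞ x)) ⊜ x) refl a x)

  ∑-reflect : ∀ f a → ∑ (λ x → f (x ⁻¹ ∙ a)) ≡ ∑ f
  ∑-reflect f a = ∑-bijection f (λ x → x ⁻¹ ∙ a) (λ x → x ⁻¹ ∙ a) inv inv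
    where
    inv : ∀ x → (x ⁻¹ ∙ a) ⁻¹ ∙ a ≡ x
    inv x = solve 2 (λ a x → (neg (neg x ⊞ a) ⊞ a) ⊜ x) refl a x

  Subset : Set
  Subset = C → Bool

  infix 4 _∈_ _∉_ _⊂_

  -- A record instead of the bare equation lets unification recover `x` and `A` from a membership
  -- type. The `abstract` set operations below serve the same purpose.
  record _∈_ (x : C) (A : Subset) : Set where
    constructor mem
    field holds : A x ≡ true
  open _∈_ public

  record _∉_ (x : C) (A : Subset) : Set where
    constructor non
    field fails : A x ≡ false
  open _∉_ public

  _⊂_ : Subset → Subset → Set
  A ⊂ B = ∀ {x} → x ∈ A → x ∈ B

  absurd : ∀ {P : Set} {x A} → x ∈ A → x ∉ A → P
  absurd (mem p) (non q) = ⊥-elim (true≢false p q)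

  member? : ∀ A x → x ∈ A ⊎ x ∉ A
  member? A x with A x in eq
  ... | true  = inj₁ (mem eq)
  ... | false = inj₂ (non eq)

  by-member : ∀ {P : Set} A x → (x ∈ A → P) → (x ∉ A → P) → P
  by-member A x f g with member? A x
  ... | inj₁ p = f p
  ... | inj₂ p = g p

  ∉-intro : ∀ {A x} → (x ∈ A → ⊥) → x ∉ A
  ∉-intro {A} {x} f = by-member A x (λ p → ⊥-elim (f p)) (λ p → p)

  search : ∀ (A : Subset) → (∃ λ x → x ∈ A) ⊎ (∀ x → x ∉ A)
  search A with any? (λ i → A (to i) ≟ᵇ true)
  ... | yes (i , p) = inj₁ (to i , mem p)
  ... | no ¬p = inj₂ λ x → ∉-intro λ q → ¬p (from x , trans (cong A (strictlyInverseˡ x)) (holds q))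

  some : Subset → Bool
  some A with search A
  ... | inj₁ _ = true
  ... | inj₂ _ = false

  some⁺ : ∀ {A x} → x ∈ A → some A ≡ true
  some⁺ {A} {x} p with search A
  ... | inj₁ _ = refl
  ... | inj₂ q = absurd p (q x)

  some⁻ : ∀ A → some A ≡ true → ∃ λ x → x ∈ A
  some⁻ A p with search A
  ... | inj₁ q = q

  infixl 5 _∪_ _∖_
  infixl 7 _∩_

  abstract
    full : Subset
    full _ = true

    compl : Subset → Subset
    compl A x = not (A x)

    full⁺ : ∀ {x} → x ∈ full
    full⁺ = mem refl

    _∪_ _∩_ _∖_ : Subset → Subset → Subset
    (A ∪ B) x = A x ∨ B x
    (A ∩ B) x = A x ∧ B x
    (A ∖ B) x = A x ∧ not (B x)

    ∪ˡ : ∀ {A B} → A ⊂ A ∪ B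
    ∪ˡ (mem p) = mem (∨-introˡ _ p)

    ∪ʳ : ∀ {A B} → B ⊂ A ∪ B
    ∪ʳ {A} {B} {x} (mem p) = mem (∨-introʳ (A x) p)

    ∪⁻ : ∀ {A B x} → x ∈ A ∪ B → x ∈ A ⊎ x ∈ B
    ∪⁻ (mem p) with ∨-true p
    ... | inj₁ q = inj₁ (mem q)
    ... | inj₂ q = inj₂ (mem q)

    ∪-elim : ∀ {A B D} → A ⊂ D → B ⊂ D → A ∪ B ⊂ D
    ∪-elim {A} {B} f g p with ∪⁻ {A} {B} p
    ... | inj₁ q = f q
    ... | inj₂ q = g q

    ∩⁺ : ∀ {A B x} → x ∈ A → x ∈ B → x ∈ A ∩ B
    ∩⁺ (mem p) (mem q) = mem (∧-intro p q)

    ∩ˡ : ∀ {A B} → A ∩ B ⊂ A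
    ∩ˡ (mem p) = mem (proj₁ (∧-true p))

    ∩ʳ : ∀ {A B} → A ∩ B ⊂ B
    ∩ʳ {A} {B} {x} (mem p) = mem (proj₂ (∧-true {A x} p))

    compl⁺ : ∀ {A x} → x ∉ A → x ∈ compl A
    compl⁺ (non p) = mem (cong not p)

    compl⁻ : ∀ {A x} → x ∈ compl A → x ∉ A
    compl⁻ (mem p) = non (not-true p)

    ∖⁺ : ∀ {A B x} → x ∈ A → x ∉ B → x ∈ A ∖ B
    ∖⁺ (mem p) (non q) = mem (∧-intro p (cong not q))

    ∖ˡ : ∀ {A B} → A ∖ B ⊂ A
    ∖ˡ (mem p) = mem (proj₁ (∧-true p))

    ∖ʳ : ∀ {A B x} → x ∈ A ∖ B → x ∉ B
    ∖ʳ {A} {B} {x} (mem p) = non (not-true (proj₂ (∧-true {A x} p)))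

  ⊂-or-escape : ∀ (A B : Subset) → (A ⊂ B) ⊎ (∃ λ x → x ∈ A × x ∉ B)
  ⊂-or-escape A B with search (A ∖ B)
  ... | inj₁ (x , p) = inj₂ (x , ∖ˡ p , ∖ʳ p)
  ... | inj₂ q = inj₁ λ {x} p → by-member B x (λ b → b) λ b → absurd (∖⁺ p b) (q x)

  abstract
    ∣_∣ : Subset → ℕ
    ∣ A ∣ = ∑ (λ x → bit (A x))

    card-∑ : ∀ A → ∣ A ∣ ≡ ∑ (λ x → bit (A x))
    card-∑ A = refl

  bit-in : ∀ {A x} → x ∈ A → bit (A x) ≡ 1
  bit-in (mem p) = cong bit p

  bit-out : ∀ {A x} → x ∉ A → bit (A x) ≡ 0
  bit-out (non p) = cong bit p

  abstract
    ∣full∣ : ∣ full ∣ ≡ order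
    ∣full∣ = trans (∑-const 1) (*-identityʳ order)

  bit-mono : ∀ {A B : Subset} {x y} → (x ∈ A → y ∈ B) → bit (A x) ≤ bit (B y)
  bit-mono {A} {B} {x} f with A x in eq
  ... | false = z≤n
  ... | true  = ≤-reflexive (sym (bit-in (f (mem eq))))

  abstract
    card-mono : ∀ {A B} → A ⊂ B → ∣ A ∣ ≤ ∣ B ∣
    card-mono {A} {B} p = ∑-mono λ x → bit-mono {A} {B} {x} {x} p

  card≤order : ∀ A → ∣ A ∣ ≤ order
  card≤order A = ≤-trans (card-mono {A} {full} (λ _ → full⁺)) (≤-reflexive ∣full∣)

  abstract
    card-positive : ∀ {A x} → x ∈ A → 1 ≤ ∣ A ∣
    card-positive {A} {x} p = ≤-trans (≤-reflexive (sym (bit-in p))) (∑-single (bit ∘ A) x)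

    card-nonempty : ∀ A → 1 ≤ ∣ A ∣ → ∃ λ x → x ∈ A
    card-nonempty A p with ∑-positive (bit ∘ A) p
    ... | x , q with A x in eq
    ...   | true = x , mem eq

    card-empty : ∀ {A} → (∀ x → x ∉ A) → ∣ A ∣ ≡ 0
    card-empty none = trans (∑-cong λ x → bit-out (none x)) (trans (∑-const 0) (*-zeroʳ order))

  abstract
    card-∪∩ : ∀ A B → ∣ A ∪ B ∣ + ∣ A ∩ B ∣ ≡ ∣ A ∣ + ∣ B ∣
    card-∪∩ A B = trans (sym (∑-+ (bit ∘ (A ∪ B)) (bit ∘ (A ∩ B))))
      (trans (∑-cong λ x → pt (A x) (B x)) (∑-+ (bit ∘ A) (bit ∘ B)))
      where
      pt : ∀ a b → bit (a ∨ b) + bit (a ∧ b) ≡ bit a + bit b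
      pt true  true  = refl
      pt true  false = refl
      pt false true  = refl
      pt false false = refl

  card-∪≤ : ∀ A B → ∣ A ∪ B ∣ ≤ ∣ A ∣ + ∣ B ∣
  card-∪≤ A B = ≤-trans (m≤m+n _ _) (≤-reflexive (card-∪∩ A B))

  card-∪-disjoint : ∀ A B → (∀ {x} → x ∈ A → x ∈ B → ⊥) → ∣ A ∪ B ∣ ≡ ∣ A ∣ + ∣ B ∣
  card-∪-disjoint A B dis = trans (sym (trans (cong (∣ A ∪ B ∣ +_) (card-empty {A ∩ B} λ x →
    ∉-intro λ p → dis (∩ˡ p) (∩ʳ {A} p))) (+-identityʳ _))) (card-∪∩ A B)

  abstract
    card-∖ : ∀ A B → ∣ A ∖ B ∣ + ∣ A ∩ B ∣ ≡ ∣ A ∣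
    card-∖ A B = trans (sym (∑-+ (bit ∘ (A ∖ B)) (bit ∘ (A ∩ B)))) (∑-cong λ x → pt (A x) (B x))
      where
      pt : ∀ a b → bit (a ∧ not b) + bit (a ∧ b) ≡ bit a
      pt true  true  = refl
      pt true  false = refl
      pt false b     = refl

  card-compl : ∀ A → ∣ compl A ∣ + ∣ A ∣ ≡ order
  card-compl A = trans (trans (sym (card-∪-disjoint (compl A) A λ p q → absurd q (compl⁻ p)))
    (≤-antisym (card-mono λ _ → full⁺) (card-mono {full} λ {x} _ → by-member A x (∪ʳ {compl A}) (λ p → ∪ˡ (compl⁺ p))))) ∣full∣

  card-disjoint : ∀ {A B} U → A ⊂ U → B ⊂ U → (∀ {x} → x ∈ A → x ∈ B → ⊥) → ∣ A ∣ + ∣ B ∣ ≤ ∣ U ∣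
  card-disjoint {A} {B} U a b dis = ≤-trans (≤-reflexive (sym (card-∪-disjoint A B dis)))
    (card-mono {A ∪ B} {U} (∪-elim a b))

  ⊂-antisym : ∀ {A B} → A ⊂ B → ∣ B ∣ ≤ ∣ A ∣ → B ⊂ A
  ⊂-antisym {A} {B} A⊂B le {x} xB = by-member A x (λ p → p) λ xA →
    ⊥-elim (<-irrefl refl (≤-trans (≤-trans (≤-reflexive (+-comm 1 _))
      (≤-trans (+-monoʳ-≤ ∣ A ∣ (card-positive (∖⁺ xB xA)))
        (card-disjoint B A⊂B ∖ˡ λ p q → absurd p (∖ʳ q)))) le))

  abstract
    translate : C → Subset → Subset
    translate a A x = A (a ⁻¹ ∙ x)

    translate⁺ : ∀ {a A x} → x ∈ A → a ∙ x ∈ translate a A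
    translate⁺ {a} {A} {x} (mem p) = mem (trans (cong A (solve 2 (λ a x → (neg a ⊞ (a ⊞ x)) ⊜ x) refl a x)) p)

    translate⁻ : ∀ {a A x} → x ∈ translate a A → ∃ λ y → y ∈ A × x ≡ a ∙ y
    translate⁻ {a} {A} {x} (mem p) = a ⁻¹ ∙ x , mem p , solve 2 (λ a x → x ⊜ (a ⊞ (neg a ⊞ x))) refl a x

    card-translate : ∀ a A → ∣ translate a A ∣ ≡ ∣ A ∣
    card-translate a A = ∑-translate (bit ∘ A) (a ⁻¹)

    -- The set g - A. An element `g` lies in `A ⊕ B` exactly when `A` meets g - B, which turns
    -- membership in a sumset into a count.
    reflect : C → Subset → Subset
    reflect g A x = A (x ⁻¹ ∙ g)

    card-reflect : ∀ g A → ∣ reflect g A ∣ ≡ ∣ A ∣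
    card-reflect g A = ∑-reflect (bit ∘ A) g

    reflect⁺ : ∀ {g A x y} → g ≡ x ∙ y → y ∈ A → x ∈ reflect g A
    reflect⁺ {g} {A} {x} {y} refl (mem p) = mem (trans (cong A (solve 2 (λ x y → (neg x ⊞ (x ⊞ y)) ⊜ y) refl x y)) p)

    reflect⁻ : ∀ {g A x} → x ∈ reflect g A → ∃ λ y → y ∈ A × g ≡ x ∙ y
    reflect⁻ {g} {A} {x} (mem p) = x ⁻¹ ∙ g , mem p , solve 2 (λ g x → g ⊜ (x ⊞ (neg x ⊞ g))) refl g x

  infixl 6 _⊕_

  abstract
    _⊕_ : Subset → Subset → Subset
    (A ⊕ B) g = some (A ∩ reflect g B)

    ⊕⁺ : ∀ {A B a b} → a ∈ A → b ∈ B → a ∙ b ∈ A ⊕ B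
    ⊕⁺ p q = mem (some⁺ (∩⁺ p (reflect⁺ refl q)))

    ⊕⁻ : ∀ {A B g} → g ∈ A ⊕ B → ∃ λ a → ∃ λ b → a ∈ A × b ∈ B × g ≡ a ∙ b
    ⊕⁻ {A} {B} {g} (mem p) with some⁻ (A ∩ reflect g B) p
    ... | a , q with reflect⁻ (∩ʳ {A} q)
    ...   | b , b∈ , eq = a , b , ∩ˡ q , b∈ , eq

  ⊕-elim : ∀ {A B} (D : Subset) → (∀ {a b} → a ∈ A → b ∈ B → a ∙ b ∈ D) → A ⊕ B ⊂ D
  ⊕-elim D f p with ⊕⁻ p
  ... | a , b , a∈ , b∈ , refl = f a∈ b∈

  ⊕-comm : ∀ {A B} → A ⊕ B ⊂ B ⊕ A
  ⊕-comm {A} {B} = ⊕-elim (B ⊕ A) λ {a} {b} p q → subst (_∈ B ⊕ A) (comm b a) (⊕⁺ q p)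

  ⊕-assoc : ∀ {A B D} → A ⊕ (B ⊕ D) ⊂ A ⊕ B ⊕ D
  ⊕-assoc {A} {B} {D} p with ⊕⁻ p
  ... | a , _ , a∈ , q , refl with ⊕⁻ q
  ...   | b , d , b∈ , d∈ , refl = subst (_∈ A ⊕ B ⊕ D) (assoc a b d) (⊕⁺ (⊕⁺ a∈ b∈) d∈)

  ⊕-assoc⁻ : ∀ {A B D} → A ⊕ B ⊕ D ⊂ A ⊕ (B ⊕ D)
  ⊕-assoc⁻ {A} {B} {D} p with ⊕⁻ p
  ... | _ , d , q , d∈ , refl with ⊕⁻ q
  ...   | a , b , a∈ , b∈ , refl = subst (_∈ A ⊕ (B ⊕ D)) (sym (assoc a b d)) (⊕⁺ a∈ (⊕⁺ b∈ d∈))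

  ⊕-mono : ∀ {A B A′ B′} → A ⊂ A′ → B ⊂ B′ → A ⊕ B ⊂ A′ ⊕ B′
  ⊕-mono {A′ = A′} {B′} f g = ⊕-elim (A′ ⊕ B′) λ p q → ⊕⁺ (f p) (g q)

  abstract
    -- Inside `U` the sets A and g - B are too large to be disjoint. `U` is the whole group or, when
    -- fibres are added, a single coset.
    pigeonhole : ∀ {A B} U g → A ⊂ U → reflect g B ⊂ U → ∣ U ∣ < ∣ A ∣ + ∣ B ∣ → g ∈ A ⊕ B
    pigeonhole {A} {B} U g A⊂U B⊂ lt = case (search (A ∩ reflect g B))
      where
      case : (∃ λ x → x ∈ A ∩ reflect g B) ⊎ (∀ x → x ∉ A ∩ reflect g B) → g ∈ A ⊕ B
      case (inj₁ (x , p)) = mem (some⁺ p)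
      case (inj₂ q) = ⊥-elim (<-irrefl refl (≤-trans lt (≤-trans
        (≤-reflexive (cong (∣ A ∣ +_) (sym (card-reflect g B))))
        (card-disjoint U A⊂U B⊂ λ {x} p p′ → absurd (∩⁺ p p′) (q x)))))

  pigeonhole-full : ∀ {A B} g → order < ∣ A ∣ + ∣ B ∣ → g ∈ A ⊕ B
  pigeonhole-full {A} {B} g lt =
    pigeonhole {A} {B} full g (λ _ → full⁺) (λ _ → full⁺) (≤-trans (≤-reflexive (cong suc ∣full∣)) lt)

  card≤⊕ : ∀ {A} B {a} → a ∈ A → ∣ B ∣ ≤ ∣ A ⊕ B ∣
  card≤⊕ {A} B {a} p = ≤-trans (≤-reflexive (sym (card-translate a B))) (card-mono λ q → shift (translate⁻ q))
    where
    shift : ∀ {x} → (∃ λ y → y ∈ B × x ≡ a ∙ y) → x ∈ A ⊕ B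
    shift (y , y∈ , refl) = ⊕⁺ p y∈

  -- Subgroups, cosets and periodic sets

  record Sub : Set where
    field
      set : Subset
      ε∈  : ε ∈ set
      ∙∈  : ∀ {x y} → x ∈ set → y ∈ set → x ∙ y ∈ set
      ⁻¹∈ : ∀ {x} → x ∈ set → x ⁻¹ ∈ set
  open Sub public

  ‖_‖ : Sub → ℕ
  ‖ H ‖ = ∣ set H ∣

  ‖‖>0 : ∀ H → 1 ≤ ‖ H ‖
  ‖‖>0 H = card-positive (ε∈ H)

  infix 4 _≤ₛ_
  _≤ₛ_ : Sub → Sub → Set
  H ≤ₛ K = set H ⊂ set K

  coset : Sub → C → Subset
  coset H a = translate a (set H)

  abstract
    coset⁺ : ∀ H {a x} → a ⁻¹ ∙ x ∈ set H → x ∈ coset H a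
    coset⁺ H (mem p) = mem p

    coset⁻ : ∀ H {a x} → x ∈ coset H a → a ⁻¹ ∙ x ∈ set H
    coset⁻ H (mem p) = mem p

  card-coset : ∀ H a → ∣ coset H a ∣ ≡ ‖ H ‖
  card-coset H a = card-translate a (set H)

  coset-refl : ∀ H a → a ∈ coset H a
  coset-refl H a = coset⁺ H (subst (_∈ set H) (sym (inverseˡ a)) (ε∈ H))

  coset-sym : ∀ H {a b} → b ∈ coset H a → a ∈ coset H b
  coset-sym H {a} {b} p =
    coset⁺ H (subst (_∈ set H) (solve 2 (λ a b → neg (neg a ⊞ b) ⊜ (neg b ⊞ a)) refl a b) (⁻¹∈ H (coset⁻ H p)))

  coset-trans : ∀ H {a b c} → b ∈ coset H a → c ∈ coset H b → c ∈ coset H a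
  coset-trans H {a} {b} {c} p q = coset⁺ H (subst (_∈ set H)
    (solve 3 (λ a b c → ((neg a ⊞ b) ⊞ (neg b ⊞ c)) ⊜ (neg a ⊞ c)) refl a b c) (∙∈ H (coset⁻ H p) (coset⁻ H q)))

  coset-∙ : ∀ H {a b c d} → b ∈ coset H a → d ∈ coset H c → b ∙ d ∈ coset H (a ∙ c)
  coset-∙ H {a} {b} {c} {d} p q = coset⁺ H (subst (_∈ set H)
    (solve 4 (λ a b c d → ((neg a ⊞ b) ⊞ (neg c ⊞ d)) ⊜ (neg (a ⊞ c) ⊞ (b ⊞ d))) refl a b c d)
    (∙∈ H (coset⁻ H p) (coset⁻ H q)))

  coset-mono : ∀ {H K} → H ≤ₛ K → ∀ {a} → coset H a ⊂ coset K a
  coset-mono {H} {K} le p = coset⁺ K (le (coset⁻ H p))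

  coset-∙ʳ : ∀ H a {h} → h ∈ set H → a ∙ h ∈ coset H a
  coset-∙ʳ H a = translate⁺

  coset-∙⁻ : ∀ H {a x} → x ∈ coset H a → ∃ λ h → h ∈ set H × x ≡ a ∙ h
  coset-∙⁻ H = translate⁻

  coset-value : ∀ H {a b} x → b ∈ coset H a → coset H a x ≡ coset H b x
  coset-value H {a} {b} x p with member? (coset H a) x | member? (coset H b) x
  ... | inj₁ q | inj₁ r = trans (holds q) (sym (holds r))
  ... | inj₂ q | inj₂ r = trans (fails q) (sym (fails r))
  ... | inj₁ q | inj₂ r = absurd (coset-trans H (coset-sym H p) q) r
  ... | inj₂ q | inj₁ r = absurd (coset-trans H p r) q

  Periodic : Sub → Subset → Set
  Periodic H A = ∀ {x h} → h ∈ set H → x ∈ A → x ∙ h ∈ A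

  periodic-coset : ∀ H {A} → Periodic H A → ∀ {a} → a ∈ A → coset H a ⊂ A
  periodic-coset H per p q with coset-∙⁻ H q
  ... | h , h∈ , refl = per h∈ p

  coset-periodic : ∀ {K} H a → K ≤ₛ H → Periodic K (coset H a)
  coset-periodic H a le {x} p q = coset-trans H q (coset-∙ʳ H x (le p))

  set-periodic : ∀ {K} H → K ≤ₛ H → Periodic K (set H)
  set-periodic H le p q = ∙∈ H q (le p)

  full-periodic : ∀ H → Periodic H full
  full-periodic H _ _ = full⁺

  ∪-periodic : ∀ H {A B} → Periodic H A → Periodic H B → Periodic H (A ∪ B)
  ∪-periodic H pa pb h∈ p with ∪⁻ p
  ... | inj₁ q = ∪ˡ (pa h∈ q)
  ... | inj₂ q = ∪ʳ (pb h∈ q)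

  ∩-periodic : ∀ H {A B} → Periodic H A → Periodic H B → Periodic H (A ∩ B)
  ∩-periodic H {A} pa pb h∈ p = ∩⁺ (pa h∈ (∩ˡ p)) (pb h∈ (∩ʳ {A} p))

  periodic-∉ : ∀ H {A} → Periodic H A → ∀ {x h} → h ∈ set H → x ∉ A → x ∙ h ∉ A
  periodic-∉ H {A} per {x} {h} h∈ p = ∉-intro λ q →
    absurd (subst (_∈ A) (solve 2 (λ x h → ((x ⊞ h) ⊟ h) ⊜ x) refl x h) (per (⁻¹∈ H h∈) q)) p

  compl-periodic : ∀ H {A} → Periodic H A → Periodic H (compl A)
  compl-periodic H per h∈ p = compl⁺ (periodic-∉ H per h∈ (compl⁻ p))

  ∖-periodic : ∀ H {A B} → Periodic H A → Periodic H B → Periodic H (A ∖ B)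
  ∖-periodic H pa pb h∈ p = ∖⁺ (pa h∈ (∖ˡ p)) (periodic-∉ H pb h∈ (∖ʳ p))

  ⊕-periodicʳ : ∀ H A {B} → Periodic H B → Periodic H (A ⊕ B)
  ⊕-periodicʳ H A {B} per {x} {h} h∈ p with ⊕⁻ p
  ... | a , b , a∈ , b∈ , refl = subst (_∈ A ⊕ B) (sym (assoc a b h)) (⊕⁺ a∈ (per h∈ b∈))

  ⊕-periodicˡ : ∀ H {A} B → Periodic H A → Periodic H (A ⊕ B)
  ⊕-periodicˡ H {A} B per h∈ p = ⊕-comm (⊕-periodicʳ H B per h∈ (⊕-comm p))

  translate-periodic : ∀ H a {A} → Periodic H A → Periodic H (translate a A)
  translate-periodic H a {A} per {x} {h} h∈ p with translate⁻ {a} {A} p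
  ... | y , y∈ , refl = subst (_∈ translate a A) (sym (assoc a y h)) (translate⁺ {a} {A} (per h∈ y∈))

  reflect-periodic : ∀ H g {A} → Periodic H A → Periodic H (reflect g A)
  reflect-periodic H g {A} per {x} {h} h∈ p with reflect⁻ {g} {A} p
  ... | y , y∈ , refl = reflect⁺ (solve 3 (λ x y h → (x ⊞ y) ⊜ ((x ⊞ h) ⊞ (y ⊟ h))) refl x y h) (per (⁻¹∈ H h∈) y∈)

  ⊂⊕ : ∀ {A} H → A ⊂ A ⊕ set H
  ⊂⊕ {A} H {x} p = subst (_∈ A ⊕ set H) (identityʳ x) (⊕⁺ p (ε∈ H))

  closure⊂ : ∀ {A B} H → Periodic H B → A ⊂ B → A ⊕ set H ⊂ B
  closure⊂ {A} {B} H per A⊂B = ⊕-elim B λ p q → per q (A⊂B p)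

  closure-coset : ∀ {A} H {x} → x ∈ A ⊕ set H → ∃ λ a → a ∈ A × x ∈ coset H a
  closure-coset H p with ⊕⁻ p
  ... | a , h , a∈ , h∈ , refl = a , a∈ , coset-∙ʳ H a h∈

  closure-intro : ∀ {A} H {a x} → a ∈ A → x ∈ coset H a → x ∈ A ⊕ set H
  closure-intro H a∈ q with coset-∙⁻ H q
  ... | h , h∈ , refl = ⊕⁺ a∈ h∈

  closure-periodic : ∀ {J} A H → J ≤ₛ H → Periodic J (A ⊕ set H)
  closure-periodic {J} A H le = ⊕-periodicʳ J A (set-periodic {J} H le)

  card-closure-mono : ∀ {A B} H K → A ⊂ B → H ≤ₛ K → ∣ A ⊕ set H ∣ ≤ ∣ B ⊕ set K ∣
  card-closure-mono H K f g = card-mono (⊕-mono f g)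

  card≤closure : ∀ A H → ∣ A ∣ ≤ ∣ A ⊕ set H ∣
  card≤closure A H = card-mono (⊂⊕ H)

  card-closure : ∀ A H → Periodic H A → ∣ A ⊕ set H ∣ ≤ ∣ A ∣
  card-closure A H per = card-mono (closure⊂ H per (λ p → p))

  _∧ₛ_ : Sub → Sub → Sub
  H ∧ₛ K = record
    { set = set H ∩ set K
    ; ε∈  = ∩⁺ (ε∈ H) (ε∈ K)
    ; ∙∈  = λ p q → ∩⁺ (∙∈ H (∩ˡ p) (∩ˡ q)) (∙∈ K (∩ʳ {set H} p) (∩ʳ {set H} q))
    ; ⁻¹∈ = λ p → ∩⁺ (⁻¹∈ H (∩ˡ p)) (⁻¹∈ K (∩ʳ {set H} p))
    }

  ∧ₛ-≤ˡ : ∀ H K → H ∧ₛ K ≤ₛ H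
  ∧ₛ-≤ˡ H K = ∩ˡ

  ∧ₛ-≤ʳ : ∀ H K → H ∧ₛ K ≤ₛ K
  ∧ₛ-≤ʳ H K = ∩ʳ {set H}

  moved : Subset → C → Subset
  moved A h g = A g xor A (g ∙ h)

  -- Tested by searching for a point whose membership changes under translation by `h`. Demanding
  -- equality of indicators makes closure under inverses immediate; `stab-complete` recovers the
  -- one-sided test.
  stab : Subset → Sub
  stab A = record
    { set = inStab
    ; ε∈  = intro λ x → cong A (sym (identityʳ x))
    ; ∙∈  = λ {x} {y} p q → intro λ g → trans (elim p g) (trans (elim q (g ∙ x)) (cong A (assoc g x y)))
    ; ⁻¹∈ = λ {x} p → intro λ g →
        sym (trans (elim p (g ∙ x ⁻¹)) (cong A (solve 2 (λ g x → ((g ⊟ x) ⊞ x) ⊜ g) refl g x)))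
    }
    where
    inStab : Subset
    inStab h = not (some (moved A h))
    same : ∀ a → a xor a ≡ false
    same true  = refl
    same false = refl
    differ : ∀ {a b} → a xor b ≡ false → a ≡ b
    differ {true}  {true}  _ = refl
    differ {false} {false} _ = refl
    intro : ∀ {h} → (∀ g → A g ≡ A (g ∙ h)) → h ∈ inStab
    intro {h} f with some (moved A h) in eq
    ... | false = mem (cong not eq)
    ... | true with some⁻ (moved A h) eq
    ...   | g , mem q = ⊥-elim (true≢false q (trans (cong (_xor A (g ∙ h)) (f g)) (same (A (g ∙ h)))))
    elim : ∀ {h} → h ∈ inStab → ∀ g → A g ≡ A (g ∙ h)
    elim {h} (mem p) g = by-member (moved A h) g
      (λ q → ⊥-elim (true≢false (some⁺ q) (not-true p))) (λ q → differ (fails q))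

  stab-periodic : ∀ A → Periodic (stab A) A
  stab-periodic A {x} {h} (mem h∈) p = by-member A (x ∙ h) (λ q → q) λ q →
    ⊥-elim (true≢false (some⁺ {moved A h} {x} (mem (cong₂ _xor_ (holds p) (fails q)))) (not-true h∈))

  -- One inclusion suffices: `A` lies in the set of all x with x + h in `A`, and the two have the
  -- same finite size.
  stab-complete : ∀ A {h} → (∀ {x} → x ∈ A → x ∙ h ∈ A) → h ∈ set (stab A)
  stab-complete A {h} f with some (moved A h) in eq
  ... | false = mem (cong not eq)
  ... | true with some⁻ (moved A h) eq
  ...   | g , mem q = ⊥-elim (bad g q)
    where
    A⁺ : Subset
    A⁺ x = A (x ∙ h)
    to⁺ : A ⊂ A⁺
    to⁺ p = mem (holds (f p))
    back : A⁺ ⊂ A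
    back = ⊂-antisym to⁺ (≤-reflexive (trans (card-∑ A⁺) (trans (∑-cong λ x → cong (bit ∘ A) (comm x h))
      (trans (∑-translate (bit ∘ A) h) (sym (card-∑ A))))))
    bad : ∀ g → moved A h g ≡ true → ⊥
    bad g q with A g in eq | A (g ∙ h) in eq′
    ... | true  | false = true≢false (holds (to⁺ (mem eq))) eq′
    ... | false | true  = true≢false (holds (back {g} (mem eq′))) eq

  escape : ∀ A {h} → h ∉ set (stab A) → ∃ λ x → x ∈ A × x ∙ h ∉ A
  escape A {h} p with ⊂-or-escape A (λ x → A (x ∙ h))
  ... | inj₁ f = absurd (stab-complete A λ q → mem (holds (f q))) p
  ... | inj₂ (x , q , non r) = x , q , non r

  stab-maximal : ∀ H A → Periodic H A → H ≤ₛ stab A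
  stab-maximal H A per h∈ = stab-complete A (per h∈)

  -- A period moves a point of `A` to a point of the same H-coset, so it is a difference of two
  -- elements of that coset.
  period-bound : ∀ {A} H {r} → A ⊂ coset H r → (∃ λ a → a ∈ A) → ∀ K → Periodic K A → K ≤ₛ H
  period-bound {A} H {r} A⊂ (a , a∈) K per {k} k∈ =
    subst (_∈ set H) (solve 2 (λ a k → (neg a ⊞ (a ⊞ k)) ⊜ k) refl a k)
      (coset⁻ H (coset-trans H (coset-sym H (A⊂ a∈)) (A⊂ (per k∈ a∈))))

  card-remove-coset : ∀ H A → Periodic H A → ∀ {a} → a ∈ A → ∣ A ∖ coset H a ∣ + ‖ H ‖ ≡ ∣ A ∣
  card-remove-coset H A per {a} a∈ = trans (cong (∣ A ∖ coset H a ∣ +_)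
    (trans (sym (card-coset H a)) (≤-antisym (card-mono λ p → ∩⁺ (periodic-coset H per a∈ p) p) (card-mono (∩ʳ {A})))))
    (card-∖ A (coset H a))

  remove-coset-periodic : ∀ H A a → Periodic H A → Periodic H (A ∖ coset H a)
  remove-coset-periodic H A a per = ∖-periodic H per (coset-periodic {H} H a (λ p → p))

  periodic-card : ∀ H A → Periodic H A → ∃ λ k → ∣ A ∣ ≡ k * ‖ H ‖
  periodic-card H A = go ∣ A ∣ A ≤-refl
    where
    go : ∀ n A → ∣ A ∣ ≤ n → Periodic H A → ∃ λ k → ∣ A ∣ ≡ k * ‖ H ‖
    go n A le per with search A
    ... | inj₂ none = 0 , card-empty none
    go zero A le per | inj₁ (a , a∈) = ⊥-elim (<-irrefl refl (≤-trans (card-positive a∈) le))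
    go (suc n) A le per | inj₁ (a , a∈) with go n (A ∖ coset H a)
        (s≤s⁻¹ (≤-trans (≤-trans (≤-reflexive (+-comm 1 _))
          (≤-trans (+-monoʳ-≤ _ (‖‖>0 H)) (≤-reflexive (card-remove-coset H A per a∈)))) le))
        (remove-coset-periodic H A a per)
    ... | k , eq = suc k , trans (sym (card-remove-coset H A per a∈)) (trans (cong (_+ ‖ H ‖) eq) (+-comm _ ‖ H ‖))

  -- Both sizes are multiples of |H|. This is the rounding that replaces integrality in the quotient
  -- by `H`.
  periodic-gap : ∀ H A B → Periodic H A → Periodic H B → ∣ A ∣ < ∣ B ∣ → ∣ A ∣ + ‖ H ‖ ≤ ∣ B ∣
  periodic-gap H A B pa pb lt with periodic-card H A pa | periodic-card H B pb
  ... | k , eq | l , eq′ rewrite eq | eq′ =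
    ≤-trans (≤-reflexive (+-comm (k * ‖ H ‖) _)) (*-monoˡ-≤ ‖ H ‖ (*-cancelʳ-< ‖ H ‖ k l lt))

-- Kneser's theorem

kn-base : ∀ a b p d dh c h s j → p + dh ≤ c + h → a + b ≤ d + p → d ≤ dh → c ≤ s → h ≤ j → a + b ≤ s + j
kn-base a b p d dh c h s j q1 q2 q3 q4 q5 = linear (a + b) (s + j) 0 (+-mono-≤ q1 (+-mono-≤ q2 (+-mono-≤ q3 (+-mono-≤ q4 q5)))) (eq a b p d dh c h s j)
  where
  eq : ∀ a b p d dh c h s j → (a + b) + ((c + h) + ((d + p) + (dh + (s + j)))) + 0 ≡ (s + j) + ((p + dh) + ((a + b) + (d + (c + h))))
  eq = solve-∀

kn-same : ∀ p dk dh c h e k x y z → p + dh ≤ c + h → dk + h ≤ dh + x → x ≤ y + z → y + z ≤ e + k → p + dk ≤ (c + e) + k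
kn-same p dk dh c h e k x y z q1 q2 q3 q4 = linear (p + dk) ((c + e) + k) 0 (+-mono-≤ q1 (+-mono-≤ q2 (+-mono-≤ q3 q4))) (eq p dk dh c h e k x y z)
  where
  eq : ∀ p dk dh c h e k x y z → (p + dk) + ((c + h) + ((dh + x) + ((y + z) + (e + k)))) + 0 ≡ ((c + e) + k) + ((p + dh) + ((dk + h) + (x + (y + z))))
  eq = solve-∀

kn-lone : ∀ p dk dh c h e k x y → p + dh ≤ c + h → dk + (h + h) ≤ dh + (x + y) → x ≤ e → y ≤ h → p + dk ≤ (c + e) + k
kn-lone p dk dh c h e k x y q1 q2 q3 q4 = linear (p + dk) ((c + e) + k) k (+-mono-≤ q1 (+-mono-≤ q2 (+-mono-≤ q3 q4))) (eq p dk dh c h e k x y)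
  where
  eq : ∀ p dk dh c h e k x y → (p + dk) + ((c + h) + ((dh + (x + y)) + (e + h))) + k ≡ ((c + e) + k) + ((p + dh) + ((dk + (h + h)) + (x + y)))
  eq = solve-∀

kn-defect : ∀ p dk dh c h e k x y → p + dh ≤ c + h → dk + (h + h) ≤ dh + (x + y) → x ≤ h → y ≤ h → 1 + ((c + e) + k) ≤ p + dk → 1 + (e + k) ≤ h
kn-defect p dk dh c h e k x y q1 q2 q3 q4 q5 = linear (1 + (e + k)) h 0 (+-mono-≤ q1 (+-mono-≤ q2 (+-mono-≤ q3 (+-mono-≤ q4 q5)))) (eq p dk dh c h e k x y)
  where
  eq : ∀ p dk dh c h e k x y → (1 + (e + k)) + ((c + h) + ((dh + (x + y)) + (h + (h + (p + dk))))) + 0 ≡ h + ((p + dh) + ((dk + (h + h)) + (x + (y + (1 + ((c + e) + k))))))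
  eq = solve-∀

-- For the case that none of three extensions of a convergent works. The hypotheses up to the two
-- Kneser bounds give h + e12 + i < e1 + e2 + h1 + h2. They are taken twice, so that h1 and h2 are
-- doubled and match the defects e1 + 2 h1 ≤ h and e2 + 2 h2 ≤ h; what is left contradicts e1, e2 ≤
-- e12.
kn-final : ∀ p di dh c h e1 e2 e12 i x y h1 h2 a1 b1 a2 b2 → p + dh ≤ c + h → di + (h + h) ≤ dh + (x + y) → 1 + ((c + e12) + i) ≤ p + di → x ≤ a1 + b2 → y ≤ a2 + b1 → a1 + b1 ≤ e1 + h1 → a2 + b2 ≤ e2 + h2 → e1 + (h1 + h1) ≤ h → e2 + (h2 + h2) ≤ h → e1 ≤ e12 → e2 ≤ e12 → ⊥
kn-final p di dh c h e1 e2 e12 i x y h1 h2 a1 b1 a2 b2 q1 q2 q3 q4 q5 q6 q7 q8 q9 q10 q11 = linear⊥ (1 + 2 * i) (+-mono-≤ q1 (+-mono-≤ q1 (+-mono-≤ q2 (+-mono-≤ q2 (+-mono-≤ q3 (+-mono-≤ q3 (+-mono-≤ q4 (+-mono-≤ q4 (+-mono-≤ q5 (+-mono-≤ q5 (+-mono-≤ q6 (+-mono-≤ q6 (+-mono-≤ q7 (+-mono-≤ q7 (+-mono-≤ q8 (+-mono-≤ q9 (+-mono-≤ q10 q11))))))))))))))))) (eq p di dh c h e1 e2 e12 i x y h1 h2 a1 b1 a2 b2)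
  where
  eq : ∀ p di dh c h e1 e2 e12 i x y h1 h2 a1 b1 a2 b2 → ((p + dh) + ((p + dh) + ((di + (h + h)) + ((di + (h + h)) + ((1 + ((c + e12) + i)) + ((1 + ((c + e12) + i)) + (x + (x + (y + (y + ((a1 + b1) + ((a1 + b1) + ((a2 + b2) + ((a2 + b2) + ((e1 + (h1 + h1)) + ((e2 + (h2 + h2)) + (e1 + e2))))))))))))))))) ≡ suc (((c + h) + ((c + h) + ((dh + (x + y)) + ((dh + (x + y)) + ((p + di) + ((p + di) + ((a1 + b2) + ((a1 + b2) + ((a2 + b1) + ((a2 + b1) + ((e1 + h1) + ((e1 + h1) + ((e2 + h2) + ((e2 + h2) + (h + (h + (e12 + e12))))))))))))))))) + (1 + 2 * i))
  eq = solve-∀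

module KneserTheorem (G : D.FiniteAbelianGroup) where

  open FiniteSets G

  Nonempty : Subset → Set
  Nonempty A = ∃ λ x → x ∈ A

  ⊕-nonempty : ∀ {A B} → Nonempty A → Nonempty B → Nonempty (A ⊕ B)
  ⊕-nonempty (a , a∈) (b , b∈) = a ∙ b , ⊕⁺ a∈ b∈

  Kneser : Subset → Subset → Set
  Kneser A B = ∣ A ⊕ set (stab (A ⊕ B)) ∣ + ∣ B ⊕ set (stab (A ⊕ B)) ∣ ≤ ∣ A ⊕ B ∣ + ‖ stab (A ⊕ B) ‖

  periodic-gap₂ : ∀ H A B → Periodic H A → Periodic H B → ∣ A ∣ + ‖ H ‖ < ∣ B ∣ → ∣ A ∣ + (‖ H ‖ + ‖ H ‖) ≤ ∣ B ∣
  periodic-gap₂ H A B pa pb lt with periodic-card H A pa | periodic-card H B pb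
  ... | k , eq | l , eq′ rewrite eq | eq′ =
    ≤-trans (≤-reflexive (rearrange k ‖ H ‖))
      (*-monoˡ-≤ ‖ H ‖ (*-cancelʳ-< ‖ H ‖ (suc k) l (≤-trans (≤-reflexive (cong suc (+-comm ‖ H ‖ _))) lt)))
    where
    rearrange : ∀ k h → k * h + (h + h) ≡ h + (h + k * h)
    rearrange = solve-∀

  card-closure-∪ : ∀ {X Y Z} H → X ⊂ Y ∪ Z → ∣ X ⊕ set H ∣ ≤ ∣ Y ⊕ set H ∣ + ∣ Z ⊕ set H ∣
  card-closure-∪ {X} {Y} {Z} H f = ≤-trans (card-mono {X ⊕ set H} {(Y ⊕ set H) ∪ (Z ⊕ set H)} inc) (card-∪≤ _ _)
    where
    inc : X ⊕ set H ⊂ (Y ⊕ set H) ∪ (Z ⊕ set H)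
    inc p with closure-coset H p
    ... | x , x∈ , q with ∪⁻ (f x∈)
    ...   | inj₁ y∈ = ∪ˡ (closure-intro H y∈ q)
    ...   | inj₂ z∈ = ∪ʳ (closure-intro H z∈ q)

  -- D + K and the coset a + H both lie in D + H, and they meet only in K-cosets of points of `D` in
  -- a + H. It measures what is lost in |D + H| when `H` shrinks to `K`.
  fill-coset : ∀ D H K {a} → K ≤ₛ H → a ∈ D →
    ∣ D ⊕ set K ∣ + ‖ H ‖ ≤ ∣ D ⊕ set H ∣ + ∣ (D ∩ coset H a) ⊕ set K ∣
  fill-coset D H K {a} K≤H a∈ = begin
    ∣ D ⊕ set K ∣ + ‖ H ‖                 ≡⟨ cong (∣ D ⊕ set K ∣ +_) (sym (card-coset H a)) ⟩
    ∣ D ⊕ set K ∣ + ∣ coset H a ∣         ≡⟨ sym (card-∪∩ (D ⊕ set K) (coset H a)) ⟩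
    ∣ D ⊕ set K ∪ coset H a ∣ + ∣ (D ⊕ set K) ∩ coset H a ∣
      ≤⟨ +-mono-≤ (card-mono (∪-elim (⊕-mono (λ p → p) K≤H) (closure-intro H a∈))) (card-mono inside) ⟩
    ∣ D ⊕ set H ∣ + ∣ (D ∩ coset H a) ⊕ set K ∣ ∎
    where
    open ≤-Reasoning
    inside : (D ⊕ set K) ∩ coset H a ⊂ (D ∩ coset H a) ⊕ set K
    inside p with closure-coset K (∩ˡ p)
    ... | d , d∈ , q =
      closure-intro K (∩⁺ d∈ (coset-trans H (∩ʳ {D ⊕ set K} p) (coset-sym H (coset-mono {K} {H} K≤H q)))) q

  fill-cosets : ∀ D H K {a b} → K ≤ₛ H → a ∈ D → b ∈ D → b ∉ coset H a →
    ∣ D ⊕ set K ∣ + (‖ H ‖ + ‖ H ‖) ≤ ∣ D ⊕ set H ∣ + (∣ (D ∩ coset H a) ⊕ set K ∣ + ∣ (D ∩ coset H b) ⊕ set K ∣)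
  fill-cosets D H K {a} {b} K≤H a∈ b∈ b∉ = begin
    ∣ D ⊕ set K ∣ + (‖ H ‖ + ‖ H ‖)
      ≡⟨ cong (∣ D ⊕ set K ∣ +_) (trans (sym (cong₂ _+_ (card-coset H a) (card-coset H b)))
           (sym (card-∪-disjoint (coset H a) (coset H b) λ p q → absurd (coset-trans H p (coset-sym H q)) b∉))) ⟩
    ∣ D ⊕ set K ∣ + ∣ cc ∣  ≡⟨ sym (card-∪∩ (D ⊕ set K) cc) ⟩
    ∣ D ⊕ set K ∪ cc ∣ + ∣ (D ⊕ set K) ∩ cc ∣
      ≤⟨ +-mono-≤ (card-mono (∪-elim (⊕-mono (λ p → p) K≤H) (∪-elim (closure-intro H a∈) (closure-intro H b∈))))
                  (≤-trans (card-mono inside) (card-∪≤ _ _)) ⟩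
    ∣ D ⊕ set H ∣ + (∣ (D ∩ coset H a) ⊕ set K ∣ + ∣ (D ∩ coset H b) ⊕ set K ∣) ∎
    where
    open ≤-Reasoning
    cc = coset H a ∪ coset H b
    inside : (D ⊕ set K) ∩ cc ⊂ (D ∩ coset H a) ⊕ set K ∪ (D ∩ coset H b) ⊕ set K
    inside p with closure-coset K (∩ˡ p)
    ... | d , d∈ , q with ∪⁻ (∩ʳ {D ⊕ set K} p)
    ...   | inj₁ r = ∪ˡ (closure-intro K (∩⁺ d∈ (coset-trans H r (coset-sym H (coset-mono {K} {H} K≤H q)))) q)
    ...   | inj₂ r = ∪ʳ (closure-intro K (∩⁺ d∈ (coset-trans H r (coset-sym H (coset-mono {K} {H} K≤H q)))) q)

  card-in-coset : ∀ {X} H K a → K ≤ₛ H → X ⊂ coset H a → ∣ X ⊕ set K ∣ ≤ ‖ H ‖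
  card-in-coset H K a K≤H X⊂ = ≤-trans (card-mono (closure⊂ K (coset-periodic {K} H a K≤H) X⊂)) (≤-reflexive (card-coset H a))

  closure≤sum : ∀ {A B a} H → a ∈ A → Periodic H (A ⊕ B) → ∣ B ⊕ set H ∣ ≤ ∣ A ⊕ B ∣
  closure≤sum {A} {B} H a∈ per =
    ≤-trans (card≤⊕ (B ⊕ set H) a∈) (card-mono λ p → closure⊂ H per (λ q → q) (⊕-assoc p))

  closure≤sum′ : ∀ {A B b} H → b ∈ B → Periodic H (A ⊕ B) → ∣ A ⊕ set H ∣ ≤ ∣ A ⊕ B ∣
  closure≤sum′ {A} {B} H b∈ per = ≤-trans (closure≤sum H b∈ λ h∈ p → ⊕-comm (per h∈ (⊕-comm p))) (card-mono ⊕-comm)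

  module Step (n : ℕ) (ih : ∀ A B → ∣ A ⊕ B ∣ ≤ n → Nonempty A → Nonempty B → Kneser A B) where

    module Descent (A B : Subset) (J : Sub) (small : ∣ A ⊕ B ∣ ≤ suc n)
                   (perA : Periodic J A) (perB : Periodic J B) (maximal : stab (A ⊕ B) ≤ₛ J) where

      S = A ⊕ B
      P = A ∩ B
      D = A ∪ B

      -- DeVos's convergents: the bound with |A ∩ B| + |A ∪ B| in place of |A| + |B|, the second
      -- term saturated by H.  The goal is a convergent whose period is J.
      Convergent : Subset → Sub → Set
      Convergent X H = ∣ P ∣ + ∣ D ⊕ set H ∣ ≤ ∣ X ∣ + ‖ H ‖

      -- The H-coset `R` of `z` meets `S` but does not lie in it. The H-periodic set `X` therefore
      -- avoids `R`, and sums found inside `R` are new.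
      module Incomplete (X : Subset) (H : Sub) (J≤H : J ≤ₛ H) (X⊂S : X ⊂ S) (neX : Nonempty X) (perX : Periodic H X)
                        (conv : Convergent X H) {z h : C} (h∈ : h ∈ set H) (z∈ : z ∈ S) (zh∉ : z ∙ h ∉ S) where

        R = coset H z

        X∩R : ∀ {x} → x ∈ X → x ∈ R → ⊥
        X∩R {x} p q = absurd (X⊂S (periodic-coset H perX p (coset-trans H (coset-sym H q) (coset-∙ʳ H z h∈)))) zh∉

        record Fibre (A′ B′ : Subset) : Set where
          field
            E⊂S    : A′ ⊕ B′ ⊂ S
            E⊂R    : A′ ⊕ B′ ⊂ R
            neA    : Nonempty A′
            neB    : Nonempty B′
            perA′  : Periodic J A′

          E = A′ ⊕ B′
          K = stab E

          neE : Nonempty E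
          neE = ⊕-nonempty neA neB

          K≤H : K ≤ₛ H
          K≤H = period-bound H E⊂R neE K (stab-periodic E)

          J≤K : J ≤ₛ K
          J≤K = stab-maximal J E (⊕-periodicˡ J B′ perA′)

          -- Otherwise `K` is all of `H`, so `E` fills `R` and contains z + h, which is missing from
          -- `S`.
          K<H : ‖ K ‖ < ‖ H ‖
          K<H with ‖ H ‖ ≤? ‖ K ‖
          ... | no ¬p = ≰⇒> ¬p
          ... | yes p = absurd (E⊂S (periodic-coset H
                   (λ k∈ → stab-periodic E (⊂-antisym K≤H p k∈)) (proj₂ neE)
                   (coset-trans H (coset-sym H (E⊂R (proj₂ neE))) (coset-∙ʳ H z h∈)))) zh∉

          -- `X` takes at least one element of `S` away from `E`; this is what makes the induction
          -- hypothesis available.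
          small′ : ∣ E ∣ ≤ n
          small′ = s≤s⁻¹ (≤-trans (≤-trans (+-monoˡ-≤ ∣ E ∣ (card-positive (proj₂ neX)))
            (card-disjoint S X⊂S E⊂S λ p q → X∩R p (E⊂R q))) small)

          kneser : Kneser A′ B′
          kneser = ih A′ B′ small′ neA neB

        record Next : Set where
          field
            X⁺    : Subset
            K     : Sub
            K<H   : ‖ K ‖ < ‖ H ‖
            J≤K   : J ≤ₛ K
            X⁺⊂S  : X⁺ ⊂ S
            ne⁺   : Nonempty X⁺
            per⁺  : Periodic K X⁺
            conv⁺ : Convergent X⁺ K

        extend : ∀ E K → K ≤ₛ H → ‖ K ‖ < ‖ H ‖ → J ≤ₛ K → E ⊂ S → E ⊂ R → Periodic K E →
                 ∣ P ∣ + ∣ D ⊕ set K ∣ ≤ ∣ X ∣ + ∣ E ∣ + ‖ K ‖ → Next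
        extend E K K≤H K<H J≤K E⊂S E⊂R perE le = record
          { X⁺ = X ∪ E ; K = K ; K<H = K<H ; J≤K = J≤K ; X⁺⊂S = ∪-elim X⊂S E⊂S
          ; ne⁺ = proj₁ neX , ∪ˡ (proj₂ neX)
          ; per⁺ = ∪-periodic K (λ k∈ → perX (K≤H k∈)) perE
          ; conv⁺ = ≤-trans le (≤-reflexive (cong (_+ ‖ K ‖)
              (sym (card-∪-disjoint X E λ p q → X∩R p (E⊂R q))))) }

        next : Next
        next with ⊕⁻ z∈
        ... | a , b , a∈ , b∈ , z≡ = by-member (coset H a) b same distinct
          where
          -- Writing z = a + b gives two pairs of fibres summing into `R`: `A₁`, `B₁` and, with the
          -- cosets exchanged, `A₂`, `B₂`. In the cosets of `a` and `b` the union `D` consists of A₁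
          -- and B₂, respectively A₂ and B₁.
          A₁ = A ∩ coset H a
          B₁ = B ∩ coset H b
          A₂ = A ∩ coset H b
          B₂ = B ∩ coset H a
          into : ∀ {x y c d} → x ∈ coset H c → y ∈ coset H d → z ≡ c ∙ d → x ∙ y ∈ R
          into {x} {y} p q eq = subst (λ w → x ∙ y ∈ coset H w) (sym eq) (coset-∙ H p q)
          F₁ : Fibre A₁ B₁
          F₁ = record
            { E⊂S = ⊕-mono ∩ˡ ∩ˡ ; E⊂R = ⊕-elim R λ p q → into (∩ʳ {A} p) (∩ʳ {B} q) z≡
            ; neA = a , ∩⁺ a∈ (coset-refl H a) ; neB = b , ∩⁺ b∈ (coset-refl H b)
            ; perA′ = ∩-periodic J perA (coset-periodic {J} H a J≤H) }
          module F₁ = Fibre F₁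
          H₁ = F₁.K
          E₁ = F₁.E
          a∈D : a ∈ D
          a∈D = ∪ˡ a∈
          b∈D : b ∈ D
          b∈D = ∪ʳ b∈
          D∩a⊂ : D ∩ coset H a ⊂ A₁ ∪ B₂
          D∩a⊂ p with ∪⁻ (∩ˡ p)
          ... | inj₁ q = ∪ˡ (∩⁺ q (∩ʳ {D} p))
          ... | inj₂ q = ∪ʳ (∩⁺ q (∩ʳ {D} p))
          D∩b⊂ : D ∩ coset H b ⊂ A₂ ∪ B₁
          D∩b⊂ p with ∪⁻ (∩ˡ p)
          ... | inj₁ q = ∪ˡ (∩⁺ q (∩ʳ {D} p))
          ... | inj₂ q = ∪ʳ (∩⁺ q (∩ʳ {D} p))
          extend₁ : ∣ P ∣ + ∣ D ⊕ set H₁ ∣ ≤ ∣ X ∣ + ∣ E₁ ∣ + ‖ H₁ ‖ → Next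
          extend₁ = extend E₁ H₁ F₁.K≤H F₁.K<H F₁.J≤K F₁.E⊂S F₁.E⊂R (stab-periodic E₁)

          same : b ∈ coset H a → Next
          same b∼a = extend₁ (kn-same _ _ (∣ D ⊕ set H ∣) (∣ X ∣) (‖ H ‖) (∣ E₁ ∣) (‖ H₁ ‖) (∣ (D ∩ coset H a) ⊕ set H₁ ∣)
            (∣ A₁ ⊕ set H₁ ∣) (∣ B₁ ⊕ set H₁ ∣) conv (fill-coset D H H₁ F₁.K≤H a∈D)
            (card-closure-∪ H₁ λ p → widen (D∩a⊂ p)) F₁.kneser)
            where
            widen : A₁ ∪ B₂ ⊂ A₁ ∪ B₁
            widen = ∪-elim ∪ˡ λ q → ∪ʳ (∩⁺ (∩ˡ q) (coset-trans H (coset-sym H b∼a) (∩ʳ {B} q)))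

          distinct : b ∉ coset H a → Next
          distinct b≁a with search A₂ | search B₂
          -- With `A₂` empty, `D` meets b + H in `B₁` alone, and |B₁ + H₁| ≤ |E₁|; the trivial bound
          -- |H| does for the other coset.
          ... | inj₂ none | _ = extend₁ (kn-lone _ _ (∣ D ⊕ set H ∣) (∣ X ∣) (‖ H ‖) (∣ E₁ ∣) (‖ H₁ ‖)
                  (∣ (D ∩ coset H b) ⊕ set H₁ ∣) (∣ (D ∩ coset H a) ⊕ set H₁ ∣) conv
                  (≤-trans (fill-cosets D H H₁ F₁.K≤H a∈D b∈D b≁a) (+-monoʳ-≤ (∣ D ⊕ set H ∣) (≤-reflexive (+-comm (∣ (D ∩ coset H a) ⊕ set H₁ ∣) _))))
                  (≤-trans (card-mono (⊕-mono (λ p → only (D∩b⊂ p)) (λ p → p))) (closure≤sum H₁ (proj₂ F₁.neA) (stab-periodic E₁)))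
                  (card-in-coset H H₁ a F₁.K≤H (∩ʳ {D})))
            where
            only : A₂ ∪ B₁ ⊂ B₁
            only = ∪-elim (λ {x} p → absurd p (none x)) (λ p → p)
          ... | inj₁ _ | inj₂ none = extend₁ (kn-lone _ _ (∣ D ⊕ set H ∣) (∣ X ∣) (‖ H ‖) (∣ E₁ ∣) (‖ H₁ ‖)
                  (∣ (D ∩ coset H a) ⊕ set H₁ ∣) (∣ (D ∩ coset H b) ⊕ set H₁ ∣) conv
                  (fill-cosets D H H₁ F₁.K≤H a∈D b∈D b≁a)
                  (≤-trans (card-mono (⊕-mono (λ p → only (D∩a⊂ p)) (λ p → p))) (closure≤sum′ H₁ (proj₂ F₁.neB) (stab-periodic E₁)))
                  (card-in-coset H H₁ b F₁.K≤H (∩ʳ {D})))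
            where
            only : A₁ ∪ B₂ ⊂ A₁
            only = ∪-elim (λ p → p) (λ {x} p → absurd p (none x))
          ... | inj₁ neA₂ | inj₁ neB₂ = decide
            where
            F₂ : Fibre A₂ B₂
            F₂ = record
              { E⊂S = ⊕-mono ∩ˡ ∩ˡ ; E⊂R = ⊕-elim R λ p q → into (∩ʳ {A} p) (∩ʳ {B} q) (trans z≡ (comm a b))
              ; neA = neA₂ ; neB = neB₂
              ; perA′ = ∩-periodic J perA (coset-periodic {J} H b J≤H) }
            module F₂ = Fibre F₂
            H₂ = F₂.K
            E₂ = F₂.E
            I = H₁ ∧ₛ H₂
            E₁₂ = E₁ ∪ E₂
            I≤H : I ≤ₛ H
            I≤H p = F₁.K≤H (∧ₛ-≤ˡ H₁ H₂ p)
            -- Failure of the extension by `E` gives |E| + |K| < |H|. As `E` and the coset `R` are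
            -- K-periodic, the gap rounds up to two K-cosets.
            defect : ∀ K E → K ≤ₛ H → Periodic K E →
                     ¬ (∣ P ∣ + ∣ D ⊕ set K ∣ ≤ ∣ X ∣ + ∣ E ∣ + ‖ K ‖) → ∣ E ∣ + (‖ K ‖ + ‖ K ‖) ≤ ‖ H ‖
            defect K E K≤H perE bad = ≤-trans (periodic-gap₂ K E R perE (coset-periodic {K} H z K≤H)
              (≤-trans (kn-defect (∣ P ∣) (∣ D ⊕ set K ∣) (∣ D ⊕ set H ∣) (∣ X ∣) (‖ H ‖) (∣ E ∣) (‖ K ‖)
                (∣ (D ∩ coset H a) ⊕ set K ∣) (∣ (D ∩ coset H b) ⊕ set K ∣) conv
                (fill-cosets D H K K≤H a∈D b∈D b≁a)
                (card-in-coset H K a K≤H (∩ʳ {D})) (card-in-coset H K b K≤H (∩ʳ {D})) (≰⇒> bad))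
                (≤-reflexive (sym (card-coset H z)))))
              (≤-reflexive (card-coset H z))
            decide : Next
            decide with ∣ P ∣ + ∣ D ⊕ set H₁ ∣ ≤? ∣ X ∣ + ∣ E₁ ∣ + ‖ H₁ ‖
                      | ∣ P ∣ + ∣ D ⊕ set H₂ ∣ ≤? ∣ X ∣ + ∣ E₂ ∣ + ‖ H₂ ‖
                      | ∣ P ∣ + ∣ D ⊕ set I ∣ ≤? ∣ X ∣ + ∣ E₁₂ ∣ + ‖ I ‖
            ... | yes p | _ | _ = extend₁ p
            ... | no _ | yes p | _ = extend E₂ H₂ F₂.K≤H F₂.K<H F₂.J≤K F₂.E⊂S F₂.E⊂R (stab-periodic E₂) p
            ... | no _ | no _ | yes p = extend E₁₂ I I≤H
                    (≤-trans (s≤s (card-mono (∧ₛ-≤ˡ H₁ H₂))) F₁.K<H) (λ p → ∩⁺ (F₁.J≤K p) (F₂.J≤K p))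
                    (∪-elim F₁.E⊂S F₂.E⊂S) (∪-elim F₁.E⊂R F₂.E⊂R)
                    (∪-periodic I (λ p → stab-periodic E₁ (∧ₛ-≤ˡ H₁ H₂ p)) (λ p → stab-periodic E₂ (∧ₛ-≤ʳ H₁ H₂ p))) p
            ... | no ¬1 | no ¬2 | no ¬12 = ⊥-elim (kn-final
                    (∣ P ∣) (∣ D ⊕ set I ∣) (∣ D ⊕ set H ∣) (∣ X ∣) (‖ H ‖) (∣ E₁ ∣) (∣ E₂ ∣) (∣ E₁₂ ∣) (‖ I ‖)
                    (∣ (D ∩ coset H a) ⊕ set I ∣) (∣ (D ∩ coset H b) ⊕ set I ∣) (‖ H₁ ‖) (‖ H₂ ‖)
                    (∣ A₁ ⊕ set I ∣) (∣ B₁ ⊕ set I ∣) (∣ A₂ ⊕ set I ∣) (∣ B₂ ⊕ set I ∣)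
                    conv (fill-cosets D H I I≤H a∈D b∈D b≁a) (≰⇒> ¬12)
                    (card-closure-∪ I D∩a⊂) (card-closure-∪ I D∩b⊂)
                    (≤-trans (+-mono-≤ (shrink H₁ (∧ₛ-≤ˡ H₁ H₂)) (shrink H₁ (∧ₛ-≤ˡ H₁ H₂))) F₁.kneser)
                    (≤-trans (+-mono-≤ (shrink H₂ (∧ₛ-≤ʳ H₁ H₂)) (shrink H₂ (∧ₛ-≤ʳ H₁ H₂))) F₂.kneser)
                    (defect H₁ E₁ F₁.K≤H (stab-periodic E₁) ¬1) (defect H₂ E₂ F₂.K≤H (stab-periodic E₂) ¬2)
                    (card-mono ∪ˡ) (card-mono (∪ʳ {E₁})))
              where
              shrink : ∀ {Y} K → I ≤ₛ K → ∣ Y ⊕ set I ∣ ≤ ∣ Y ⊕ set K ∣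
              shrink K le = card-closure-mono I K (λ p → p) le

      descend : ∀ k X H → ‖ H ‖ ≤ k → J ≤ₛ H → X ⊂ S → Nonempty X → Periodic H X → Convergent X H →
                ∣ A ∣ + ∣ B ∣ ≤ ∣ S ∣ + ‖ J ‖
      descend k X H le J≤H X⊂S neX perX conv with ⊂-or-escape (set H) (set J)
      ... | inj₁ H≤J = kn-base (∣ A ∣) (∣ B ∣) (∣ P ∣) (∣ D ∣) (∣ D ⊕ set H ∣) (∣ X ∣) (‖ H ‖) (∣ S ∣) (‖ J ‖) conv
              (≤-reflexive (sym (card-∪∩ A B))) (card≤closure D H) (card-mono X⊂S) (card-mono H≤J)
      descend zero X H le J≤H X⊂S neX perX conv | inj₂ _ = ⊥-elim (<-irrefl refl (≤-trans (‖‖>0 H) le))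
      descend (suc k) X H le J≤H X⊂S neX perX conv | inj₂ (h , h∈ , h∉)
        with escape S (∉-intro λ q → absurd (maximal q) h∉)
      ... | z , z∈ , zh∉ = descend k N.X⁺ N.K (s≤s⁻¹ (≤-trans N.K<H le)) N.J≤K N.X⁺⊂S N.ne⁺ N.per⁺ N.conv⁺
        where module N = Incomplete.Next (Incomplete.next X H J≤H X⊂S neX perX conv h∈ z∈ zh∉)

    -- If `A` contains a, a′ in different J-cosets, then `B` is not stable under a′ - a, which would
    -- otherwise be a period of the sum outside `J`. So some translate of `B` contains a and misses
    -- a′, as `overlapping` requires.
    aperiodic : ∀ m A B J → ∣ A ⊕ B ∣ ≤ suc n → ∣ A ∣ ≤ m → Nonempty A → Nonempty B →
                Periodic J A → Periodic J B → stab (A ⊕ B) ≤ₛ J → ∣ A ∣ + ∣ B ∣ ≤ ∣ A ⊕ B ∣ + ‖ J ‖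
    -- The sum of the intersection P and the union D lies in `A ⊕ B`. If it is everything, replace
    -- the pair by P, D, where P is smaller than `A`. If not, Kneser's theorem for P, D holds by
    -- induction and is the first convergent of the descent.
    overlapping : ∀ m A B J → ∣ A ⊕ B ∣ ≤ suc n → ∣ A ∣ ≤ m → Nonempty (A ∩ B) → Nonempty (A ∖ B) →
                  Periodic J A → Periodic J B → stab (A ⊕ B) ≤ₛ J → ∣ A ∣ + ∣ B ∣ ≤ ∣ A ⊕ B ∣ + ‖ J ‖

    aperiodic m A B J small le (a , a∈) (b , b∈) perA perB maximal with ⊂-or-escape A (coset J a)
    ... | inj₁ A⊂ = ≤-trans (+-mono-≤ (≤-trans (card-mono A⊂) (≤-reflexive (card-coset J a))) (card≤⊕ B a∈))
                            (≤-reflexive (+-comm (‖ J ‖) (∣ A ⊕ B ∣)))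
    ... | inj₂ (a′ , a′∈ , a′∉) with ⊂-or-escape B (λ x → B (x ∙ (a ⁻¹ ∙ a′)))
    ...   | inj₁ stable = absurd (coset⁺ J (maximal (stab-complete (A ⊕ B) λ p → moved⊂ (⊕⁻ p)))) a′∉
      where
      moved⊂ : ∀ {x} → (∃ λ c → ∃ λ d → c ∈ A × d ∈ B × x ≡ c ∙ d) → x ∙ (a ⁻¹ ∙ a′) ∈ A ⊕ B
      moved⊂ (c , d , c∈ , d∈ , refl) = subst (_∈ A ⊕ B) (sym (assoc c d _)) (⊕⁺ c∈ (mem (holds (stable d∈))))
    ...   | inj₂ (d , d∈ , d∉) = ≤-trans (≤-reflexive (cong (∣ A ∣ +_) (sym (card-translate s B))))
              (≤-trans (overlapping m A B′ J (≤-trans eq small) le (a , ∩⁺ a∈ a∈B′) (a′ , ∖⁺ a′∈ a′∉B′)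
                perA (translate-periodic J s perB) (λ p → maximal (stab-complete (A ⊕ B) (unshift p))))
              (+-monoˡ-≤ (‖ J ‖) eq))
      where
      s = a ∙ d ⁻¹
      B′ = translate s B
      shift⊂ : A ⊕ B′ ⊂ translate s (A ⊕ B)
      shift⊂ p with ⊕⁻ p
      ... | c , _ , c∈ , q , refl with translate⁻ {s} {B} q
      ...   | y , y∈ , refl = subst (_∈ translate s (A ⊕ B)) (solve 3 (λ s c y → (s ⊞ (c ⊞ y)) ⊜ (c ⊞ (s ⊞ y))) refl s c y)
                                (translate⁺ {s} {A ⊕ B} (⊕⁺ c∈ y∈))
      shift⊃ : ∀ {x} → x ∈ A ⊕ B → s ∙ x ∈ A ⊕ B′
      shift⊃ p with ⊕⁻ p
      ... | c , y , c∈ , y∈ , refl = subst (_∈ A ⊕ B′) (solve 3 (λ s c y → (c ⊞ (s ⊞ y)) ⊜ (s ⊞ (c ⊞ y))) refl s c y)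
                                       (⊕⁺ c∈ (translate⁺ {s} {B} y∈))
      eq : ∣ A ⊕ B′ ∣ ≤ ∣ A ⊕ B ∣
      eq = ≤-trans (card-mono shift⊂) (≤-reflexive (card-translate s (A ⊕ B)))
      a∈B′ : a ∈ B′
      a∈B′ = subst (_∈ B′) (solve 2 (λ a d → ((a ⊟ d) ⊞ d) ⊜ a) refl a d) (translate⁺ {s} {B} d∈)
      a′∉B′ : a′ ∉ B′
      a′∉B′ = ∉-intro λ p → bad (translate⁻ {s} {B} p)
        where
        bad : (∃ λ y → y ∈ B × a′ ≡ s ∙ y) → ⊥
        bad (y , y∈ , eq) = absurd y∈ (subst (_∉ B)
          (trans (cong (λ w → d ∙ (a ⁻¹ ∙ w)) eq) (solve 3 (λ a d y → (d ⊞ (neg a ⊞ ((a ⊟ d) ⊞ y))) ⊜ y) refl a d y)) (non (fails d∉)))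
      unshift : ∀ {h} → h ∈ set (stab (A ⊕ B′)) → ∀ {x} → x ∈ A ⊕ B → x ∙ h ∈ A ⊕ B
      unshift {h} p {x} x∈ with translate⁻ {s} {A ⊕ B} (shift⊂ (stab-periodic (A ⊕ B′) p (shift⊃ x∈)))
      ... | y , y∈ , eq = subst (_∈ A ⊕ B) (trans (solve 2 (λ s y → y ⊜ (neg s ⊞ (s ⊞ y))) refl s y)
                (trans (cong (s ⁻¹ ∙_) (sym eq)) (solve 3 (λ s x h → (neg s ⊞ ((s ⊞ x) ⊞ h)) ⊜ (x ⊞ h)) refl s x h))) y∈

    overlapping zero A B J small le (p , p∈) _ _ _ _ = ⊥-elim (<-irrefl refl (≤-trans (card-positive (∩ˡ p∈)) le))
    overlapping (suc m) A B J small le (p , p∈) (q , q∈) perA perB maximal = cases (∣ A ⊕ B ∣ ≤? ∣ P ⊕ D ∣)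
      where
      P = A ∩ B
      D = A ∪ B
      T⊂ : P ⊕ D ⊂ A ⊕ B
      T⊂ = ⊕-elim (A ⊕ B) λ {x} {y} x∈ y∈ → side x∈ (∪⁻ y∈)
        where
        side : ∀ {x y} → x ∈ P → y ∈ A ⊎ y ∈ B → x ∙ y ∈ A ⊕ B
        side x∈ (inj₁ y∈) = ⊕-comm (⊕⁺ (∩ʳ {A} x∈) y∈)
        side x∈ (inj₂ y∈) = ⊕⁺ (∩ˡ x∈) y∈
      perP : Periodic J P
      perP = ∩-periodic J perA perB
      perD : Periodic J D
      perD = ∪-periodic J perA perB
      neD : Nonempty D
      neD = p , ∪ˡ (∩ˡ p∈)
      cases : _ → ∣ A ∣ + ∣ B ∣ ≤ ∣ A ⊕ B ∣ + ‖ J ‖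
      cases (yes le′) = ≤-trans (≤-reflexive (trans (sym (card-∪∩ A B)) (+-comm (∣ D ∣) (∣ P ∣))))
        (≤-trans (aperiodic m P D J (≤-trans (card-mono T⊂) small) P≤m (p , p∈) neD perP perD
            (λ h∈ → maximal (stab-complete (A ⊕ B) λ x∈ → T⊂ (stab-periodic (P ⊕ D) h∈ (T⊃ x∈)))))
          (+-monoˡ-≤ (‖ J ‖) (card-mono T⊂)))
        where
        T⊃ : A ⊕ B ⊂ P ⊕ D
        T⊃ = ⊂-antisym T⊂ le′
        P≤m : ∣ P ∣ ≤ m
        P≤m = s≤s⁻¹ (≤-trans (≤-trans (+-monoˡ-≤ (∣ P ∣) (card-positive q∈)) (≤-reflexive (card-∖ A B))) le)
      cases (no gt) = descend (‖ H ‖) (P ⊕ D) H ≤-refl (stab-maximal J (P ⊕ D) (⊕-periodicˡ J D perP)) T⊂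
          (⊕-nonempty (p , p∈) neD) (stab-periodic (P ⊕ D))
          (≤-trans (+-monoˡ-≤ _ (card≤closure P H)) (ih P D (s≤s⁻¹ (≤-trans (≰⇒> gt) small)) (p , p∈) neD))
        where
        H = stab (P ⊕ D)
        open Descent A B J small perA perB maximal using (descend)

  kneser-bounded : ∀ n A B → ∣ A ⊕ B ∣ ≤ n → Nonempty A → Nonempty B → Kneser A B
  kneser-bounded zero A B le neA neB = ⊥-elim (<-irrefl refl (≤-trans (card-positive (proj₂ (⊕-nonempty neA neB))) le))
  kneser-bounded (suc n) A B le (a , a∈) (b , b∈) =
    -- Adding the stabiliser V to both summands leaves the sum unchanged, and the relative statement
    -- with J = V is then the full bound.
    ≤-trans (Step.aperiodic n (kneser-bounded n) _ A⁺ B⁺ V (≤-trans (card-mono into) le) ≤-refl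
      (a , ⊂⊕ V a∈) (b , ⊂⊕ V b∈) (closure-periodic {V} A V (λ p → p)) (closure-periodic {V} B V (λ p → p))
      (λ h∈ → stab-complete (A ⊕ B) λ x∈ → into (stab-periodic (A⁺ ⊕ B⁺) h∈ (⊕-mono (⊂⊕ V) (⊂⊕ V) x∈))))
      (+-monoˡ-≤ (‖ V ‖) (card-mono into))
    where
    V = stab (A ⊕ B)
    A⁺ = A ⊕ set V
    B⁺ = B ⊕ set V
    into : A⁺ ⊕ B⁺ ⊂ A ⊕ B
    into p with ⊕⁻ p
    ... | _ , _ , p₁ , p₂ , refl with ⊕⁻ p₁ | ⊕⁻ p₂
    ...   | c , v , c∈ , v∈ , refl | d , w , d∈ , w∈ , refl =
      subst (_∈ A ⊕ B) (interchange c d v w) (stab-periodic (A ⊕ B) (∙∈ V v∈ w∈) (⊕⁺ c∈ d∈))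

  kneser : ∀ {A B} → Nonempty A → Nonempty B → Kneser A B
  kneser {A} {B} = kneser-bounded (∣ A ⊕ B ∣) A B ≤-refl

-- The DeVos-Goddyn-Mohar theorem

dgm-cons : ∀ v f g a b x t s → v + g ≤ b + s * v → f + v ≤ a + t * v → a + b ≤ x + v → v + (f + g) ≤ x + (t + s) * v
dgm-cons v f g a b x t s q1 q2 q3 = linear (v + (f + g)) (x + (t + s) * v) 0 (+-mono-≤ q1 (+-mono-≤ q2 q3)) (eq v f g a b x t s)
  where
  eq : ∀ v f g a b x t s → (v + (f + g)) + ((b + s * v) + ((a + t * v) + (x + v))) + 0 ≡ (x + (t + s) * v) + ((v + g) + ((f + v) + (a + b)))
  eq = solve-∀

dgm-witness : ∀ h k y w t fh fk wk → h + fh ≤ y + t * h → k + wk ≤ w + t * k → fk + h * t ≤ (wk + fh) + h → k + fk ≤ (y + w) + t * k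
dgm-witness h k y w t fh fk wk q1 q2 q3 = linear (k + fk) ((y + w) + t * k) 0 (+-mono-≤ q1 (+-mono-≤ q2 q3)) (eq h k y w t fh fk wk)
  where
  eq : ∀ h k y w t fh fk wk → (k + fk) + ((y + t * h) + ((w + t * k) + ((wk + fh) + h))) + 0 ≡ ((y + w) + t * k) + ((h + fh) + ((k + wk) + (fk + h * t)))
  eq = solve-∀

module Sequences (G : D.FiniteAbelianGroup) where

  open FiniteSets G
  open KneserTheorem G

  count : Subset → List C → ℕ
  count A []      = 0
  count A (x ∷ S) = bit (A x) + count A S

  count-mono : ∀ {A B} S → A ⊂ B → count A S ≤ count B S
  count-mono [] f = z≤n
  count-mono {A} {B} (x ∷ S) f = +-mono-≤ (bit-mono {A} {B} {x} {x} f) (count-mono S f)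

  count-⊆ : ∀ A {T S} → T ⊆ S → count A T ≤ count A S
  count-⊆ A []              = z≤n
  count-⊆ A (y ∷ʳ p)        = m≤n⇒m≤o+n _ (count-⊆ A p)
  count-⊆ A (refl ∷ p)      = +-monoʳ-≤ _ (count-⊆ A p)

  count≤length : ∀ A S → count A S ≤ length S
  count≤length A []      = z≤n
  count≤length A (x ∷ S) = +-mono-≤ (bit≤1 (A x)) (count≤length A S)

  count-coset : ∀ H {g g′} S → g′ ∈ coset H g → count (coset H g) S ≡ count (coset H g′) S
  count-coset H [] p = refl
  count-coset H (x ∷ S) p = cong₂ _+_ (cong bit (coset-value H x p)) (count-coset H S p)

  count-positive : ∀ A S → 1 ≤ count A S → Any (_∈ A) S
  count-positive A (x ∷ S) p with A x in eq
  ... | true  = here (mem eq)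
  ... | false = there (count-positive A S p)

  -- Each term lies in g + H for exactly |H| elements g.
  count-∑ : ∀ H S → ∑ (λ g → count (coset H g) S) ≡ ‖ H ‖ * length S
  count-∑ H [] = trans (∑-const 0) (trans (*-zeroʳ order) (sym (*-zeroʳ ‖ H ‖)))
  count-∑ H (x ∷ S) = trans (∑-+ (λ g → bit (coset H g x)) (λ g → count (coset H g) S))
    (trans (cong₂ _+_ (around x) (count-∑ H S)) (sym (*-suc ‖ H ‖ (length S))))
    where
    around : ∀ x → ∑ (λ g → bit (coset H g x)) ≡ ‖ H ‖
    around x = trans (∑-cong λ g → flip g) (trans (sym (card-∑ (coset H x))) (card-coset H x))
      where
      flip : ∀ g → bit (coset H g x) ≡ bit (coset H x g)
      flip g = ≤-antisym (bit-mono {coset H g} {coset H x} (coset-sym H)) (bit-mono {coset H x} {coset H g} (coset-sym H))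

  data Split : List C → List C → List C → Set where
    []    : Split [] [] []
    left  : ∀ {x S A B} → Split S A B → Split (x ∷ S) (x ∷ A) B
    right : ∀ {x S A B} → Split S A B → Split (x ∷ S) A (x ∷ B)

  all-right : ∀ S → Split S [] S
  all-right []      = []
  all-right (y ∷ S) = right (all-right S)

  split-count : ∀ P {S A B} → Split S A B → count P S ≡ count P A + count P B
  split-count P [] = refl
  split-count P (left {x} s) = trans (cong (bit (P x) +_) (split-count P s)) (sym (+-assoc (bit (P x)) _ _))
  split-count P (right {x} {A = A} {B} s) = trans (cong (bit (P x) +_) (split-count P s))
    (swap (bit (P x)) (count P A) (count P B))
    where
    swap : ∀ x a b → x + (a + b) ≡ a + (x + b)
    swap = solve-∀

  split-length : ∀ {S A B} → Split S A B → length S ≡ length A + length B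
  split-length []        = refl
  split-length (left s)  = cong suc (split-length s)
  split-length (right {A = A} s) = trans (cong suc (split-length s)) (sym (+-suc (length A) _))

  split-σ : ∀ {S A B} → Split S A B → σ S ≡ σ A ∙ σ B
  split-σ [] = sym (identityˡ ε)
  split-σ (left {x} s) = trans (cong (x ∙_) (split-σ s)) (sym (assoc x _ _))
  split-σ (right {x} {A = A} {B} s) = trans (cong (x ∙_) (split-σ s))
    (solve 3 (λ x a b → (x ⊞ (a ⊞ b)) ⊜ (a ⊞ (x ⊞ b))) refl x (σ A) (σ B))

  split-merge : ∀ {S A B T U} → Split S A B → T ⊆ A → U ⊆ B → ∃ λ W → W ⊆ S × Split W T U
  split-merge [] [] [] = [] , [] , []
  split-merge (left {x} s) (.x ∷ʳ p) q with split-merge s p q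
  ... | W , W⊆ , w = W , x ∷ʳ W⊆ , w
  split-merge (left {x} s) (refl ∷ p) q with split-merge s p q
  ... | W , W⊆ , w = x ∷ W , refl ∷ W⊆ , left w
  split-merge (right {x} s) p (.x ∷ʳ q) with split-merge s p q
  ... | W , W⊆ , w = W , x ∷ʳ W⊆ , w
  split-merge (right {x} s) p (refl ∷ q) with split-merge s p q
  ... | W , W⊆ , w = x ∷ W , refl ∷ W⊆ , right w

  inside beyond : Subset → List C → List C
  inside A [] = []
  inside A (x ∷ S) with A x
  ... | true  = x ∷ inside A S
  ... | false = inside A S
  beyond A [] = []
  beyond A (x ∷ S) with A x
  ... | true  = beyond A S
  ... | false = x ∷ beyond A S

  split-inside : ∀ A S → Split S (inside A S) (beyond A S)
  split-inside A [] = []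
  split-inside A (x ∷ S) with A x
  ... | true  = left (split-inside A S)
  ... | false = right (split-inside A S)

  length-inside : ∀ A S → length (inside A S) ≡ count A S
  length-inside A [] = refl
  length-inside A (x ∷ S) with A x
  ... | true  = cong suc (length-inside A S)
  ... | false = length-inside A S

  inside-all : ∀ A S → All (_∈ A) (inside A S)
  inside-all A [] = []
  inside-all A (x ∷ S) with A x in eq
  ... | true  = mem eq ∷ inside-all A S
  ... | false = inside-all A S

  outside-all : ∀ A S → All (_∉ A) (beyond A S)
  outside-all A [] = []
  outside-all A (x ∷ S) with A x in eq
  ... | true  = outside-all A S
  ... | false = non eq ∷ outside-all A S

  all-outside : ∀ {P : C → Set} A {S} → All P S → All P (beyond A S)
  all-outside A [] = []
  all-outside A {x ∷ S} (p ∷ ps) with A x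
  ... | true  = all-outside A ps
  ... | false = p ∷ all-outside A ps

  count-inside : ∀ A B S → B ⊂ A → count B (inside A S) ≡ count B S
  count-inside A B [] f = refl
  count-inside A B (x ∷ S) f with A x in eq
  ... | true  = cong (bit (B x) +_) (count-inside A B S f)
  ... | false = trans (count-inside A B S f) (cong (_+ count B S) (sym (bit-out (∉-intro λ p → absurd (f p) (non eq)))))

  count-outside : ∀ A B S → (∀ {x} → x ∈ B → x ∉ A) → count B (beyond A S) ≡ count B S
  count-outside A B [] f = refl
  count-outside A B (x ∷ S) f with A x in eq
  ... | false = cong (bit (B x) +_) (count-outside A B S f)
  ... | true  = trans (count-outside A B S f) (cong (_+ count B S) (sym (bit-out (∉-intro λ p → absurd (mem eq) (f p)))))

  all-⊆ : ∀ {P : C → Set} {T S} → T ⊆ S → All P S → All P T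
  all-⊆ []         []       = []
  all-⊆ (y ∷ʳ p)   (_ ∷ ps) = all-⊆ p ps
  all-⊆ (refl ∷ p) (q ∷ ps) = q ∷ all-⊆ p ps

  σ-coset : ∀ H {c} {T U} → All (_∈ coset H c) T → All (_∈ coset H c) U → length T ≡ length U → σ T ∈ coset H (σ U)
  σ-coset H [] [] eq = coset-refl H ε
  σ-coset H (p ∷ ps) (q ∷ qs) eq =
    coset-∙ H (coset-trans H (coset-sym H q) p) (σ-coset H ps qs (suc-injective eq))

  sublist-of-length : ∀ t (S : List C) → t ≤ length S → ∃ λ T → T ⊆ S × length T ≡ t
  sublist-of-length zero S le = [] , minimum S , refl
  sublist-of-length (suc t) (x ∷ S) (s≤s le) with sublist-of-length t S le
  ... | T , p , eq = x ∷ T , refl ∷ p , cong suc eq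

  zeroSet : Subset
  zeroSet x = ⌊ x ≟ ε ⌋

  zero⁺ : ε ∈ zeroSet
  zero⁺ with ε ≟ ε in eq
  ... | yes _ = mem (cong ⌊_⌋ eq)
  ... | no ¬p = ⊥-elim (¬p refl)

  zero⁻ : ∀ {x} → x ∈ zeroSet → x ≡ ε
  zero⁻ {x} (mem p) with x ≟ ε
  ... | yes eq = eq

  sums : ℕ → List C → Subset
  sums zero    S       = zeroSet
  sums (suc k) []      = λ _ → false
  sums (suc k) (x ∷ S) = translate x (sums k S) ∪ sums (suc k) S

  sums⁺ : ∀ {T S} → T ⊆ S → σ T ∈ sums (length T) S
  sums⁺ {[]} p = zero⁺
  sums⁺ {x ∷ T} (y ∷ʳ p)   = ∪ʳ {translate y (sums (length T) _)} (sums⁺ p)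
  sums⁺ {x ∷ T} {_ ∷ S} (refl ∷ p) = ∪ˡ (translate⁺ {x} {sums (length T) S} (sums⁺ p))

  sums⁻ : ∀ k S {x} → x ∈ sums k S → ∃ λ T → T ⊆ S × length T ≡ k × σ T ≡ x
  sums⁻ zero S p = [] , minimum S , refl , sym (zero⁻ p)
  sums⁻ (suc k) (x ∷ S) p with ∪⁻ {translate x (sums k S)} p
  ... | inj₂ q with sums⁻ (suc k) S q
  ...   | T , T⊆ , l , s = T , x ∷ʳ T⊆ , l , s
  sums⁻ (suc k) (x ∷ S) p | inj₁ q with translate⁻ {x} {sums k S} q
  ... | y , y∈ , refl with sums⁻ k S y∈
  ...   | T , T⊆ , refl , refl = x ∷ T , refl ∷ T⊆ , refl , refl

  -- A list of pairs (S, t) stands for the sumset of the sets of t-term sums of the S. A single pair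
  -- would not survive the induction: peeling splits one block into two, and restricting to an
  -- H-coset splits it by cosets.
  Blocks : Set
  Blocks = List (List C × ℕ)

  X : Blocks → Subset
  X []             = zeroSet
  X ((S , t) ∷ bs) = sums t S ⊕ X bs

  total : Blocks → ℕ
  total []             = 0
  total ((S , t) ∷ bs) = t + total bs

  -- Summed over elements instead of cosets, hence |H| times the usual coset sum. No representatives
  -- are needed, and the inequality appears multiplied by |H|.
  bound : Sub → List C → ℕ → ℕ
  bound H S t = ∑ (λ g → t ⊓ count (coset H g) S)

  bounds : Sub → Blocks → ℕ
  bounds H []             = 0
  bounds H ((S , t) ∷ bs) = bound H S t + bounds H bs

  Valid : Blocks → Set
  Valid = All (λ b → proj₂ b ≤ length (proj₁ b))

  bound-mono : ∀ H K S t → H ≤ₛ K → bound H S t ≤ bound K S t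
  bound-mono H K S t le = ∑-mono λ g → ⊓-monoʳ-≤ t (count-mono S (coset-mono {H} {K} le {g}))

  bounds-mono : ∀ H K bs → H ≤ₛ K → bounds H bs ≤ bounds K bs
  bounds-mono H K [] le = z≤n
  bounds-mono H K ((S , t) ∷ bs) le = +-mono-≤ (bound-mono H K S t le) (bounds-mono H K bs le)

  X-nonempty : ∀ {bs} → Valid bs → Nonempty (X bs)
  X-nonempty [] = ε , zero⁺
  X-nonempty {(S , t) ∷ bs} (le ∷ ok) with sublist-of-length t S le
  ... | T , p , eq = ⊕-nonempty (σ T , subst (λ k → σ T ∈ sums k S) eq (sums⁺ p)) (X-nonempty ok)

  -- The chosen subsequences themselves, not only their sums: the fibres through an element depend
  -- on how it is represented.
  data Choice : Blocks → Set where
    []   : Choice []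
    pick : ∀ {S t bs} T → T ⊆ S → length T ≡ t → Choice bs → Choice ((S , t) ∷ bs)

  value : ∀ {bs} → Choice bs → C
  value []             = ε
  value (pick T _ _ c) = σ T ∙ value c

  choose : ∀ bs {x} → x ∈ X bs → ∃ λ (c : Choice bs) → value c ≡ x
  choose [] p = [] , sym (zero⁻ p)
  choose ((S , t) ∷ bs) p with ⊕⁻ p
  ... | a , b , a∈ , b∈ , refl with sums⁻ t S a∈ | choose bs b∈
  ...   | T , T⊆ , l , refl | c , refl = pick T T⊆ l c , refl

  X-++⁻ : ∀ as bs {x} → x ∈ X (as ++ bs) → ∃ λ a → ∃ λ b → a ∈ X as × b ∈ X bs × x ≡ a ∙ b
  X-++⁻ [] bs {x} p = ε , x , zero⁺ , p , sym (identityˡ x)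
  X-++⁻ ((S , t) ∷ as) bs p with ⊕⁻ p
  ... | a , _ , a∈ , q , refl with X-++⁻ as bs q
  ...   | b , d , b∈ , d∈ , refl = a ∙ b , d , ⊕⁺ a∈ b∈ , d∈ , sym (assoc a b d)

  total-++ : ∀ as bs → total (as ++ bs) ≡ total as + total bs
  total-++ [] bs = refl
  total-++ ((S , t) ∷ as) bs = trans (cong (t +_) (total-++ as bs)) (sym (+-assoc t _ _))

  bounds-++ : ∀ H as bs → bounds H (as ++ bs) ≡ bounds H as + bounds H bs
  bounds-++ H [] bs = refl
  bounds-++ H ((S , t) ∷ as) bs = trans (cong (bound H S t +_) (bounds-++ H as bs)) (sym (+-assoc (bound H S t) _ _))

  valid-++ : ∀ {as bs} → Valid as → Valid bs → Valid (as ++ bs)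
  valid-++ [] q = q
  valid-++ (p ∷ ps) q = p ∷ valid-++ ps q

  Covered : Sub → List C → List C → Set
  Covered H ds = All (λ x → Any (λ d → x ∈ coset H d) ds)

  covered-self : ∀ H T → Covered H T T
  covered-self H T = All.tabulate λ {x} x∈ → Any.map (λ { refl → coset-refl H x }) x∈

  covered-step : ∀ H {d ds T} → Covered H (d ∷ ds) T → Covered H ds (beyond (coset H d) T)
  covered-step H {d} {ds} {T} cov = All.zipWith drop (all-outside (coset H d) cov , outside-all (coset H d) T)
    where
    drop : ∀ {x} → Any (λ d → x ∈ coset H d) (d ∷ ds) × x ∉ coset H d → Any (λ d → x ∈ coset H d) ds
    drop (here p , q)  = absurd p q
    drop (there p , q) = p

  -- The blocks of S met by T, one for each H-coset, with the multiplicities of T;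
  -- ds lists representatives of the cosets still to be treated.
  fibre : Sub → List C → List C → List C → Blocks
  fibre H [] S T       = []
  fibre H (d ∷ ds) S T = (inside (coset H d) S , count (coset H d) T) ∷ fibre H ds (beyond (coset H d) S) (beyond (coset H d) T)

  count-split-length : ∀ A T → length T ≡ count A T + length (beyond A T)
  count-split-length A T = trans (split-length (split-inside A T)) (cong (_+ length (beyond A T)) (length-inside A T))

  outside-⊆ : ∀ A {T S} → T ⊆ S → beyond A T ⊆ beyond A S
  outside-⊆ A [] = []
  outside-⊆ A (y ∷ʳ p) with A y
  ... | true  = outside-⊆ A p
  ... | false = y ∷ʳ outside-⊆ A p
  outside-⊆ A {x ∷ T} (refl ∷ p) with A x
  ... | true  = outside-⊆ A p
  ... | false = refl ∷ outside-⊆ A p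

  fibre-valid : ∀ H ds {S T} → T ⊆ S → Valid (fibre H ds S T)
  fibre-valid H [] p = []
  fibre-valid H (d ∷ ds) {S} p =
    ≤-trans (count-⊆ (coset H d) p) (≤-reflexive (sym (length-inside (coset H d) S))) ∷ fibre-valid H ds (outside-⊆ _ p)

  fibre-total : ∀ H ds S T → Covered H ds T → total (fibre H ds S T) ≡ length T
  fibre-total H [] S [] [] = refl
  fibre-total H [] S (_ ∷ _) (() ∷ _)
  fibre-total H (d ∷ ds) S T cov = trans (cong (count (coset H d) T +_) (fibre-total H ds _ _ (covered-step H cov)))
    (sym (count-split-length (coset H d) T))

  fibre⁻ : ∀ H ds S T → Covered H ds T → ∀ {y} → y ∈ X (fibre H ds S T) →
           ∃ λ U → U ⊆ S × length U ≡ length T × σ U ≡ y × σ U ∈ coset H (σ T)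
  fibre⁻ H [] S [] [] p = [] , minimum S , refl , sym (zero⁻ p) , coset-refl H ε
  fibre⁻ H [] S (_ ∷ _) (() ∷ _) p
  fibre⁻ H (d ∷ ds) S T cov p with ⊕⁻ p
  ... | _ , _ , p₁ , p₂ , refl with sums⁻ _ _ p₁ | fibre⁻ H ds _ _ (covered-step H cov) p₂
  ...   | U₁ , U₁⊆ , l₁ , refl | U₂ , U₂⊆ , l₂ , refl , in₂ with split-merge (split-inside (coset H d) S) U₁⊆ U₂⊆
  ...     | U , U⊆ , s = U , U⊆ ,
            trans (split-length s) (trans (cong₂ _+_ l₁ l₂) (sym (count-split-length (coset H d) T))) , split-σ s ,
            subst₂ (λ a b → a ∈ coset H b) (sym (split-σ s)) (sym (split-σ (split-inside (coset H d) T)))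
              (coset-∙ H (σ-coset H (all-⊆ U₁⊆ (inside-all (coset H d) S)) (inside-all (coset H d) T)
                (trans l₁ (sym (length-inside (coset H d) T)))) in₂)

  fibre-bound : ∀ H K ds S T → K ≤ₛ H → Covered H ds T →
    ∑ (λ g → count (coset H g) T ⊓ count (coset K g) S) ≤ bounds K (fibre H ds S T)
  fibre-bound H K [] S [] le [] = ≤-reflexive (trans (∑-const 0) (*-zeroʳ order))
  fibre-bound H K [] S (_ ∷ _) le (() ∷ _)
  fibre-bound H K (d ∷ ds) S T le cov = ≤-trans (∑-mono pt) (≤-trans (≤-reflexive (∑-+ (λ g → count c T ⊓ count (coset K g) (inside c S))
      (λ g → count (coset H g) (beyond c T) ⊓ count (coset K g) (beyond c S))))
    (+-monoʳ-≤ (bound K (inside c S) (count c T)) (fibre-bound H K ds (beyond c S) (beyond c T) le (covered-step H cov))))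
    where
    c = coset H d
    pt : ∀ g → count (coset H g) T ⊓ count (coset K g) S ≤
           (count c T ⊓ count (coset K g) (inside c S)) +
           (count (coset H g) (beyond c T) ⊓ count (coset K g) (beyond c S))
    pt g = by-member c g
      (λ p → ≤-trans (≤-reflexive (cong₂ _⊓_ (sym (count-coset H T p))
                 (sym (count-inside c (coset K g) S λ q → coset-trans H p (coset-mono {K} {H} le q))))) (m≤m+n _ _))
      (λ p → ≤-trans (≤-reflexive (cong₂ _⊓_
                 (sym (count-outside c (coset H g) T λ q → ∉-intro λ r → absurd (coset-trans H r (coset-sym H q)) p))
                 (sym (count-outside c (coset K g) S λ q → ∉-intro λ r →
                   absurd (coset-trans H r (coset-sym H (coset-mono {K} {H} le q))) p)))) (m≤n+m _ _))

  fibres : ∀ H {bs} → Choice bs → Blocks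
  fibres H [] = []
  fibres H {(S , _) ∷ _} (pick T p _ c) = fibre H T S T ++ fibres H c

  fibres-valid : ∀ H {bs} (c : Choice bs) → Valid (fibres H c)
  fibres-valid H [] = []
  fibres-valid H (pick T p refl c) = valid-++ (fibre-valid H T p) (fibres-valid H c)

  fibres-total : ∀ H {bs} (c : Choice bs) → total (fibres H c) ≡ total bs
  fibres-total H [] = refl
  fibres-total H {(S , _) ∷ _} (pick T p refl c) = trans (total-++ (fibre H T S T) (fibres H c))
    (cong₂ _+_ (fibre-total H T S T (covered-self H T)) (fibres-total H c))

  fibres⁻ : ∀ H {bs} (c : Choice bs) {y} → y ∈ X (fibres H c) → y ∈ X bs × y ∈ coset H (value c)
  fibres⁻ H [] p = p , subst (_∈ coset H ε) (sym (zero⁻ p)) (coset-refl H ε)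
  fibres⁻ H {(S , _) ∷ _} (pick T q refl c) p with X-++⁻ (fibre H T S T) (fibres H c) p
  ... | a , b , a∈ , b∈ , refl with fibre⁻ H T S T (covered-self H T) a∈ | fibres⁻ H c b∈
  ...   | U , U⊆ , l , refl , inU | b∈X , inb =
          ⊕⁺ (subst (λ k → σ U ∈ sums k S) l (sums⁺ U⊆)) b∈X , coset-∙ H inU inb

  fibres-bound : ∀ H K {bs} → K ≤ₛ H → (c : Choice bs) → bounds K bs + ‖ H ‖ * total bs ≤ bounds K (fibres H c) + bounds H bs
  -- Holds for each g. Let τ count `T` in g + H, and let k ≤ h count `S` in g + K and g + H. Then
  -- min(t, k) + τ ≤ min(τ, k) + min(t, h), because τ ≤ t and τ ≤ h.
  block-bound : ∀ H K {S T} → K ≤ₛ H → T ⊆ S →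
    bound K S (length T) + ‖ H ‖ * length T ≤ bounds K (fibre H T S T) + bound H S (length T)

  block-bound H K {S} {T} le p = begin
    bound K S t + ‖ H ‖ * t
      ≡⟨ cong (bound K S t +_) (sym (count-∑ H T)) ⟩
    bound K S t + ∑ (λ g → count (coset H g) T)
      ≡⟨ sym (∑-+ (λ g → t ⊓ count (coset K g) S) (λ g → count (coset H g) T)) ⟩
    ∑ (λ g → (t ⊓ count (coset K g) S) + count (coset H g) T)
      ≤⟨ ∑-mono (λ g → pt (count (coset H g) T) t (count (coset K g) S) (count (coset H g) S)
           (count≤length (coset H g) T) (count-⊆ (coset H g) p) (count-mono S (coset-mono {K} {H} le {g}))) ⟩
    ∑ (λ g → (count (coset H g) T ⊓ count (coset K g) S) + (t ⊓ count (coset H g) S))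
      ≡⟨ ∑-+ (λ g → count (coset H g) T ⊓ count (coset K g) S) (λ g → t ⊓ count (coset H g) S) ⟩
    ∑ (λ g → count (coset H g) T ⊓ count (coset K g) S) + bound H S t
      ≤⟨ +-monoˡ-≤ (bound H S t) (fibre-bound H K T S T le (covered-self H T)) ⟩
    bounds K (fibre H T S T) + bound H S t ∎
    where
    open ≤-Reasoning
    t = length T
    pt : ∀ τ t k h → τ ≤ t → τ ≤ h → k ≤ h → (t ⊓ k) + τ ≤ (τ ⊓ k) + (t ⊓ h)
    pt τ t k h τ≤t τ≤h k≤h with ≤-total τ k
    ... | inj₁ τ≤k = ≤-trans (≤-reflexive (+-comm (t ⊓ k) τ))
            (+-mono-≤ (≤-reflexive (sym (m≤n⇒m⊓n≡m τ≤k))) (⊓-monoʳ-≤ t k≤h))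
    ... | inj₂ k≤τ = +-mono-≤ (≤-reflexive (trans (m≥n⇒m⊓n≡n (≤-trans k≤τ τ≤t)) (sym (m≥n⇒m⊓n≡n k≤τ))))
            (⊓-glb τ≤t τ≤h)

  add-bounds : ∀ a b c x y z u w n s → a + n * s ≤ b + c → x + n * z ≤ u + y + w → (a + x) + n * (s + z) ≤ (b + u) + (c + y) + w
  add-bounds a b c x y z u w n s p q = linear ((a + x) + n * (s + z)) ((b + u) + (c + y) + w) 0 (+-mono-≤ p q) (eq a b c x y z u w n s)
    where
    eq : ∀ a b c x y z u w n s → ((a + x) + n * (s + z)) + ((b + c) + (u + y + w)) + 0 ≡ ((b + u) + (c + y) + w) + ((a + n * s) + (x + n * z))
    eq = solve-∀

  fibres-bound H K le [] = ≤-reflexive (*-zeroʳ ‖ H ‖)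
  fibres-bound H K {(S , _) ∷ bs} le (pick T p refl c) = begin
    (bound K S (length T) + bounds K bs) + ‖ H ‖ * (length T + total bs)
      ≤⟨ add-bounds (bound K S (length T)) (bounds K (fibre H T S T)) (bound H S (length T)) (bounds K bs) (bounds H bs) (total bs)
           (bounds K (fibres H c)) 0 (‖ H ‖) (length T) (block-bound H K le p)
           (≤-trans (fibres-bound H K le c) (≤-reflexive (sym (+-identityʳ _)))) ⟩
    (bounds K (fibre H T S T) + bounds K (fibres H c)) + (bound H S (length T) + bounds H bs) + 0
      ≡⟨ +-identityʳ _ ⟩
    (bounds K (fibre H T S T) + bounds K (fibres H c)) + (bound H S (length T) + bounds H bs)
      ≡⟨ cong (_+ (bound H S (length T) + bounds H bs)) (sym (bounds-++ K (fibre H T S T) (fibres H c))) ⟩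
    bounds K (fibre H T S T ++ fibres H c) + (bound H S (length T) + bounds H bs) ∎
    where open ≤-Reasoning

  -- S is divided into A and B such that the pair of blocks (A , 1), (B , suc m) has the same
  -- J-bound as (S , 2 + m), and loses at most one unit in each H-coset for H above J.
  record Peeling (J : Sub) (m : ℕ) (S A B : List C) : Set where
    field
      split : Split S A B
      neA   : 1 ≤ length A
      longB : suc m ≤ length B
      keep  : ∀ g → (2 + m) ⊓ count (coset J g) S ≤ (1 ⊓ count (coset J g) A) + (suc m ⊓ count (coset J g) B)
      safe  : ∀ H → J ≤ₛ H → ∀ g → count (coset H g) A ≤ 1 ⊎ suc m ≤ count (coset H g) B

  data Peel (J : Sub) : Blocks → Blocks → Set where
    here  : ∀ {m S A B bs} → Peeling J m S A B → Peel J ((S , 2 + m) ∷ bs) ((A , 1) ∷ (B , suc m) ∷ bs)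
    there : ∀ {b bs bs′} → Peel J bs bs′ → Peel J (b ∷ bs) (b ∷ bs′)

  excess : Blocks → ℕ
  excess []             = 0
  excess ((S , t) ∷ bs) = (t ∸ 1) + excess bs

  step-excess : ∀ {J bs bs′} → Peel J bs bs′ → suc (excess bs′) ≤ excess bs
  step-excess (here p) = ≤-refl
  step-excess (there {S , t} s) = ≤-trans (≤-reflexive (sym (+-suc (t ∸ 1) _))) (+-monoʳ-≤ (t ∸ 1) (step-excess s))

  step-total : ∀ {J bs bs′} → Peel J bs bs′ → total bs′ ≡ total bs
  step-total (here p) = refl
  step-total (there {S , t} s) = cong (t +_) (step-total s)

  step-valid : ∀ {J bs bs′} → Peel J bs bs′ → Valid bs → Valid bs′
  step-valid (here p) (_ ∷ ok) = Peeling.neA p ∷ Peeling.longB p ∷ ok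
  step-valid (there s) (le ∷ ok) = le ∷ step-valid s ok

  step-⊂ : ∀ {J bs bs′} → Peel J bs bs′ → X bs′ ⊂ X bs
  step-⊂ (there s) = ⊕-mono (λ p → p) (step-⊂ s)
  step-⊂ (here {m} {S} {A} {B} {bs} P) p with ⊕⁻ (⊕-assoc p)
  ... | _ , b , q , b∈ , refl with ⊕⁻ q
  ...   | _ , _ , a₁ , a₂ , refl with sums⁻ 1 A a₁ | sums⁻ (suc m) B a₂
  ...     | T , T⊆ , l₁ , refl | U , U⊆ , l₂ , refl with split-merge (Peeling.split P) T⊆ U⊆
  ...       | W , W⊆ , s = ⊕⁺ (subst₂ (λ k w → w ∈ sums k S) (trans (split-length s) (cong₂ _+_ l₁ l₂)) (split-σ s) (sums⁺ W⊆)) b∈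

  step-keep : ∀ {J bs bs′} → Peel J bs bs′ → bounds J bs ≤ bounds J bs′
  step-keep (there {S , t} s) = +-monoʳ-≤ _ (step-keep s)
  step-keep {J} (here {m} {S} {A} {B} {bs} P) = ≤-trans (+-monoˡ-≤ (bounds J bs)
    (≤-trans (∑-mono (Peeling.keep P)) (≤-reflexive (∑-+ (λ g → 1 ⊓ count (coset J g) A) (λ g → suc m ⊓ count (coset J g) B)))))
    (≤-reflexive (+-assoc (bound J A 1) (bound J B (suc m)) (bounds J bs)))

  -- The comparison of `block-bound` for a peeled block. It may now fail by one, but only at those g
  -- for which g + H contains all of `T`; there are at most |H| of these, hence the extra summand.
  peeling-bound : ∀ {J m S A B} → Peeling J m S A B → ∀ H K {T} → J ≤ₛ H → K ≤ₛ H → T ⊆ S → length T ≡ 2 + m →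
    (bound K A 1 + bound K B (suc m)) + ‖ H ‖ * (2 + m) ≤ bounds K (fibre H T S T) + (bound H A 1 + bound H B (suc m)) + ‖ H ‖
  peeling-bound {J} {m} {S} {A} {B} P H K {T} J≤H K≤H T⊆ len = begin
    (bound K A 1 + bound K B (suc m)) + ‖ H ‖ * t
      ≡⟨ cong (bound K A 1 + bound K B (suc m) +_) (trans (cong (‖ H ‖ *_) (sym len)) (sym (count-∑ H T))) ⟩
    (bound K A 1 + bound K B (suc m)) + ∑ τ
      ≡⟨ sym (trans (∑-+ (f K) τ) (cong (_+ ∑ τ) (∑-+ (λ g → 1 ⊓ a K g) (λ g → suc m ⊓ b K g)))) ⟩
    ∑ (λ g → f K g + τ g)
      ≤⟨ ∑-mono pt ⟩
    ∑ (λ g → (τ g ⊓ count (coset K g) S) + f H g + full? g)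
      ≡⟨ trans (∑-+ (λ g → (τ g ⊓ count (coset K g) S) + f H g) full?) (cong (_+ ∑ full?)
           (trans (∑-+ (λ g → τ g ⊓ count (coset K g) S) (f H))
             (cong (∑ (λ g → τ g ⊓ count (coset K g) S) +_) (∑-+ (λ g → 1 ⊓ a H g) (λ g → suc m ⊓ b H g))))) ⟩
    ∑ (λ g → τ g ⊓ count (coset K g) S) + (bound H A 1 + bound H B (suc m)) + ∑ full?
      ≤⟨ +-mono-≤ (+-monoˡ-≤ (bound H A 1 + bound H B (suc m)) (fibre-bound H K T S T K≤H (covered-self H T))) few-full ⟩
    bounds K (fibre H T S T) + (bound H A 1 + bound H B (suc m)) + ‖ H ‖ ∎
    where
    open ≤-Reasoning
    t = 2 + m
    τ : C → ℕ
    τ g = count (coset H g) T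
    a b f : Sub → C → ℕ
    a V g = count (coset V g) A
    b V g = count (coset V g) B
    f V g = (1 ⊓ a V g) + (suc m ⊓ b V g)
    full? : C → ℕ
    full? g with t ≤? τ g
    ... | yes _ = 1
    ... | no _  = 0
    few-full : ∑ full? ≤ ‖ H ‖
    few-full = *-cancelˡ-≤ t (begin
      t * ∑ full?          ≡⟨ sym (∑-* t full?) ⟩
      ∑ (λ g → t * full? g) ≤⟨ ∑-mono below ⟩
      ∑ τ                  ≡⟨ count-∑ H T ⟩
      ‖ H ‖ * length T     ≡⟨ trans (cong (‖ H ‖ *_) len) (*-comm (‖ H ‖) t) ⟩
      t * ‖ H ‖            ∎)
      where
      below : ∀ g → t * full? g ≤ τ g
      below g with t ≤? τ g
      ... | yes p = ≤-trans (≤-reflexive (*-identityʳ t)) p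
      ... | no _  = ≤-trans (≤-reflexive (*-zeroʳ t)) z≤n
    pt : ∀ g → f K g + τ g ≤ (τ g ⊓ count (coset K g) S) + f H g + full? g
    pt g with t ≤? τ g
    ... | yes full = weigh (≤-trans (count≤length (coset H g) T) (≤-reflexive len)) full
      where
      v = count (coset K g) S
      v≡ : v ≡ a K g + b K g
      v≡ = split-count (coset K g) (Peeling.split P)
      fK≤v : f K g ≤ v
      fK≤v = ≤-trans (+-mono-≤ (m⊓n≤n 1 (a K g)) (m⊓n≤n (suc m) (b K g))) (≤-reflexive (sym v≡))
      fK≤t : f K g ≤ t
      fK≤t = +-mono-≤ (m⊓n≤m 1 (a K g)) (m⊓n≤m (suc m) (b K g))
      big : suc m ≤ f H g
      big = enough (Peeling.safe P H J≤H g)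
        where
        total≥ : t ≤ a H g + b H g
        total≥ = ≤-trans full (≤-trans (count-⊆ (coset H g) T⊆) (≤-reflexive (split-count (coset H g) (Peeling.split P))))
        enough : a H g ≤ 1 ⊎ suc m ≤ b H g → suc m ≤ f H g
        enough (inj₁ a≤1) = ≤-trans (⊓-glb ≤-refl (s≤s⁻¹ (≤-trans total≥ (+-monoˡ-≤ (b H g) a≤1)))) (m≤n+m _ (1 ⊓ a H g))
        enough (inj₂ m≤b) = ≤-trans (⊓-glb ≤-refl m≤b) (m≤n+m _ (1 ⊓ a H g))
      weigh : τ g ≤ t → t ≤ τ g → f K g + τ g ≤ (τ g ⊓ v) + f H g + 1
      weigh le ge = ≤-trans (+-mono-≤ (⊓-glb (≤-trans fK≤t ge) fK≤v) (≤-trans le (s≤s big)))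
        (≤-reflexive (trans (cong ((τ g ⊓ v) +_) (+-comm 1 (f H g))) (sym (+-assoc (τ g ⊓ v) (f H g) 1))))
    ... | no notfull = ≤-trans (weigh (≤-total (τ g) v)) (≤-reflexive (sym (+-identityʳ _)))
      where
      v = count (coset K g) S
      fK≤v : f K g ≤ v
      fK≤v = ≤-trans (+-mono-≤ (m⊓n≤n 1 (a K g)) (m⊓n≤n (suc m) (b K g))) (≤-reflexive (sym (split-count (coset K g) (Peeling.split P))))
      fK≤fH : f K g ≤ f H g
      fK≤fH = +-mono-≤ (⊓-monoʳ-≤ 1 (count-mono A (coset-mono {K} {H} K≤H {g}))) (⊓-monoʳ-≤ (suc m) (count-mono B (coset-mono {K} {H} K≤H {g})))
      τ≤m : τ g ≤ suc m
      τ≤m = s≤s⁻¹ (≰⇒> notfull)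
      τ≤ab : τ g ≤ a H g + b H g
      τ≤ab = ≤-trans (count-⊆ (coset H g) T⊆) (≤-reflexive (split-count (coset H g) (Peeling.split P)))
      τ≤fH : τ g ≤ f H g
      τ≤fH with Peeling.safe P H J≤H g | ≤-total (suc m) (b H g)
      ... | inj₂ m≤b | _ = ≤-trans (⊓-glb τ≤m (≤-trans τ≤m m≤b)) (m≤n+m _ (1 ⊓ a H g))
      ... | inj₁ a≤1 | inj₁ m≤b = ≤-trans (⊓-glb τ≤m (≤-trans τ≤m m≤b)) (m≤n+m _ (1 ⊓ a H g))
      ... | inj₁ a≤1 | inj₂ b≤m = ≤-trans τ≤ab (≤-reflexive (cong₂ _+_ (sym (m≥n⇒m⊓n≡n a≤1)) (sym (m≥n⇒m⊓n≡n b≤m))))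
      weigh : τ g ≤ v ⊎ v ≤ τ g → f K g + τ g ≤ (τ g ⊓ v) + f H g
      weigh (inj₁ τ≤v) = ≤-trans (≤-reflexive (+-comm (f K g) (τ g))) (+-mono-≤ (≤-reflexive (sym (m≤n⇒m⊓n≡m τ≤v))) fK≤fH)
      weigh (inj₂ v≤τ) = +-mono-≤ (≤-trans fK≤v (≤-reflexive (sym (m≥n⇒m⊓n≡n v≤τ)))) τ≤fH

  step-bound : ∀ {J bs bs′} → Peel J bs bs′ → ∀ H K → J ≤ₛ H → K ≤ₛ H → (c : Choice bs) →
    bounds K bs′ + ‖ H ‖ * total bs ≤ bounds K (fibres H c) + bounds H bs′ + ‖ H ‖
  step-bound {bs = (S , t) ∷ bs} (there {bs′ = bs′} s) H K J≤H K≤H (pick T p refl c) = begin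
    (bound K S t + bounds K bs′) + ‖ H ‖ * (t + total bs)
      ≤⟨ add-bounds (bound K S t) (bounds K (fibre H T S T)) (bound H S t) (bounds K bs′) (bounds H bs′) (total bs)
           (bounds K (fibres H c)) (‖ H ‖) (‖ H ‖) t (block-bound H K K≤H p) (step-bound s H K J≤H K≤H c) ⟩
    (bounds K (fibre H T S T) + bounds K (fibres H c)) + (bound H S t + bounds H bs′) + ‖ H ‖
      ≡⟨ cong (λ z → z + (bound H S t + bounds H bs′) + ‖ H ‖) (sym (bounds-++ K (fibre H T S T) (fibres H c))) ⟩
    bounds K (fibre H T S T ++ fibres H c) + (bound H S t + bounds H bs′) + ‖ H ‖ ∎
    where open ≤-Reasoning
  step-bound (here {m} {S} {A} {B} {bs} P) H K J≤H K≤H (pick T p len c) = begin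
    (bound K A 1 + (bound K B (suc m) + bounds K bs)) + ‖ H ‖ * (2 + m + total bs)
      ≤⟨ combine (bound K A 1) (bound K B (suc m)) (bounds K bs) (‖ H ‖) (2 + m) (total bs)
           (bounds K (fibre H T S T)) (bounds K (fibres H c)) (bound H A 1) (bound H B (suc m)) (bounds H bs)
           (peeling-bound P H K J≤H K≤H p len) (fibres-bound H K K≤H c) ⟩
    (bounds K (fibre H T S T) + bounds K (fibres H c)) + (bound H A 1 + (bound H B (suc m) + bounds H bs)) + ‖ H ‖
      ≡⟨ cong (λ z → z + (bound H A 1 + (bound H B (suc m) + bounds H bs)) + ‖ H ‖) (sym (bounds-++ K (fibre H T S T) (fibres H c))) ⟩
    bounds K (fibre H T S T ++ fibres H c) + (bound H A 1 + (bound H B (suc m) + bounds H bs)) + ‖ H ‖ ∎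
    where
    open ≤-Reasoning
    combine : ∀ a b x h t s u w a′ b′ x′ → (a + b) + h * t ≤ u + (a′ + b′) + h → x + h * s ≤ w + x′ →
              (a + (b + x)) + h * (t + s) ≤ (u + w) + (a′ + (b′ + x′)) + h
    combine a b x h t s u w a′ b′ x′ p q = linear _ _ 0 (+-mono-≤ p q) (eq a b x h t s u w a′ b′ x′)
      where
      eq : ∀ a b x h t s u w a′ b′ x′ → ((a + (b + x)) + h * (t + s)) + ((u + (a′ + b′) + h) + (w + x′)) + 0
             ≡ ((u + w) + (a′ + (b′ + x′)) + h) + (((a + b) + h * t) + (x + h * s))
      eq = solve-∀

  representatives : ∀ (J : Sub) (big : Subset) (R : List C) → Periodic J big → ∃ λ A → ∃ λ B → Split R A B ×
    (∀ g → g ∈ big → count (coset J g) A ≡ 1 ⊓ count (coset J g) R) × All (_∈ big) A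
  representatives J big [] per = [] , [] , [] , (λ _ _ → refl) , []
  representatives J big (x ∷ R) per with representatives J big R per
  ... | A , B , s , exact , inBig = by-member big x put skip
    where
    Goal = ∃ λ A → ∃ λ B → Split (x ∷ R) A B ×
      (∀ g → g ∈ big → count (coset J g) A ≡ 1 ⊓ count (coset J g) (x ∷ R)) × All (_∈ big) A
    skip : x ∉ big → Goal
    skip x∉ = A , x ∷ B , right s , (λ g g∈ → trans (exact g g∈) (cong (λ k → 1 ⊓ (k + count (coset J g) R))
      (sym (bit-out {coset J g} (∉-intro λ p → absurd (periodic-coset J per g∈ p) x∉))))) , inBig
    put : x ∈ big → Goal
    put x∈ with count (coset J x) R in eq
    ... | zero = x ∷ A , B , left s , (λ g g∈ → by-member (coset J g) x
            (λ p → trans (cong₂ _+_ (bit-in p) (trans (exact g g∈) (cong (1 ⊓_) (trans (count-coset J R p) eq))))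
                    (cong (1 ⊓_) (sym (cong (_+ count (coset J g) R) (bit-in {coset J g} p)))))
            (λ p → trans (cong₂ _+_ (bit-out {coset J g} p) (exact g g∈)) (cong (λ k → 1 ⊓ (k + count (coset J g) R)) (sym (bit-out {coset J g} p))))) , x∈ ∷ inBig
    ... | suc k = A , x ∷ B , right s , (λ g g∈ → by-member (coset J g) x
            (λ p → trans (exact g g∈) (trans (cong (1 ⊓_) (trans (count-coset J R p) eq))
                    (sym (cong (λ j → 1 ⊓ (j + count (coset J g) R)) (bit-in {coset J g} p)))))
            (λ p → trans (exact g g∈) (cong (λ j → 1 ⊓ (j + count (coset J g) R)) (sym (bit-out {coset J g} p))))) , inBig

  atLeast : Sub → ℕ → List C → Subset
  atLeast J t S g = ⌊ t ≤? count (coset J g) S ⌋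

  atLeast⁺ : ∀ {J t S g} → t ≤ count (coset J g) S → g ∈ atLeast J t S
  atLeast⁺ {J} {t} {S} {g} p with t ≤? count (coset J g) S in eq
  ... | yes _ = mem (cong ⌊_⌋ eq)
  ... | no ¬p = ⊥-elim (¬p p)

  atLeast⁻ : ∀ {J t S g} → g ∈ atLeast J t S → t ≤ count (coset J g) S
  atLeast⁻ {J} {t} {S} {g} (mem p) with t ≤? count (coset J g) S
  ... | yes q = q

  atLeast-periodic : ∀ J t S → Periodic J (atLeast J t S)
  atLeast-periodic J t S {x} h∈ p =
    atLeast⁺ {J} {t} {S} (≤-trans (atLeast⁻ {J} {t} {S} p) (≤-reflexive (count-coset J S (coset-∙ʳ J x h∈))))

  -- `A` takes one term from each J-coset holding at least 2 + m terms of `S`. Such a coset gives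
  -- one unit to `A` and keeps 1 + m terms in `B`; a lighter coset loses nothing. If no coset is
  -- heavy, any single term may be peeled.
  peeling : ∀ J m S → 2 + m ≤ length S → ∃ λ A → ∃ λ B → Peeling J m S A B
  peeling J m [] ()
  peeling J m (x ∷ S′) len with representatives J (atLeast J (2 + m) (x ∷ S′)) (x ∷ S′) (atLeast-periodic J (2 + m) (x ∷ S′))
  ... | [] , B , s , exact , inBig = x ∷ [] , S′ , record
    { split = left (all-right S′) ; neA = ≤-refl ; longB = s≤s⁻¹ len
    ; keep = keep′
    ; safe = λ H _ g → inj₁ (≤-trans (≤-reflexive (+-identityʳ _)) (bit≤1 (coset H g x))) }
    where
    keep′ : ∀ g → (2 + m) ⊓ count (coset J g) (x ∷ S′) ≤ (1 ⊓ count (coset J g) (x ∷ [])) + (suc m ⊓ count (coset J g) S′)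
    keep′ g with (2 + m) ≤? count (coset J g) (x ∷ S′)
    ... | yes full = ⊥-elim (0≢1+n (trans (exact g (atLeast⁺ {J} {2 + m} {x ∷ S′} full))
                       (m≤n⇒m⊓n≡m (≤-trans (s≤s z≤n) full))))
    ... | no notfull = ≤-trans (m⊓n≤n (2 + m) _) (+-mono-≤
            (⊓-glb (bit≤1 (coset J g x)) (≤-reflexive (sym (+-identityʳ _))))
            (⊓-glb (≤-trans (m≤n+m _ (bit (coset J g x))) (s≤s⁻¹ (≰⇒> notfull))) ≤-refl))
  ... | A@(y ∷ A′) , B , s , exact , inBig = A , B , record
    { split = s ; neA = s≤s z≤n
    ; longB = ≤-trans (heavy y (All.head inBig)) (count≤length (coset J y) B)
    ; keep = keep′ ; safe = safe′ }
    where
    S = x ∷ S′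
    heavy : ∀ g → g ∈ atLeast J (2 + m) S → suc m ≤ count (coset J g) B
    heavy g g∈ = s≤s⁻¹ (≤-trans (atLeast⁻ {J} {2 + m} {S} g∈) (≤-trans (≤-reflexive (split-count (coset J g) s))
      (+-monoˡ-≤ _ (≤-trans (≤-reflexive (exact g g∈)) (m⊓n≤m 1 _)))))
    keep′ : ∀ g → (2 + m) ⊓ count (coset J g) S ≤ (1 ⊓ count (coset J g) A) + (suc m ⊓ count (coset J g) B)
    keep′ g with (2 + m) ≤? count (coset J g) S
    ... | yes full = ≤-trans (m⊓n≤m (2 + m) _) (+-mono-≤
            (⊓-glb ≤-refl (≤-reflexive (sym (trans (exact g g∈) (m≤n⇒m⊓n≡m (≤-trans (s≤s z≤n) full))))))
            (⊓-glb ≤-refl (heavy g g∈)))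
      where g∈ = atLeast⁺ {J} {2 + m} {S} full
    ... | no notfull = ≤-trans (m⊓n≤n (2 + m) _) (≤-trans (≤-reflexive (split-count (coset J g) s)) (+-mono-≤
            (⊓-glb (none-or-one (count (coset J g) A) refl) ≤-refl)
            (⊓-glb (≤-trans (m≤n+m _ (count (coset J g) A)) (≤-trans (≤-reflexive (sym (split-count (coset J g) s))) (s≤s⁻¹ (≰⇒> notfull)))) ≤-refl)))
      where
      none-or-one : ∀ k → count (coset J g) A ≡ k → count (coset J g) A ≤ 1
      none-or-one zero eq = ≤-trans (≤-reflexive eq) z≤n
      none-or-one (suc k) eq = ⊥-elim (notfull (atLeast⁻ {J} {2 + m} {S} (found inBig (count-positive (coset J g) A
          (≤-trans (s≤s z≤n) (≤-reflexive (sym eq)))))))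
        where
        found : ∀ {A} → All (_∈ atLeast J (2 + m) S) A → Any (_∈ coset J g) A → g ∈ atLeast J (2 + m) S
        found (p ∷ _) (here q) = periodic-coset J (atLeast-periodic J (2 + m) S) p (coset-sym J q)
        found (_ ∷ ps) (there q) = found ps q
    safe′ : ∀ H → J ≤ₛ H → ∀ g → count (coset H g) A ≤ 1 ⊎ suc m ≤ count (coset H g) B
    safe′ H J≤H g with count (coset H g) A in eq
    ... | zero = inj₁ z≤n
    ... | suc k = inj₂ (found inBig (count-positive (coset H g) A (≤-trans (s≤s z≤n) (≤-reflexive (sym eq)))))
      where
      found : ∀ {A} → All (_∈ atLeast J (2 + m) S) A → Any (_∈ coset H g) A → suc m ≤ count (coset H g) B
      found {z ∷ _} (p ∷ _) (here q) = ≤-trans (heavy z p) (count-mono B λ r → coset-trans H q (coset-mono {J} {H} J≤H r))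
      found (_ ∷ ps) (there q) = found ps q

  peel : ∀ J bs → Valid bs → All (λ b → proj₂ b ≤ 1) bs ⊎ ∃ (Peel J bs)
  peel J [] ok = inj₁ []
  peel J ((S , t) ∷ bs) (le ∷ ok) with peel J bs ok
  ... | inj₂ (bs′ , s) = inj₂ (_ , there s)
  peel J ((S , zero) ∷ bs) (le ∷ ok) | inj₁ small = inj₁ (z≤n ∷ small)
  peel J ((S , suc zero) ∷ bs) (le ∷ ok) | inj₁ small = inj₁ (≤-refl ∷ small)
  peel J ((S , suc (suc m)) ∷ bs) (le ∷ ok) | inj₁ _ with peeling J m S le
  ... | A , B , P = inj₂ (_ , here P)

  DGM : Sub → Blocks → Set
  DGM J bs = ∃ λ V → J ≤ₛ V × Periodic V (X bs ⊕ set J) × ‖ V ‖ + bounds V bs ≤ ∣ X bs ⊕ set J ∣ + total bs * ‖ V ‖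

  singleton-bound : ∀ V S t → t ≤ 1 → bound V S t + ‖ V ‖ ≤ ∣ sums t S ⊕ set V ∣ + t * ‖ V ‖
  singleton-bound V S zero _ = begin
    bound V S 0 + ‖ V ‖        ≡⟨ cong (_+ ‖ V ‖) (trans (∑-const 0) (*-zeroʳ order)) ⟩
    ‖ V ‖                      ≤⟨ card≤⊕ (set V) zero⁺ ⟩
    ∣ zeroSet ⊕ set V ∣        ≡⟨ sym (+-identityʳ _) ⟩
    ∣ zeroSet ⊕ set V ∣ + 0    ∎
    where open ≤-Reasoning
  singleton-bound V S (suc zero) _ = +-mono-≤
    (≤-trans (∑-mono pt) (≤-reflexive (sym (card-∑ (sums 1 S ⊕ set V))))) (≤-reflexive (sym (+-identityʳ ‖ V ‖)))
    where
    single : ∀ {g S} → Any (_∈ coset V g) S → ∃ λ x → x ∈ sums 1 S × x ∈ coset V g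
    single {S = y ∷ S} (here p) = y ∙ ε , ∪ˡ (translate⁺ {y} {zeroSet} zero⁺) , subst (_∈ coset V _) (sym (identityʳ y)) p
    single {S = y ∷ S} (there p) with single p
    ... | x , x∈ , q = x , ∪ʳ {translate y zeroSet} x∈ , q
    pt : ∀ g → 1 ⊓ count (coset V g) S ≤ bit ((sums 1 S ⊕ set V) g)
    pt g with count (coset V g) S in eq
    ... | zero  = z≤n
    ... | suc k with single (count-positive (coset V g) S (≤-trans (s≤s z≤n) (≤-reflexive (sym eq))))
    ...   | x , x∈ , q = ≤-reflexive (sym (bit-in (closure-intro V x∈ (coset-sym V q))))
  singleton-bound V S (suc (suc t)) (s≤s ())

  -- Blocks with t ≤ 1 are sums of sets, so Kneser's theorem can be iterated. The recursion is
  -- relative to the stabiliser V of the whole sum: a period of the remaining blocks modulo V is a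
  -- period of the whole, hence already in V.
  dgm-sets : ∀ J bs → All (λ b → proj₂ b ≤ 1) bs → Valid bs → DGM J bs
  dgm-sets J [] _ _ = J , (λ p → p) , closure-periodic {J} zeroSet J (λ p → p) , +-monoˡ-≤ 0 (card≤⊕ (set J) zero⁺)
  dgm-sets J ((S , t) ∷ bs) (t≤1 ∷ small) (le ∷ ok) with dgm-sets V bs small ok
    where V = stab (sums t S ⊕ X bs ⊕ set J)
  ... | V′ , V≤V′ , per , ineq = V , J≤V , stab-periodic Y ,
      dgm-cons (‖ V ‖) (bound V S t) (bounds V bs) (∣ A ⊕ set V ∣) (∣ B ∣) (∣ Y ∣) t (total bs)
        (≤-trans (+-mono-≤ (card-mono V≤V′) (bounds-mono V V′ bs V≤V′))
          (≤-trans ineq (+-monoʳ-≤ (∣ B ∣) (*-monoʳ-≤ (total bs) (card-mono V′≤V)))))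
        (singleton-bound V S t t≤1)
        (≤-trans (+-mono-≤ (card-closure-mono V W (λ p → p) V≤W) (card≤closure B W))
          (≤-trans (kneser neA neB) (+-mono-≤ (card-mono AB⊂Y) (card-mono W≤V))))
    where
    A = sums t S
    Y = A ⊕ X bs ⊕ set J
    V = stab Y
    B = X bs ⊕ set V
    W = stab (A ⊕ B)
    J≤V : J ≤ₛ V
    J≤V = stab-maximal J Y (closure-periodic {J} (A ⊕ X bs) J (λ p → p))
    AB⊂Y : A ⊕ B ⊂ Y
    AB⊂Y p = closure⊂ V (stab-periodic Y) (⊂⊕ J) (⊕-assoc p)
    Y⊂AB : Y ⊂ A ⊕ B
    Y⊂AB p = ⊕-assoc⁻ (⊕-mono (λ q → q) J≤V p)
    V≤W : V ≤ₛ W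
    V≤W = stab-maximal V (A ⊕ B) (⊕-periodicʳ V A (closure-periodic {V} (X bs) V (λ p → p)))
    W≤V : W ≤ₛ V
    W≤V h∈ = stab-complete Y λ p → AB⊂Y (stab-periodic (A ⊕ B) h∈ (Y⊂AB p))
    V′≤V : V′ ≤ₛ V
    V′≤V h∈ = stab-complete Y λ p → AB⊂Y (⊕-periodicʳ V′ A per h∈ (Y⊂AB p))
    neA : Nonempty A
    neA with sublist-of-length t S le
    ... | T , T⊆ , eq = σ T , subst (λ k → σ T ∈ sums k S) eq (sums⁺ T⊆)
    neB : Nonempty B
    neB = ⊕-nonempty (X-nonempty ok) (ε , ε∈ V)

  module Descent (J : Sub) {bs bs′ : Blocks} (ok : Valid bs) (step : Peel J bs bs′)
                 (aperiodic : stab (X bs ⊕ set J) ≤ₛ J)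
                 (smaller : ∀ cs → Valid cs → ∣ X cs ⊕ set J ∣ < ∣ X bs ⊕ set J ∣ → DGM J cs) where

    S = X bs ⊕ set J

    -- Y witnesses the bound for the peeled blocks with period H.  A coset of H meeting S but not
    -- contained in it is reached by the fibres of some choice, and their sums, to which the theorem
    -- applies inductively, extend Y to a witness with smaller period.
    descend : ∀ k Y H → ‖ H ‖ ≤ k → J ≤ₛ H → Y ⊂ S → Nonempty Y → Periodic H Y →
              ‖ H ‖ + bounds H bs′ ≤ ∣ Y ∣ + total bs * ‖ H ‖ → DGM J bs
    descend k Y H le J≤H Y⊂S neY perY ineq with ⊂-or-escape (set H) (set J)
    ... | inj₁ H≤J = J , (λ p → p) , closure-periodic {J} (X bs) J (λ p → p) ,
          ≤-trans (+-mono-≤ (card-mono J≤H) (≤-trans (step-keep step) (bounds-mono J H bs′ J≤H)))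
            (≤-trans ineq (+-mono-≤ (card-mono Y⊂S) (*-monoʳ-≤ (total bs) (card-mono H≤J))))
    descend zero Y H le J≤H Y⊂S neY perY ineq | inj₂ _ = ⊥-elim (<-irrefl refl (≤-trans (‖‖>0 H) le))
    descend (suc k) Y H le J≤H Y⊂S neY perY ineq | inj₂ (h , h∈ , h∉)
      with escape S (∉-intro λ q → absurd (aperiodic q) h∉)
    ... | z , z∈ , zh∉ with closure-coset J z∈
    ...   | x , x∈ , zx with choose bs x∈
    ...     | c , refl = continue (smaller cs (fibres-valid H c) W<S)
      where
      cs = fibres H c
      W = X cs ⊕ set J
      R = coset H z
      W⊂S : W ⊂ S
      W⊂S = ⊕-mono (λ p → proj₁ (fibres⁻ H c p)) (λ p → p)
      W⊂R : W ⊂ R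
      W⊂R = closure⊂ J (coset-periodic {J} H z J≤H)
        λ p → coset-trans H (coset-sym H (coset-mono {J} {H} J≤H zx)) (proj₂ (fibres⁻ H c p))
      neW : Nonempty W
      neW = ⊕-nonempty (X-nonempty (fibres-valid H c)) (ε , ε∈ J)
      disjoint : ∀ {y} → y ∈ Y → y ∈ W → ⊥
      disjoint p q = absurd (Y⊂S (periodic-coset H perY p (coset-trans H (coset-sym H (W⊂R q)) (coset-∙ʳ H z h∈)))) zh∉
      W<S : ∣ W ∣ < ∣ S ∣
      W<S = ≤-trans (+-monoˡ-≤ (∣ W ∣) (card-positive (proj₂ neY))) (card-disjoint S Y⊂S W⊂S disjoint)
      continue : DGM J cs → DGM J bs
      continue (K , J≤K , perW , ineqW) = descend k (Y ∪ W) K (s≤s⁻¹ (≤-trans K<H le)) J≤K (∪-elim Y⊂S W⊂S)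
        (proj₁ neY , ∪ˡ (proj₂ neY)) (∪-periodic K (λ k∈ → perY (K≤H k∈)) perW)
        -- The bound for `Y` at `H` is added to the inductive bound for `W` at `K`. `step-bound`
        -- trades the H-bounds of the peeled blocks for K-bounds, and its surplus |H| is the |H| on
        -- the left of the first bound.
        (≤-trans (dgm-witness (‖ H ‖) (‖ K ‖) (∣ Y ∣) (∣ W ∣) (total bs) (bounds H bs′) (bounds K bs′) (bounds K cs)
            ineq (subst (λ t → ‖ K ‖ + bounds K cs ≤ ∣ W ∣ + t * ‖ K ‖) (fibres-total H c) ineqW)
            (step-bound step H K J≤H K≤H c))
          (≤-reflexive (cong (_+ total bs * ‖ K ‖) (sym (card-∪-disjoint Y W disjoint)))))
        where
        K≤H : K ≤ₛ H
        K≤H = period-bound H W⊂R neW K perW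
        K<H : ‖ K ‖ < ‖ H ‖
        K<H with ‖ H ‖ ≤? ‖ K ‖
        ... | no ¬p = ≰⇒> ¬p
        ... | yes p = absurd (W⊂S (periodic-coset H (λ k∈ → perW (⊂-antisym K≤H p k∈)) (proj₂ neW)
                 (coset-trans H (coset-sym H (W⊂R (proj₂ neW))) (coset-∙ʳ H z h∈)))) zh∉

  module Induction (J : Sub) (above : ∀ V → J ≤ₛ V → ‖ J ‖ < ‖ V ‖ → ∀ bs → Valid bs → DGM V bs) where

    -- If the sum has a period V larger than `J`, adding V instead of `J` gives the same set, so the
    -- theorem relative to V applies.
    periodic-case : ∀ bs → Valid bs → ‖ J ‖ < ‖ stab (X bs ⊕ set J) ‖ → DGM J bs
    periodic-case bs ok lt = lift (above V J≤V lt bs ok)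
      where
      Y = X bs ⊕ set J
      V = stab Y
      J≤V : J ≤ₛ V
      J≤V = stab-maximal J Y (closure-periodic {J} (X bs) J (λ p → p))
      XV⊂Y : X bs ⊕ set V ⊂ Y
      XV⊂Y = closure⊂ V (stab-periodic Y) (⊂⊕ J)
      lift : DGM V bs → DGM J bs
      lift (W , V≤W , per , ineq) = W , (λ p → V≤W (J≤V p)) ,
        (λ w∈ p → XV⊂Y (per w∈ (⊕-mono (λ q → q) J≤V p))) , ≤-trans ineq (+-monoˡ-≤ _ (card-mono XV⊂Y))

    -- The size n of the sum decreases for the fibre blocks, the excess m for the peeled blocks at
    -- unchanged n.
    run : ∀ n m bs → Valid bs → ∣ X bs ⊕ set J ∣ ≤ n → excess bs ≤ m → DGM J bs
    run n m bs ok size ex with ‖ stab (X bs ⊕ set J) ‖ ≤? ‖ J ‖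
    ... | no lt = periodic-case bs ok (≰⇒> lt)
    ... | yes le with peel J bs ok
    ...   | inj₁ small = dgm-sets J bs small ok
    run zero m bs ok size ex | yes le | inj₂ _ =
      ⊥-elim (<-irrefl refl (≤-trans (card-positive (proj₂ (⊕-nonempty (X-nonempty ok) (ε , ε∈ J)))) size))
    run (suc n) zero bs ok size ex | yes le | inj₂ (bs′ , s) = ⊥-elim (<-irrefl refl (≤-trans (≤-trans (s≤s z≤n) (step-excess s)) ex))
    run (suc n) (suc m) bs ok size ex | yes le | inj₂ (bs′ , s)
      with run (suc n) m bs′ (step-valid s ok) (≤-trans (card-mono (⊕-mono (step-⊂ s) (λ p → p))) size) (s≤s⁻¹ (≤-trans (step-excess s) ex))
    ... | H , J≤H , per , ineq = Descent.descend J ok s (⊂-antisym J≤V le)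
            (λ cs okc lt → run n (excess cs) cs okc (s≤s⁻¹ (≤-trans lt size)) ≤-refl)
            (‖ H ‖) (X bs′ ⊕ set J) H ≤-refl J≤H (⊕-mono (step-⊂ s) (λ p → p))
            (⊕-nonempty (X-nonempty (step-valid s ok)) (ε , ε∈ J)) per
            (subst (λ t → ‖ H ‖ + bounds H bs′ ≤ ∣ X bs′ ⊕ set J ∣ + t * ‖ H ‖) (step-total s) ineq)
      where
      J≤V : J ≤ₛ stab (X bs ⊕ set J)
      J≤V = stab-maximal J (X bs ⊕ set J) (closure-periodic {J} (X bs) J (λ p → p))

  dgm-bounded : ∀ n J → order ≤ n + ‖ J ‖ → ∀ bs → Valid bs → DGM J bs
  dgm-bounded n J le bs ok = Induction.run J (above n le) _ _ bs ok ≤-refl ≤-refl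
    where
    above : ∀ n → order ≤ n + ‖ J ‖ → ∀ V → J ≤ₛ V → ‖ J ‖ < ‖ V ‖ → ∀ bs → Valid bs → DGM V bs
    above zero le V _ lt = ⊥-elim (<-irrefl refl (≤-trans lt (≤-trans (card≤order (set V)) le)))
    above (suc n) le V _ lt = dgm-bounded n V (≤-trans le (≤-trans (≤-reflexive (sym (+-suc n ‖ J ‖))) (+-monoʳ-≤ n lt)))

  dgm : ∀ J bs → Valid bs → DGM J bs
  dgm J = dgm-bounded order J (m≤m+n order ‖ J ‖)

-- Critical pairs

vo-growth : ∀ x a xv av s v → v + a ≤ av → x ≤ xv → xv + av ≤ s + v → x + a ≤ s
vo-growth x a xv av s v q1 q2 q3 = linear (x + a) s 0 (+-mono-≤ q1 (+-mono-≤ q2 q3)) (eq x a xv av s v)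
  where
  eq : ∀ x a xv av s v → (x + a) + (av + (xv + (s + v))) + 0 ≡ s + ((v + a) + (x + (xv + av)))
  eq = solve-∀

vo-half : ∀ m a s g t u → t + s ≤ g → m + a ≤ s + u → m ≤ t → 2 * m + a ≤ g + u
vo-half m a s g t u q1 q2 q3 = linear (2 * m + a) (g + u) 0 (+-mono-≤ q1 (+-mono-≤ q2 q3)) (eq m a s g t u)
  where
  eq : ∀ m a s g t u → (2 * m + a) + (g + ((s + u) + t)) + 0 ≡ (g + u) + ((t + s) + ((m + a) + m))
  eq = solve-∀

vo-union : ∀ s t i ia m a u w → s + u ≤ m + a → w + ia ≤ 2 * s → i + a ≤ ia → 2 * m ≤ t + i → w + 2 * u ≤ t + a
vo-union s t i ia m a u w q1 q2 q3 q4 = linear (w + 2 * u) (t + a) 0 (+-mono-≤ q1 (+-mono-≤ q1 (+-mono-≤ q2 (+-mono-≤ q3 q4)))) (eq s t i ia m a u w)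
  where
  eq : ∀ s t i ia m a u w → (w + 2 * u) + ((m + a) + ((m + a) + ((2 * s) + (ia + (t + i))))) + 0 ≡ (t + a) + ((s + u) + ((s + u) + ((w + ia) + ((i + a) + (2 * m)))))
  eq = solve-∀

vo-union⊥ : ∀ g w u t a m i → 2 * m + a ≤ g + u → g ≤ w → w + 2 * u ≤ t + a → t + i ≤ 2 * m → 1 + u ≤ i → ⊥
vo-union⊥ g w u t a m i q1 q2 q3 q4 q5 = linear⊥ (2 * u) (+-mono-≤ q1 (+-mono-≤ q2 (+-mono-≤ q3 (+-mono-≤ q4 q5)))) (eq g w u t a m i)
  where
  eq : ∀ g w u t a m i → ((2 * m + a) + (g + ((w + 2 * u) + ((t + i) + (1 + u))))) ≡ suc (((g + u) + (w + ((t + a) + ((2 * m) + i)))) + (2 * u))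
  eq = solve-∀

vo-two : ∀ ma d a u s m → ma ≤ s → a + d ≤ ma → s + u ≤ m + a → m ≤ 2 * u → d ≤ u
vo-two ma d a u s m q1 q2 q3 q4 = linear d u 0 (+-mono-≤ q1 (+-mono-≤ q2 (+-mono-≤ q3 q4))) (eq ma d a u s m)
  where
  eq : ∀ ma d a u s m → d + (s + (ma + ((m + a) + (2 * u)))) + 0 ≡ u + (ma + ((a + d) + ((s + u) + m)))
  eq = solve-∀

vo-fibres : ∀ m v w f k → m + (v + v) ≤ w + (f + k) → 1 + w ≤ v + m → 1 + v ≤ f + k
vo-fibres m v w f k q1 q2 = linear (1 + v) (f + k) 0 (+-mono-≤ q1 q2) (eq m v w f k)
  where
  eq : ∀ m v w f k → (1 + v) + ((w + (f + k)) + (v + m)) + 0 ≡ (f + k) + ((m + (v + v)) + (1 + w))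
  eq = solve-∀

vo-sidon⊥ : ∀ v u f k i j c → v + u ≤ f + k → 2 * f ≤ v + i → 2 * k ≤ v + j → i + j ≤ c → c ≤ u → 1 ≤ u → ⊥
vo-sidon⊥ v u f k i j c q1 q2 q3 q4 q5 q6 = linear⊥ 0 (+-mono-≤ q1 (+-mono-≤ q1 (+-mono-≤ q2 (+-mono-≤ q3 (+-mono-≤ q4 (+-mono-≤ q5 q6)))))) (eq v u f k i j c)
  where
  eq : ∀ v u f k i j c → ((v + u) + ((v + u) + ((2 * f) + ((2 * k) + ((i + j) + (c + 1)))))) ≡ suc (((f + k) + ((f + k) + ((v + i) + ((v + j) + (c + (u + u)))))) + 0)
  eq = solve-∀

vo-rest : ∀ ac r a m s u p q → a ≤ ac + r → ac + m ≤ p + u → p + q ≤ s → s + u ≤ a + m → q ≤ r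
vo-rest ac r a m s u p q q1 q2 q3 q4 = linear q r 0 (+-mono-≤ q1 (+-mono-≤ q2 (+-mono-≤ q3 q4))) (eq ac r a m s u p q)
  where
  eq : ∀ ac r a m s u p q → q + ((ac + r) + ((p + u) + (s + (a + m)))) + 0 ≡ r + (a + ((ac + m) + ((p + q) + (s + u))))
  eq = solve-∀

vo-final⊥ : ∀ m n s u → 3 * m ≤ s + 3 * u → 3 * n ≤ s + 3 * u → s + u ≤ n + m → 1 + 2 * u ≤ m → 1 + 2 * u ≤ n → ⊥
vo-final⊥ m n s u q1 q2 q3 q4 q5 = linear⊥ 1 (+-mono-≤ q1 (+-mono-≤ q2 (+-mono-≤ q3 (+-mono-≤ q3 (+-mono-≤ q4 q5))))) (eq m n s u)
  where
  eq : ∀ m n s u → ((3 * m) + ((3 * n) + ((s + u) + ((s + u) + ((1 + 2 * u) + (1 + 2 * u)))))) ≡ suc (((s + 3 * u) + ((s + 3 * u) + ((n + m) + ((n + m) + (m + n))))) + 1)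
  eq = solve-∀

vo-larger : ∀ m n s u → 2 * m ≤ s + u → s + u ≤ n + m → m ≤ n
vo-larger m n s u q1 q2 = linear m n 0 (+-mono-≤ q1 q2) (eq m n s u)
  where
  eq : ∀ m n s u → m + ((s + u) + (n + m)) + 0 ≡ n + ((2 * m) + (s + u))
  eq = solve-∀

vo-pair : ∀ m p i u → 2 * m ≤ p + i → i ≤ u → 2 * m ≤ p + u
vo-pair m p i u q1 q2 = linear (2 * m) (p + u) 0 (+-mono-≤ q1 q2) (eq m p i u)
  where
  eq : ∀ m p i u → (2 * m) + ((p + i) + u) + 0 ≡ (p + u) + ((2 * m) + i)
  eq = solve-∀

vo-triple : ∀ m p q i u j → 2 * m ≤ p + i → i ≤ u → p + m ≤ q + j → j ≤ u + u → 3 * m ≤ q + 3 * u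
vo-triple m p q i u j q1 q2 q3 q4 = linear (3 * m) (q + 3 * u) 0 (+-mono-≤ q1 (+-mono-≤ q2 (+-mono-≤ q3 q4))) (eq m p q i u j)
  where
  eq : ∀ m p q i u j → (3 * m) + ((p + i) + (u + ((q + j) + (u + u)))) + 0 ≡ (q + 3 * u) + ((2 * m) + (i + ((p + m) + j)))
  eq = solve-∀

module SidonSets (G : D.FiniteAbelianGroup) (e : ℕ) .{{_ : NonZero e}}
                     (exponent : ∀ g → D.FiniteAbelianGroup._·_ G e g ≡ D.FiniteAbelianGroup.ε G) where

  open FiniteSets G
  open KneserTheorem G

  ·-ε : ∀ m → m · ε ≡ ε
  ·-ε zero    = refl
  ·-ε (suc m) = trans (identityˡ _) (·-ε m)

  ·-* : ∀ m k x → (m * k) · x ≡ m · (k · x)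
  ·-* zero    k x = refl
  ·-* (suc m) k x = trans (·-+ k (m * k) x) (cong ((k · x) ∙_) (·-* m k x))

  ·-% : ∀ i x → i · x ≡ (i % e) · x
  ·-% i x = begin
    i · x                                ≡⟨ cong (_· x) (m≡m%n+[m/n]*n i e) ⟩
    (i % e + i / e * e) · x              ≡⟨ ·-+ (i % e) (i / e * e) x ⟩
    (i % e) · x ∙ (i / e * e) · x        ≡⟨ cong ((i % e) · x ∙_) (trans (·-* (i / e) e x) (trans (cong ((i / e) ·_) (exponent x)) (·-ε (i / e)))) ⟩
    (i % e) · x ∙ ε                      ≡⟨ identityʳ _ ⟩
    (i % e) · x                          ∎
    where open ≡-Reasoning

  inverse-multiple : ∀ y → (e ∸ 1) · y ≡ y ⁻¹
  inverse-multiple y = begin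
    (e ∸ 1) · y                    ≡⟨ solve 2 (λ y z → z ⊜ (neg y ⊞ (y ⊞ z))) refl y ((e ∸ 1) · y) ⟩
    y ⁻¹ ∙ (suc (e ∸ 1) · y)       ≡⟨ cong (λ k → y ⁻¹ ∙ (k · y)) (suc-pred e) ⟩
    y ⁻¹ ∙ (e · y)                 ≡⟨ cong (y ⁻¹ ∙_) (exponent y) ⟩
    y ⁻¹ ∙ ε                       ≡⟨ identityʳ _ ⟩
    y ⁻¹                           ∎
    where open ≡-Reasoning

  abstract
    -- The subgroup generated by `x` and `J`; multiples below `e` suffice because e annihilates the
    -- group.
    genSet : C → Sub → Subset
    genSet x J g = ⌊ any? (λ (i : Fin e) → coset J (toℕ i · x) g ≟ᵇ true) ⌋

    gen⁺ : ∀ x J {g} i → g ∈ coset J (i · x) → g ∈ genSet x J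
    gen⁺ x J {g} i p with any? (λ (i : Fin e) → coset J (toℕ i · x) g ≟ᵇ true) in eq
    ... | yes _ = mem (cong ⌊_⌋ eq)
    ... | no ¬q = ⊥-elim (¬q (fromℕ< (m%n<n i e) ,
            holds (subst (λ y → g ∈ coset J y) (trans (·-% i x) (cong (_· x) (sym (toℕ-fromℕ< (m%n<n i e))))) p)))

    gen⁻ : ∀ x J {g} → g ∈ genSet x J → ∃ λ i → i < e × g ∈ coset J (i · x)
    gen⁻ x J {g} (mem p) with any? (λ (i : Fin e) → coset J (toℕ i · x) g ≟ᵇ true)
    ... | yes (i , q) = toℕ i , toℕ<n i , mem q

  gen : C → Sub → Sub
  gen x J = record
    { set = genSet x J
    ; ε∈ = gen⁺ x J 0 (coset-refl J ε)
    ; ∙∈ = λ p q → plus (gen⁻ x J p) (gen⁻ x J q)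
    ; ⁻¹∈ = λ p → inv (gen⁻ x J p)
    }
    where
    plus : ∀ {a b} → (∃ λ i → i < e × a ∈ coset J (i · x)) → (∃ λ i → i < e × b ∈ coset J (i · x)) → a ∙ b ∈ genSet x J
    plus {a} {b} (i , _ , p) (j , _ , q) = gen⁺ x J (i + j) (subst (λ y → a ∙ b ∈ coset J y) (sym (·-+ i j x)) (coset-∙ J p q))
    inv : ∀ {a} → (∃ λ i → i < e × a ∈ coset J (i · x)) → a ⁻¹ ∈ genSet x J
    inv {a} (i , _ , p) = gen⁺ x J ((e ∸ 1) * i) (subst (λ y → a ⁻¹ ∈ coset J y)
      (trans (sym (inverse-multiple (i · x))) (sym (·-* (e ∸ 1) i x)))
      (coset⁺ J (subst (_∈ set J) (solve 2 (λ y a → neg (neg y ⊞ a) ⊜ (neg (neg y) ⊞ neg a)) refl (i · x) a) (⁻¹∈ J (coset⁻ J p)))))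

  J≤gen : ∀ x J → J ≤ₛ gen x J
  J≤gen x J {g} p = gen⁺ x J 0 (subst (_∈ coset J ε) (identityˡ g) (coset-∙ʳ J ε p))

  x∈gen : ∀ x J → x ∈ genSet x J
  x∈gen x J = gen⁺ x J 1 (subst (λ y → x ∈ coset J y) (sym (identityʳ x)) (coset-refl J x))

  card-gen : ∀ x J → ‖ gen x J ‖ ≤ e * ‖ J ‖
  card-gen x J = ≤-trans (card-mono λ p → within e (gen⁻ x J p)) (bounded e)
    where
    upTo : ℕ → Subset
    upTo zero    = λ _ → false
    upTo (suc k) = coset J (k · x) ∪ upTo k
    within : ∀ k {g} → (∃ λ i → i < k × g ∈ coset J (i · x)) → g ∈ upTo k
    within (suc k) (i , s≤s le , p) with m≤n⇒m<n∨m≡n le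
    ... | inj₁ lt   = ∪ʳ {coset J (k · x)} (within k (i , lt , p))
    ... | inj₂ refl = ∪ˡ p
    bounded : ∀ k → ∣ upTo k ∣ ≤ k * ‖ J ‖
    bounded zero    = ≤-reflexive (card-empty λ _ → non refl)
    bounded (suc k) = ≤-trans (card-∪≤ _ _) (+-mono-≤ (≤-reflexive (card-coset J (k · x))) (bounded k))

  -- Stepping back from w by `x` must enter `A` at the latest at the coset of `a`; the point of
  -- entry is the required y.
  walk : ∀ J A x {a} → Periodic J A → a ∈ A → ∀ i w → w ∈ coset J (a ∙ (i · x)) → w ∉ A →
         ∃ λ y → y ∈ A × x ∙ y ∉ A × ∃ λ k → y ∈ coset J (a ∙ (k · x))
  walk J A x {a} per a∈ zero w p w∉ =
    absurd (periodic-coset J per a∈ (subst (λ b → w ∈ coset J b) (identityʳ a) p)) w∉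
  walk J A x {a} per a∈ (suc i) w p w∉ with member? A (x ⁻¹ ∙ w)
  ... | inj₁ q = x ⁻¹ ∙ w , q , subst (_∉ A) (solve 2 (λ x w → w ⊜ (x ⊞ (neg x ⊞ w))) refl x w) w∉ , i , back
    where
    back : x ⁻¹ ∙ w ∈ coset J (a ∙ (i · x))
    back = coset⁺ J (subst (_∈ set J)
      (solve 4 (λ a x w k → (neg (a ⊞ (x ⊞ k)) ⊞ w) ⊜ (neg (a ⊞ k) ⊞ (neg x ⊞ w))) refl a x w (i · x)) (coset⁻ J p))
  ... | inj₂ q = walk J A x per a∈ i (x ⁻¹ ∙ w) back q
    where
    back : x ⁻¹ ∙ w ∈ coset J (a ∙ (i · x))
    back = coset⁺ J (subst (_∈ set J)
      (solve 4 (λ a x w k → (neg (a ⊞ (x ⊞ k)) ⊞ w) ⊜ (neg (a ⊞ k) ⊞ (neg x ⊞ w))) refl a x w (i · x)) (coset⁻ J p))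

  gen-coset : ∀ x J {a w} k → w ∈ coset J (a ∙ (k · x)) → w ∈ coset (gen x J) a
  gen-coset x J {a} {w} k p = coset⁺ (gen x J) (gen⁺ x J k (coset⁺ J (subst (_∈ set J)
    (solve 3 (λ a k w → (neg (a ⊞ k) ⊞ w) ⊜ (neg k ⊞ (neg a ⊞ w))) refl a (k · x) w) (coset⁻ J p))))

  leave : ∀ J A x {a w} → Periodic J A → a ∈ A → w ∈ coset (gen x J) a → w ∉ A →
          ∃ λ y → y ∈ A × x ∙ y ∉ A × y ∈ coset (gen x J) a
  leave J A x {a} {w} per a∈ p w∉ with gen⁻ x J (coset⁻ (gen x J) p)
  ... | i , _ , q with walk J A x per a∈ i w (coset⁺ J (subst (_∈ set J)
          (solve 3 (λ a k w → (neg k ⊞ (neg a ⊞ w)) ⊜ (neg (a ⊞ k) ⊞ w)) refl a (i · x) w) (coset⁻ J q))) w∉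
  ...   | y , y∈ , xy∉ , k , r = y , y∈ , xy∉ , gen-coset x J k r

  multiple-gap : ∀ k l m u → k * u < l * u + m * u → k * u + u ≤ l * u + m * u
  multiple-gap k l m u lt = ≤-trans (≤-reflexive (+-comm (k * u) u)) (≤-trans
    (*-monoˡ-≤ u (*-cancelʳ-< u k (l + m) (≤-trans lt (≤-reflexive (sym (*-distribʳ-+ u l m))))))
    (≤-reflexive (*-distribʳ-+ u l m)))

  periodic-gap₃ : ∀ J A B D → Periodic J A → Periodic J B → Periodic J D → ∣ A ∣ < ∣ B ∣ + ∣ D ∣ → ∣ A ∣ + ‖ J ‖ ≤ ∣ B ∣ + ∣ D ∣
  periodic-gap₃ J A B D pa pb pd lt with periodic-card J A pa | periodic-card J B pb | periodic-card J D pd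
  ... | k , eq | l , eq′ | m , eq″ rewrite eq | eq′ | eq″ = multiple-gap k l m (‖ J ‖) lt

  proper : ∀ {A z} V → Periodic V A → Nonempty A → z ∉ A → ‖ V ‖ < order
  proper {A} {z} V per (a , a∈) z∉ with order ≤? ‖ V ‖
  ... | no ¬p = ≰⇒> ¬p
  ... | yes p = absurd (subst (_∈ A) (solve 2 (λ a z → (a ⊞ (neg a ⊞ z)) ⊜ z) refl a z)
                  (per (⊂-antisym {set V} {full} (λ _ → full⁺) (≤-trans (≤-reflexive ∣full∣) p) full⁺) a∈)) z∉

  missing : ∀ A → ∣ A ∣ < order → ∃ λ z → z ∉ A
  missing A lt with ⊂-or-escape full A
  ... | inj₁ f = ⊥-elim (<-irrefl refl (≤-trans lt (≤-trans (≤-reflexive (sym ∣full∣)) (card-mono f))))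
  ... | inj₂ (z , _ , z∉) = z , z∉

  -- For V strictly between `J` and the group, completing `A` to a union of V-cosets must add at
  -- least |V| elements. This is what cancels the |V| of Kneser's bound.
  NoFat : Sub → Subset → Set
  NoFat J A = ∀ V → J ≤ₛ V → ‖ J ‖ < ‖ V ‖ → ‖ V ‖ < order → ‖ V ‖ + ∣ A ∣ ≤ ∣ A ⊕ set V ∣

  -- Modulo `J`, every nonzero difference has at most one representation in `M`.
  Sidon : Sub → Subset → Set
  Sidon J M = ∀ g → g ∉ set J → ∣ M ∩ translate g M ∣ ≤ ‖ J ‖

  -- Hamidoune's 2-fragments that violate |Y + A| ≥ |Y| + |A|, relative to J.
  record Bad (J : Sub) (A Y : Subset) : Set where
    field
      per   : Periodic J Y
      large : ‖ J ‖ < ∣ Y ∣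
      room  : ∣ Y ⊕ A ∣ + ‖ J ‖ < order
      tight : ∣ Y ⊕ A ∣ < ∣ Y ∣ + ∣ A ∣

  nonempty-large : ∀ {Y} J → ‖ J ‖ < ∣ Y ∣ → Nonempty Y
  nonempty-large {Y} J lt = card-nonempty Y (≤-trans (s≤s z≤n) lt)

  module Growth (J : Sub) (A : Subset) (perA : Periodic J A) (neA : Nonempty A) (thin : NoFat J A) where

    u = ‖ J ‖

    -- With V the stabiliser of the sum, Kneser's theorem gives |Y + V| + |A + V| ≤ |Y + A| + |V|,
    -- and `thin` gives |V| + |A| ≤ |A + V|.
    growth-periodic : ∀ Y {z} → Nonempty Y → Periodic J Y → z ∉ Y ⊕ A → u < ‖ stab (Y ⊕ A) ‖ → ∣ Y ∣ + ∣ A ∣ ≤ ∣ Y ⊕ A ∣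
    growth-periodic Y neY perY z∉ lt =
      vo-growth (∣ Y ∣) (∣ A ∣) (∣ Y ⊕ set V ∣) (∣ A ⊕ set V ∣) (∣ Y ⊕ A ∣) (‖ V ‖)
        (thin V J≤V lt (proper V (stab-periodic (Y ⊕ A)) (⊕-nonempty neY neA) z∉)) (card≤closure Y V) (kneser neY neA)
      where
      V = stab (Y ⊕ A)
      J≤V : J ≤ₛ V
      J≤V = stab-maximal J (Y ⊕ A) (⊕-periodicˡ J A perY)

    growth : ∀ Y {z} → Nonempty Y → Periodic J Y → z ∉ Y ⊕ A → ∣ Y ∣ + ∣ A ∣ ≤ ∣ Y ⊕ A ∣ + u
    growth Y neY perY z∉ with ‖ stab (Y ⊕ A) ‖ ≤? u
    ... | no lt  = ≤-trans (growth-periodic Y neY perY z∉ (≰⇒> lt)) (m≤m+n _ u)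
    ... | yes le = ≤-trans (+-mono-≤ (card≤closure Y V) (card≤closure A V)) (≤-trans (kneser neY neA) (+-monoʳ-≤ _ le))
      where V = stab (Y ⊕ A)

    tight-eq : ∀ {Y} → Bad J A Y → ∣ Y ⊕ A ∣ + u ≤ ∣ Y ∣ + ∣ A ∣
    tight-eq {Y} b = periodic-gap₃ J (Y ⊕ A) Y A (⊕-periodicˡ J A (Bad.per b)) (Bad.per b) perA (Bad.tight b)

    room-missing : ∀ {Y} → Bad J A Y → ∃ λ z → z ∉ Y ⊕ A
    room-missing {Y} b = missing (Y ⊕ A) (≤-trans (s≤s (m≤m+n _ u)) (Bad.room b))

    -- A smallest bad set has translates meeting in at most one coset.
    atom : ∀ n Y → ∣ Y ∣ ≤ n → Bad J A Y → (∀ M → Bad J A M → Sidon J M → ⊥) → ⊥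
    atom zero Y le b _ = <-irrefl refl (≤-trans (≤-trans (s≤s z≤n) (Bad.large b)) le)
    atom (suc n) M le b k = k M b sidon
      where
      open Bad b
      neM = nonempty-large J large
      minimal : ∀ Y → ∣ Y ∣ < ∣ M ∣ → Bad J A Y → ⊥
      minimal Y lt b′ = atom n Y (s≤s⁻¹ (≤-trans lt le)) b′ k
      -- The dual fragment, minus the complement of M + A. Its sum with `A` avoids -M, so it is bad
      -- as well, and minimality of `M` yields 2|M| + |A| ≤ |G| + |J|.
      M⋆ : Subset
      M⋆ = reflect ε (compl (M ⊕ A))
      card⋆ : ∣ M⋆ ∣ + ∣ M ⊕ A ∣ ≡ order
      card⋆ = trans (cong (_+ ∣ M ⊕ A ∣) (card-reflect ε (compl (M ⊕ A)))) (card-compl (M ⊕ A))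
      M⋆+A : M⋆ ⊕ A ⊂ reflect ε (compl M)
      M⋆+A p with ⊕⁻ p
      ... | y , a , y∈ , a∈ , refl with reflect⁻ {ε} {compl (M ⊕ A)} y∈
      ...   | w , w∈ , eq = reflect⁺ {ε} {compl M} {y ∙ a} {w ∙ a ⁻¹}
                (trans eq (solve 3 (λ y a w → (y ⊞ w) ⊜ ((y ⊞ a) ⊞ (w ⊟ a))) refl y a w))
                (compl⁺ (∉-intro λ q → absurd (subst (_∈ M ⊕ A) (solve 2 (λ w a → ((w ⊟ a) ⊞ a) ⊜ w) refl w a) (⊕⁺ q a∈)) (compl⁻ w∈)))
      card⋆A : ∣ M⋆ ⊕ A ∣ + ∣ M ∣ ≤ order
      card⋆A = ≤-trans (+-monoˡ-≤ (∣ M ∣) (≤-trans (card-mono M⋆+A) (≤-reflexive (card-reflect ε (compl M))))) (≤-reflexive (card-compl M))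
      bad⋆ : Bad J A M⋆
      bad⋆ = record
        { per = reflect-periodic J ε (compl-periodic J (⊕-periodicˡ J A per))
        ; large = +-cancelʳ-< (∣ M ⊕ A ∣) u (∣ M⋆ ∣) (≤-trans (≤-reflexive (cong suc (+-comm u _))) (≤-trans room (≤-reflexive (sym card⋆))))
        ; room = ≤-trans (≤-reflexive (sym (+-suc _ u))) (≤-trans (+-monoʳ-≤ (∣ M⋆ ⊕ A ∣) large) card⋆A)
        ; tight = dual (∣ M⋆ ⊕ A ∣) (∣ M ∣) order (∣ M⋆ ∣) (∣ M ⊕ A ∣) (∣ A ∣) card⋆A (≤-reflexive (sym card⋆)) tight
        }
        where
        dual : ∀ x m g t s a → x + m ≤ g → g ≤ t + s → s < m + a → x < t + a
        dual x m g t s a p q r = linear (suc x) (t + a) 0 (+-mono-≤ p (+-mono-≤ q r)) (eq x m g t s a)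
          where
          eq : ∀ x m g t s a → suc x + (g + ((t + s) + (m + a))) + 0 ≡ t + a + ((x + m) + (g + suc s))
          eq = solve-∀
      half : 2 * ∣ M ∣ + ∣ A ∣ ≤ order + u
      half = vo-half (∣ M ∣) (∣ A ∣) (∣ M ⊕ A ∣) order (∣ M⋆ ∣) u (≤-reflexive card⋆)
        (growth M neM per (proj₂ (room-missing b))) (M≤M⋆ (∣ M⋆ ∣ <? ∣ M ∣))
        where
        M≤M⋆ : _ → ∣ M ∣ ≤ ∣ M⋆ ∣
        M≤M⋆ (yes lt) = ⊥-elim (minimal M⋆ lt bad⋆)
        M≤M⋆ (no ge)  = ≮⇒≥ ge
      sidon : Sidon J M
      sidon g g∉ with ∣ M ∩ translate g M ∣ ≤? u
      ... | yes p = p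
      ... | no gt with ∣ M ∣ ≤? ∣ M ∩ translate g M ∣
      -- If translation by g fixes `M`, then g is a period of M + A outside `J`, and the periodic
      -- growth bound contradicts badness.
      ...   | yes all = ⊥-elim (<-irrefl refl (≤-trans tight
                (growth-periodic M neM per (proj₂ (room-missing b)) (J<V (‖ V ‖ ≤? u)))))
        where
        V = stab (M ⊕ A)
        J≤V : J ≤ₛ V
        J≤V = stab-maximal J (M ⊕ A) (⊕-periodicˡ J A per)
        shifted : ∀ {x} → x ∈ M → x ∙ g ⁻¹ ∈ M
        shifted x∈ with translate⁻ {g} {M} (∩ʳ {M} (⊂-antisym (∩ˡ {M} {translate g M}) all x∈))
        ... | y , y∈ , refl = subst (_∈ M) (solve 2 (λ g y → y ⊜ ((g ⊞ y) ⊟ g)) refl g y) y∈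
        g⁻¹∈V : g ⁻¹ ∈ set V
        g⁻¹∈V = stab-complete (M ⊕ A) λ p → move (⊕⁻ p)
          where
          move : ∀ {x} → (∃ λ m → ∃ λ a → m ∈ M × a ∈ A × x ≡ m ∙ a) → x ∙ g ⁻¹ ∈ M ⊕ A
          move (m , a , m∈ , a∈ , refl) = subst (_∈ M ⊕ A) (solve 3 (λ m a g → ((m ⊟ g) ⊞ a) ⊜ ((m ⊞ a) ⊟ g)) refl m a g) (⊕⁺ (shifted m∈) a∈)
        J<V : _ → u < ‖ V ‖
        J<V (no lt) = ≰⇒> lt
        J<V (yes le′) = absurd (subst (_∈ set J) (solve 1 (λ g → neg (neg g) ⊜ g) refl g) (⁻¹∈ J (⊂-antisym J≤V le′ g⁻¹∈V))) g∉
      -- The intersection I is smaller than `M` but larger than |J|, hence not bad. Submodularity of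
      -- X ↦ |X + A| then gives |U + A| + 2|J| ≤ |U| + |A| for the union U. This breaks the growth
      -- bound unless U + A is the whole group, and in that case it contradicts `half`.
      ...   | no lt = ⊥-elim (vo-union⊥ order (∣ U ⊕ A ∣) u (∣ U ∣) (∣ A ∣) (∣ M ∣) (∣ I ∣) half U+A-full
                  (vo-union (∣ M ⊕ A ∣) (∣ U ∣) (∣ I ∣) (∣ I ⊕ A ∣) (∣ M ∣) (∣ A ∣) u (∣ U ⊕ A ∣) (tight-eq b) sums≤ I-good U-size′)
                  U-size (≰⇒> gt))
        where
        M′ = translate g M
        I = M ∩ M′
        U = M ∪ M′
        perM′ : Periodic J M′
        perM′ = translate-periodic J g per
        doubled : ∀ x → x + x ≡ 2 * x
        doubled = solve-∀
        size : ∣ U ∣ + ∣ I ∣ ≡ 2 * ∣ M ∣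
        size = trans (card-∪∩ M M′) (trans (cong (∣ M ∣ +_) (card-translate g M)) (doubled (∣ M ∣)))
        U-size : ∣ U ∣ + ∣ I ∣ ≤ 2 * ∣ M ∣
        U-size = ≤-reflexive size
        U-size′ : 2 * ∣ M ∣ ≤ ∣ U ∣ + ∣ I ∣
        U-size′ = ≤-reflexive (sym size)
        I-good : ∣ I ∣ + ∣ A ∣ ≤ ∣ I ⊕ A ∣
        I-good with ∣ I ∣ + ∣ A ∣ ≤? ∣ I ⊕ A ∣
        ... | yes p = p
        ... | no np = ⊥-elim (minimal I (≰⇒> lt) (record
                { per = ∩-periodic J per perM′ ; large = ≰⇒> gt
                ; room = ≤-trans (s≤s (+-monoˡ-≤ u (card-mono (⊕-mono ∩ˡ λ p → p)))) room ; tight = ≰⇒> np }))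
        shiftA : M′ ⊕ A ⊂ translate g (M ⊕ A)
        shiftA p with ⊕⁻ p
        ... | _ , a , q , a∈ , refl with translate⁻ {g} {M} q
        ...   | m , m∈ , refl = subst (_∈ translate g (M ⊕ A)) (sym (assoc g m a)) (translate⁺ {g} {M ⊕ A} (⊕⁺ m∈ a∈))
        sums≤ : ∣ U ⊕ A ∣ + ∣ I ⊕ A ∣ ≤ 2 * ∣ M ⊕ A ∣
        sums≤ = begin
          ∣ U ⊕ A ∣ + ∣ I ⊕ A ∣
            ≤⟨ +-mono-≤ (card-mono (⊕-elim (M ⊕ A ∪ M′ ⊕ A) λ p q → side (∪⁻ p) q)) (card-mono λ p → ∩⁺ (⊕-mono ∩ˡ (λ q → q) p) (⊕-mono (∩ʳ {M}) (λ q → q) p)) ⟩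
          ∣ M ⊕ A ∪ M′ ⊕ A ∣ + ∣ (M ⊕ A) ∩ (M′ ⊕ A) ∣   ≡⟨ card-∪∩ (M ⊕ A) (M′ ⊕ A) ⟩
          ∣ M ⊕ A ∣ + ∣ M′ ⊕ A ∣   ≤⟨ +-monoʳ-≤ _ (≤-trans (card-mono shiftA) (≤-reflexive (card-translate g (M ⊕ A)))) ⟩
          ∣ M ⊕ A ∣ + ∣ M ⊕ A ∣    ≡⟨ doubled (∣ M ⊕ A ∣) ⟩
          2 * ∣ M ⊕ A ∣            ∎
          where
          open ≤-Reasoning
          side : ∀ {x a} → x ∈ M ⊎ x ∈ M′ → a ∈ A → x ∙ a ∈ M ⊕ A ∪ M′ ⊕ A
          side (inj₁ p) q = ∪ˡ (⊕⁺ p q)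
          side (inj₂ p) q = ∪ʳ {M ⊕ A} (⊕⁺ p q)
        U+A-full : order ≤ ∣ U ⊕ A ∣
        U+A-full with order ≤? ∣ U ⊕ A ∣
        ... | yes p = p
        ... | no np = ⊥-elim (too-small (growth U (proj₁ neM , ∪ˡ (proj₂ neM)) (∪-periodic J per perM′) (proj₂ (missing (U ⊕ A) (≰⇒> np)))))
          where
          too-small : ∣ U ∣ + ∣ A ∣ ≤ ∣ U ⊕ A ∣ + u → ⊥
          too-small p = contra (∣ U ⊕ A ∣) u (∣ U ∣ + ∣ A ∣) (vo-union (∣ M ⊕ A ∣) (∣ U ∣) (∣ I ∣) (∣ I ⊕ A ∣) (∣ M ∣) (∣ A ∣) u (∣ U ⊕ A ∣) (tight-eq b) sums≤ I-good U-size′) p (‖‖>0 J)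
            where
            contra : ∀ w u t → w + 2 * u ≤ t → t ≤ w + u → 1 ≤ u → ⊥
            contra w u t p q r = linear⊥ 0 (+-mono-≤ p (+-mono-≤ q r)) (eq w u t)
              where
              eq : ∀ w u t → (w + 2 * u) + (t + 1) ≡ suc (t + ((w + u) + u) + 0)
              eq = solve-∀

  -- If it failed, the parts F, F′ of `M` in two V-cosets would have |F| + |F′| ≥ |V| + |J|. For l
  -- in V outside `J`, the overlaps of F and of F′ with their translates by l would together be at
  -- least 2|J|, but the Sidon property allows only |J|.
  two-cosets : ∀ J M → Periodic J M → Sidon J M → ∀ V → J ≤ₛ V → ‖ J ‖ < ‖ V ‖ →
               ∀ {m m′} → m ∈ M → m′ ∈ M → m′ ∉ coset V m → ‖ V ‖ + ∣ M ∣ ≤ ∣ M ⊕ set V ∣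
  two-cosets J M per sidon V J≤V J<V {m} {m′} m∈ m′∈ m′∉ with ‖ V ‖ + ∣ M ∣ ≤? ∣ M ⊕ set V ∣
  ... | yes p = p
  ... | no np with ⊂-or-escape (set V) (set J)
  ...   | inj₁ V≤J = ⊥-elim (<-irrefl refl (≤-trans J<V (card-mono V≤J)))
  ...   | inj₂ (l , l∈ , l∉) = ⊥-elim (vo-sidon⊥ (‖ V ‖) (‖ J ‖) (∣ F ∣) (∣ F′ ∣) (∣ F ∩ translate l F ∣) (∣ F′ ∩ translate l F′ ∣)
            (∣ M ∩ translate l M ∣) many (self-meet m) (self-meet m′) both (sidon l l∉) (‖‖>0 J))
    where
    F = M ∩ coset V m
    F′ = M ∩ coset V m′
    apart : ∀ {x} → x ∈ coset V m → x ∈ coset V m′ → ⊥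
    apart p q = absurd (coset-trans V p (coset-sym V q)) m′∉
    perF : ∀ m → Periodic J (M ∩ coset V m)
    perF m = ∩-periodic J per (coset-periodic {J} V m J≤V)
    many : ‖ V ‖ + ‖ J ‖ ≤ ∣ F ∣ + ∣ F′ ∣
    many = periodic-gap₃ J (set V) F F′ (set-periodic {J} V J≤V) (perF m) (perF m′)
      (vo-fibres (∣ M ∣) (‖ V ‖) (∣ M ⊕ set V ∣) (∣ F ∣) (∣ F′ ∣)
        (begin
          ∣ M ∣ + (‖ V ‖ + ‖ V ‖)
            ≤⟨ +-mono-≤ (card≤closure M J) ≤-refl ⟩
          ∣ M ⊕ set J ∣ + (‖ V ‖ + ‖ V ‖)
            ≤⟨ fill-cosets M V J J≤V m∈ m′∈ m′∉ ⟩
          ∣ M ⊕ set V ∣ + (∣ F ⊕ set J ∣ + ∣ F′ ⊕ set J ∣)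
            ≤⟨ +-monoʳ-≤ (∣ M ⊕ set V ∣) (+-mono-≤ (card-closure F J (perF m)) (card-closure F′ J (perF m′))) ⟩
          ∣ M ⊕ set V ∣ + (∣ F ∣ + ∣ F′ ∣) ∎)
        (≰⇒> np))
      where open ≤-Reasoning
    self-meet : ∀ m → 2 * ∣ M ∩ coset V m ∣ ≤ ‖ V ‖ + ∣ (M ∩ coset V m) ∩ translate l (M ∩ coset V m) ∣
    self-meet m = begin
      2 * ∣ B ∣                      ≡⟨ cong (∣ B ∣ +_) (trans (+-identityʳ _) (sym (card-translate l B))) ⟩
      ∣ B ∣ + ∣ translate l B ∣      ≡⟨ sym (card-∪∩ B (translate l B)) ⟩
      ∣ B ∪ translate l B ∣ + ∣ B ∩ translate l B ∣
        ≤⟨ +-monoˡ-≤ _ (≤-trans (card-mono (∪-elim (∩ʳ {M}) λ p → moved-in (translate⁻ {l} {B} p))) (≤-reflexive (card-coset V m))) ⟩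
      ‖ V ‖ + ∣ B ∩ translate l B ∣  ∎
      where
      open ≤-Reasoning
      B = M ∩ coset V m
      moved-in : ∀ {x} → (∃ λ y → y ∈ B × x ≡ l ∙ y) → x ∈ coset V m
      moved-in (y , y∈ , refl) = coset-trans V (∩ʳ {M} y∈) (subst (_∈ coset V y) (comm y l) (coset-∙ʳ V y l∈))
    both : ∣ F ∩ translate l F ∣ + ∣ F′ ∩ translate l F′ ∣ ≤ ∣ M ∩ translate l M ∣
    both = card-disjoint (M ∩ translate l M) (into m) (into m′) λ p q → apart (∩ʳ {M} (∩ˡ p)) (∩ʳ {M} (∩ˡ q))
      where
      into : ∀ m → (M ∩ coset V m) ∩ translate l (M ∩ coset V m) ⊂ M ∩ translate l M
      into m p with translate⁻ {l} {M ∩ coset V m} (∩ʳ {M ∩ coset V m} p)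
      ... | y , y∈ , refl = ∩⁺ (∩ˡ (∩ˡ p)) (translate⁺ {l} {M} (∩ˡ y∈))

  sidon-meet : ∀ J M → Sidon J M → ∀ {p q} → q ∉ coset J p → ∣ translate p M ∩ translate q M ∣ ≤ ‖ J ‖
  sidon-meet J M sidon {p} {q} q∉ = ≤-trans (card-mono inc) (≤-trans (≤-reflexive (card-translate p (M ∩ translate g M)))
    (sidon g (∉-intro λ r → absurd (coset⁺ J r) q∉)))
    where
    g = p ⁻¹ ∙ q
    inc : translate p M ∩ translate q M ⊂ translate p (M ∩ translate g M)
    inc r with translate⁻ {p} {M} (∩ˡ r) | translate⁻ {q} {M} (∩ʳ {translate p M} r)
    ... | y , y∈ , refl | w , w∈ , eq = translate⁺ {p} {M ∩ translate g M} (∩⁺ y∈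
          (subst (_∈ translate g M) (trans (solve 3 (λ p q w → ((neg p ⊞ q) ⊞ w) ⊜ (neg p ⊞ (q ⊞ w))) refl p q w)
            (trans (cong (p ⁻¹ ∙_) (sym eq)) (solve 2 (λ p y → (neg p ⊞ (p ⊞ y)) ⊜ y) refl p y))) (translate⁺ {g} {M} w∈)))

  another : ∀ J N → Periodic J N → ∀ {p} → p ∈ N → ‖ J ‖ < ∣ N ∣ → ∃ λ q → q ∈ N × q ∉ coset J p
  another J N per {p} p∈ lt with card-nonempty (N ∖ coset J p)
      (+-cancelʳ-< (‖ J ‖) 0 _ (≤-trans lt (≤-reflexive (sym (card-remove-coset J N per p∈)))))
  ... | q , q∈ = q , ∖ˡ q∈ , ∖ʳ q∈

  translate⊂⊕ : ∀ N M {p} → p ∈ N → translate p M ⊂ N ⊕ M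
  translate⊂⊕ N M {p} p∈ q with translate⁻ {p} {M} q
  ... | y , y∈ , refl = ⊕⁺ p∈ y∈

  sidon-two : ∀ J M N → Sidon J M → Periodic J N → ‖ J ‖ < ∣ N ∣ → 2 * ∣ M ∣ ≤ ∣ N ⊕ M ∣ + ‖ J ‖
  sidon-two J M N sidon perN lt with nonempty-large J lt
  ... | p , p∈ with another J N perN p∈ lt
  ...   | q , q∈ , q∉ = vo-pair (∣ M ∣) (∣ N ⊕ M ∣) (∣ translate p M ∩ translate q M ∣) (‖ J ‖)
    (≤-trans (≤-reflexive (trans (cong₂ _+_ (sym (card-translate p M)) (trans (+-identityʳ _) (sym (card-translate q M)))) (sym (card-∪∩ (translate p M) (translate q M)))))
      (+-monoˡ-≤ _ (card-mono (∪-elim (translate⊂⊕ N M p∈) (translate⊂⊕ N M q∈))))) (sidon-meet J M sidon q∉)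

  -- Inclusion and exclusion for three translates of `M`, of which any two share at most |J|
  -- elements.
  sidon-three : ∀ J M N → Sidon J M → Periodic J N → 2 * ‖ J ‖ < ∣ N ∣ → 3 * ∣ M ∣ ≤ ∣ N ⊕ M ∣ + 3 * ‖ J ‖
  sidon-three J M N sidon perN lt with nonempty-large J (≤-trans (s≤s (m≤m+n _ _)) lt)
  ... | p , p∈ with nonempty-large J (+-cancelʳ-< (‖ J ‖) _ (∣ N ∖ coset J p ∣)
          (≤-trans (≤-trans (≤-reflexive (cong suc (cong (‖ J ‖ +_) (sym (+-identityʳ _))))) lt) (≤-reflexive (sym (card-remove-coset J N perN p∈)))))
  ...   | q , q∈ with another J (N ∖ coset J p) (remove-coset-periodic J N p perN) q∈ (+-cancelʳ-< (‖ J ‖) _ (∣ N ∖ coset J p ∣)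
          (≤-trans (≤-trans (≤-reflexive (cong suc (cong (‖ J ‖ +_) (sym (+-identityʳ _))))) lt) (≤-reflexive (sym (card-remove-coset J N perN p∈)))))
  ...     | r , r∈ , r∉ = vo-triple (∣ M ∣) (∣ P ∪ Q ∣) (∣ N ⊕ M ∣) (∣ P ∩ Q ∣) (‖ J ‖) (∣ (P ∪ Q) ∩ R ∣)
    (≤-reflexive (trans (cong₂ _+_ (sym (card-translate p M)) (trans (+-identityʳ _) (sym (card-translate q M)))) (sym (card-∪∩ P Q))))
    (sidon-meet J M sidon (∖ʳ q∈))
    (≤-trans (≤-reflexive (trans (cong (∣ P ∪ Q ∣ +_) (sym (card-translate r M))) (sym (card-∪∩ (P ∪ Q) R))))
      (+-monoˡ-≤ _ (card-mono (∪-elim (∪-elim (translate⊂⊕ N M p∈) (translate⊂⊕ N M (∖ˡ q∈))) (translate⊂⊕ N M (∖ˡ r∈))))))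
    (≤-trans (≤-trans (card-mono distribute) (card-∪≤ (P ∩ R) (Q ∩ R))) (+-mono-≤ (sidon-meet J M sidon (∖ʳ r∈)) (sidon-meet J M sidon r∉)))
    where
    P = translate p M
    Q = translate q M
    R = translate r M
    distribute : (P ∪ Q) ∩ R ⊂ P ∩ R ∪ Q ∩ R
    distribute s with ∪⁻ (∩ˡ s)
    ... | inj₁ t = ∪ˡ (∩⁺ t (∩ʳ {P ∪ Q} s))
    ... | inj₂ t = ∪ʳ (∩⁺ t (∩ʳ {P ∪ Q} s))

  -- If A + x leaves A in a single J-coset then A is a union of V-cosets up to one of them.
  module QuasiPeriodic (J V : Sub) (J≤V : J ≤ₛ V) (A : Subset) (x : C) (x∈V : x ∈ set V) (perA : Periodic J A)
    (few : ∣ translate x A ∖ A ∣ ≤ ‖ J ‖)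
    (leaving : ∀ {a w} → a ∈ A → w ∈ coset V a → w ∉ A → ∃ λ y → y ∈ A × x ∙ y ∉ A × y ∈ coset V a) where

    E B : Subset
    E = translate x A ∖ A
    B = A ⊕ set V ∖ A

    record Gap (z : C) : Set where
      field
        y   : C
        y∈  : y ∈ A
        yz  : y ∈ coset V z
        xy∈ : x ∙ y ∈ E
        xyz : x ∙ y ∈ coset V z

    gap : ∀ {z} → z ∈ B → Gap z
    gap {z} z∈ with closure-coset V (∖ˡ z∈)
    ... | a , a∈ , za with leaving a∈ za (∖ʳ z∈)
    ...   | y , y∈ , xy∉ , ya = record
            { y = y ; y∈ = y∈ ; yz = yz ; xy∈ = ∖⁺ (translate⁺ {x} {A} y∈) xy∉
            ; xyz = coset-trans V yz (subst (_∈ coset V y) (comm y x) (coset-∙ʳ V y x∈V)) }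
      where
      yz : y ∈ coset V z
      yz = coset-trans V (coset-sym V za) ya

    -- Every element of `B` leads to a point of `E` within its own V-coset, and `E` is one J-coset.
    -- Hence all of `B` lies in one V-coset.
    B⊂coset : ∀ {z} (g : Gap z) → B ⊂ coset V z
    B⊂coset g p = coset-trans V (Gap.xyz g) (coset-trans V (coset-mono {J} {V} J≤V (E⊂ (Gap.xy∈ (gap p)))) (coset-sym V (Gap.xyz (gap p))))
      where
      E⊂ : E ⊂ coset J (x ∙ Gap.y g)
      E⊂ = ⊂-antisym (periodic-coset J (∖-periodic J (translate-periodic J x perA) perA) (Gap.xy∈ g))
             (≤-trans few (≤-reflexive (sym (card-coset J (x ∙ Gap.y g)))))

    B<V : ∣ B ∣ < ‖ V ‖
    B<V with search B
    ... | inj₂ none = ≤-trans (s≤s (≤-reflexive (card-empty none))) (‖‖>0 V)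
    ... | inj₁ (z , z∈) = ≤-trans (+-monoˡ-≤ (∣ B ∣) (card-positive (∩⁺ (Gap.y∈ g) (Gap.yz g))))
            (≤-trans (card-disjoint (coset V z) (∩ʳ {A}) (B⊂coset g) (λ p q → absurd (∩ˡ p) (∖ʳ q))) (≤-reflexive (card-coset V z)))
      where g = gap z∈

    fat : ∣ A ⊕ set V ∣ < ‖ V ‖ + ∣ A ∣
    fat = ≤-trans (s≤s (≤-trans (card-mono {A ⊕ set V} {A ∪ B} (λ {w} p → by-member A w ∪ˡ λ q → ∪ʳ {A} (∖⁺ p q))) (card-∪≤ A B)))
      (≤-trans (≤-reflexive (sym (+-suc (∣ A ∣) (∣ B ∣)))) (≤-trans (+-monoʳ-≤ (∣ A ∣) B<V) (≤-reflexive (+-comm (∣ A ∣) (‖ V ‖)))))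

-- An analogue of Vosper's theorem relative to a subgroup

module VosperTheorem (G : D.FiniteAbelianGroup) (e : ℕ) .{{_ : NonZero e}}
                     (exponent : ∀ g → D.FiniteAbelianGroup._·_ G e g ≡ D.FiniteAbelianGroup.ε G) where

  open FiniteSets G
  open KneserTheorem G

  open SidonSets G e exponent

  module Vosper (J : Sub) (A : Subset) (perA : Periodic J A) (bigA : ‖ J ‖ < ∣ A ∣) (thin : NoFat J A)
                (notCyclic : ∀ x → order ≤ ‖ gen x J ‖ → ⊥) where

    private
      u = ‖ J ‖
      neA = nonempty-large J bigA

    module A = Growth J A perA neA thin

    -- With M a union of two J-cosets differing by x, A is a union of <x>-cosets up to one.
    pair : ∀ M → Bad J A M → ∣ M ∣ ≤ 2 * u → ⊥
    pair M b le with nonempty-large J (Bad.large b)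
    ... | m , m∈ with another J M (Bad.per b) m∈ (Bad.large b)
    ...   | m′ , m′∈ , m′∉ = finish (order ≤? ‖ V ‖)
      where
      open Bad b
      x = m ⁻¹ ∙ m′
      V = gen x J
      E = translate x A ∖ A
      x∉J : x ∉ set J
      x∉J = ∉-intro λ p → absurd (coset⁺ J p) m′∉
      J<V : u < ‖ V ‖
      J<V with ‖ V ‖ ≤? u
      ... | no lt = ≰⇒> lt
      ... | yes ge = absurd (⊂-antisym (J≤gen x J) ge (x∈gen x J)) x∉J
      E≤u : ∣ E ∣ ≤ u
      E≤u = vo-two (∣ A ∪ translate x A ∣) (∣ E ∣) (∣ A ∣) u (∣ M ⊕ A ∣) (∣ M ∣)
        (≤-trans (≤-reflexive (sym (card-translate m (A ∪ translate x A)))) (card-mono λ p → into (translate⁻ {m} {A ∪ translate x A} p)))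
        (card-disjoint (A ∪ translate x A) ∪ˡ (λ p → ∪ʳ {A} (∖ˡ p)) (λ p q → absurd p (∖ʳ q)))
        (A.tight-eq b) le
        where
        into : ∀ {z} → (∃ λ y → y ∈ A ∪ translate x A × z ≡ m ∙ y) → z ∈ M ⊕ A
        into (y , y∈ , refl) with ∪⁻ y∈
        ... | inj₁ q = ⊕⁺ m∈ q
        ... | inj₂ q with translate⁻ {x} {A} q
        ...   | a , a∈ , refl = subst (_∈ M ⊕ A) (solve 3 (λ m w a → (w ⊞ a) ⊜ (m ⊞ ((neg m ⊞ w) ⊞ a))) refl m m′ a) (⊕⁺ m′∈ a∈)
      finish : _ → ⊥
      finish (yes cyc) = notCyclic x cyc
      finish (no V<) = <-irrefl refl (≤-trans
        (QuasiPeriodic.fat J V (J≤gen x J) A x (x∈gen x J) perA E≤u (leave J A x perA))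
        (thin V (J≤gen x J) J<V (≰⇒> V<)))

    vosper : ∀ Y → Bad J A Y → ⊥
    vosper Y b = A.atom (∣ Y ∣) Y ≤-refl b sidon-case
      where
      sidon-case : ∀ M → Bad J A M → Sidon J M → ⊥
      sidon-case M bM sidon with ∣ M ∣ ≤? 2 * u
      ... | yes le = pair M bM le
      -- The roles are exchanged: `A` is bad for `M`, so a smallest bad set for `M` exists and is
      -- Sidon too. Two Sidon sets of more than two J-cosets each cannot have so small a sum.
      ... | no gt = Growth.atom J M perM neM thinM (∣ A ∣) A ≤-refl badA last
        where
        open Bad bM renaming (per to perM)
        neM = nonempty-large J large
        m = proj₁ neM
        m∈ = proj₂ neM
        3u : 2 * u < ∣ M ∣
        3u = ≰⇒> gt
        AM≤ : ∣ A ⊕ M ∣ ≤ ∣ M ⊕ A ∣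
        AM≤ = card-mono ⊕-comm
        badA : Bad J M A
        badA = record { per = perA ; large = bigA ; room = ≤-trans (s≤s (+-monoˡ-≤ u AM≤)) room
                      ; tight = ≤-trans (s≤s AM≤) (≤-trans tight (≤-reflexive (+-comm (∣ M ∣) (∣ A ∣)))) }
        tightA : ∣ A ⊕ M ∣ + u ≤ ∣ A ∣ + ∣ M ∣
        tightA = periodic-gap₃ J (A ⊕ M) A M (⊕-periodicˡ J M perA) perA perM (Bad.tight badA)
        -- Take the smallest V with `M` in a coset m + V. If m + A + V lies in A + M, then |A + V| <
        -- |A| + |V|, against `thin`. Otherwise some coset a + V of A + V is not filled after adding
        -- `M`. Let P be the part of `A` in it and Q the rest. Kneser's theorem and minimality of V
        -- give |P| + |M| ≤ |P + M| + |J|, so tightness leaves |Q + M| ≤ |Q|. Thus M - m consists of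
        -- periods of Q, by minimality V does, and again |A + V| < |A| + |V|.
        generating : ∀ n V → ‖ V ‖ ≤ n → J ≤ₛ V → M ⊂ coset V m → ‖ V ‖ < order → ⊥
        generating zero V le _ _ _ = <-irrefl refl (≤-trans (‖‖>0 V) le)
        generating (suc n) V le J≤V M⊂ V< = go (⊂-or-escape (translate m (A ⊕ set V)) (A ⊕ M))
          where
          M≤V : ∣ M ∣ ≤ ‖ V ‖
          M≤V = ≤-trans (card-mono M⊂) (≤-reflexive (card-coset V m))
          J<V : u < ‖ V ‖
          J<V = ≤-trans large M≤V
          fat = thin V J≤V J<V V<
          minimal : ∀ W → ‖ W ‖ < ‖ V ‖ → J ≤ₛ W → M ⊂ coset W m → ⊥
          minimal W lt J≤W M⊂W = generating n W (s≤s⁻¹ (≤-trans lt le)) J≤W M⊂W (≤-trans lt (<⇒≤ V<))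
          go : _ → ⊥
          go (inj₁ inc) = <-irrefl refl (≤-trans (Bad.tight badA) (≤-trans (+-monoʳ-≤ (∣ A ∣) M≤V)
            (≤-trans (≤-reflexive (+-comm (∣ A ∣) (‖ V ‖))) (≤-trans fat
              (≤-trans (≤-reflexive (sym (card-translate m (A ⊕ set V)))) (card-mono inc))))))
          go (inj₂ (z , z∈ , z∉)) with translate⁻ {m} {A ⊕ set V} z∈
          ... | y , y∈ , refl with closure-coset V y∈
          ...   | a , a∈ , ya = <-irrefl refl (≤-trans (≤-trans (s≤s (≤-trans (card-mono closed) (card-∪≤ Q (coset V a))))
                    (≤-trans (+-monoʳ-≤ (suc (∣ Q ∣)) (≤-reflexive (card-coset V a)))
                    (≤-trans (+-monoˡ-≤ (‖ V ‖) (≤-trans (+-monoˡ-≤ (∣ Q ∣) (card-positive (∩⁺ a∈ (coset-refl V a)))) (≤-reflexive (trans (+-comm (∣ P ∣) (∣ Q ∣)) parts))))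
                      (≤-reflexive (+-comm (∣ A ∣) (‖ V ‖)))))) fat)
            where
            P = A ∩ coset V a
            Q = A ∖ coset V a
            parts : ∣ Q ∣ + ∣ P ∣ ≡ ∣ A ∣
            parts = card-∖ A (coset V a)
            perP : Periodic J P
            perP = ∩-periodic J perA (coset-periodic {J} V a J≤V)
            neP : Nonempty P
            neP = a , ∩⁺ a∈ (coset-refl V a)
            W = stab (P ⊕ M)
            PM⊂ : P ⊕ M ⊂ coset V (a ∙ m)
            PM⊂ = ⊕-elim (coset V (a ∙ m)) λ p q → coset-∙ V (∩ʳ {A} p) (M⊂ q)
            W≤V : W ≤ₛ V
            W≤V = period-bound V PM⊂ (⊕-nonempty neP neM) W (stab-periodic (P ⊕ M))
            J≤W : J ≤ₛ W
            J≤W = stab-maximal J (P ⊕ M) (⊕-periodicˡ J M perP)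
            W<V : ‖ W ‖ < ‖ V ‖
            W<V with ‖ V ‖ ≤? ‖ W ‖
            ... | no lt = ≰⇒> lt
            ... | yes ge = absurd (⊕-mono ∩ˡ (λ p → p) (periodic-coset V (λ v∈ → stab-periodic (P ⊕ M) (⊂-antisym W≤V ge v∈))
                    (⊕⁺ (proj₂ neP) m∈) (subst (_∈ coset V (a ∙ m)) (comm y m) (coset-∙ V ya (coset-refl V m))))) z∉
            grown : ∣ P ∣ + ∣ M ∣ ≤ ∣ P ⊕ M ∣ + u
            grown with ‖ W ‖ ≤? u
            ... | yes le′ = ≤-trans (+-mono-≤ (card≤closure P W) (card≤closure M W)) (≤-trans (kneser neP neM) (+-monoʳ-≤ _ le′))
            ... | no gt′ with ⊂-or-escape M (coset W m)
            ...   | inj₁ M⊂W = ⊥-elim (minimal W W<V J≤W M⊂W)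
            ...   | inj₂ (m′ , m′∈ , m′∉) = ≤-trans (vo-growth (∣ P ∣) (∣ M ∣) (∣ P ⊕ set W ∣) (∣ M ⊕ set W ∣) (∣ P ⊕ M ∣) (‖ W ‖)
                    (two-cosets J M perM sidon W J≤W (≰⇒> gt′) m∈ m′∈ m′∉) (card≤closure P W) (kneser neP neM)) (m≤m+n _ u)
            QM≤Q : ∣ Q ⊕ M ∣ ≤ ∣ Q ∣
            QM≤Q = vo-rest (∣ P ∣) (∣ Q ∣) (∣ A ∣) (∣ M ∣) (∣ A ⊕ M ∣) u (∣ P ⊕ M ∣) (∣ Q ⊕ M ∣)
              (≤-reflexive (trans (sym parts) (+-comm (∣ Q ∣) (∣ P ∣)))) grown
              (card-disjoint (A ⊕ M) (⊕-mono ∩ˡ (λ p → p)) (⊕-mono ∖ˡ (λ p → p)) λ p q → apart (PM⊂ p) (⊕⁻ q)) tightA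
              where
              apart : ∀ {w} → w ∈ coset V (a ∙ m) → (∃ λ q → ∃ λ m′ → q ∈ Q × m′ ∈ M × w ≡ q ∙ m′) → ⊥
              apart p (q , m′ , q∈ , m′∈ , refl) = absurd (coset⁺ V (subst (_∈ set V)
                (solve 4 (λ a m q w → ((neg (a ⊞ m) ⊞ (q ⊞ w)) ⊞ (neg w ⊞ m)) ⊜ (neg a ⊞ q)) refl a m q m′)
                (∙∈ V (coset⁻ V p) (coset⁻ V (coset-sym V (M⊂ m′∈)))))) (∖ʳ q∈)
            QM⊂ : Q ⊕ M ⊂ translate m Q
            QM⊂ = ⊂-antisym mQ⊂ (≤-trans QM≤Q (≤-reflexive (sym (card-translate m Q))))
              where
              mQ⊂ : translate m Q ⊂ Q ⊕ M
              mQ⊂ p with translate⁻ {m} {Q} p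
              ... | q , q∈ , refl = ⊕-comm (⊕⁺ m∈ q∈)
            W′ = stab Q ∧ₛ V
            J≤W′ : J ≤ₛ W′
            J≤W′ p = ∩⁺ (stab-maximal J Q (∖-periodic J perA (coset-periodic {J} V a J≤V)) p) (J≤V p)
            M⊂W′ : M ⊂ coset W′ m
            M⊂W′ {m′} m′∈ = coset⁺ W′ (∩⁺ (stab-complete Q λ {q} q∈ → unshift q (translate⁻ {m} {Q} (QM⊂ (⊕⁺ q∈ m′∈)))) (coset⁻ V (M⊂ m′∈)))
              where
              unshift : ∀ q → (∃ λ w → w ∈ Q × q ∙ m′ ≡ m ∙ w) → q ∙ (m ⁻¹ ∙ m′) ∈ Q
              unshift q (w , w∈ , eq) = subst (_∈ Q) (trans (solve 2 (λ m w → w ⊜ (neg m ⊞ (m ⊞ w))) refl m w)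
                (trans (cong (m ⁻¹ ∙_) (sym eq)) (solve 3 (λ m q n → (neg m ⊞ (q ⊞ n)) ⊜ (q ⊞ (neg m ⊞ n))) refl m q m′))) w∈
            V≤stabQ : V ≤ₛ stab Q
            V≤stabQ p with ‖ V ‖ ≤? ‖ W′ ‖
            ... | yes ge = ∧ₛ-≤ˡ (stab Q) V (⊂-antisym (∧ₛ-≤ʳ (stab Q) V) ge p)
            ... | no lt = ⊥-elim (minimal W′ (≰⇒> lt) J≤W′ M⊂W′)
            closed : A ⊕ set V ⊂ Q ∪ coset V a
            closed = closure⊂ V (∪-periodic V (λ v∈ → stab-periodic Q (V≤stabQ v∈)) (coset-periodic {V} V a (λ p → p)))
              λ {w} w∈ → by-member (coset V a) w (∪ʳ {Q}) (λ w∉ → ∪ˡ (∖⁺ w∈ w∉))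
        thinM : NoFat J M
        thinM V J≤V J<V V< with ⊂-or-escape M (coset V m)
        ... | inj₁ M⊂ = ⊥-elim (generating (‖ V ‖) V ≤-refl J≤V M⊂ V<)
        ... | inj₂ (m′ , m′∈ , m′∉) = two-cosets J M perM sidon V J≤V J<V m∈ m′∈ m′∉
        last : ∀ N → Bad J M N → Sidon J N → ⊥
        -- With s = |N + M|, three translates give 3|M| and 3|N| ≤ s + 3|J|, while s ≤ |N| + |M| -
        -- |J|. Adding yields |N| + |M| ≤ 4|J|, but both exceed 2|J|.
        last N bN sidonN = vo-final⊥ (∣ M ∣) (∣ N ∣) (∣ N ⊕ M ∣) u
          (sidon-three J M N sidon (Bad.per bN) N>2u)
          (≤-trans (sidon-three J N M sidonN perM 3u) (+-monoˡ-≤ _ (card-mono ⊕-comm)))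
          tightN 3u N>2u
          where
          tightN : ∣ N ⊕ M ∣ + u ≤ ∣ N ∣ + ∣ M ∣
          tightN = periodic-gap₃ J (N ⊕ M) N M (⊕-periodicˡ J M (Bad.per bN)) (Bad.per bN) perM (Bad.tight bN)
          N>2u : 2 * u < ∣ N ∣
          N>2u = ≤-trans 3u (vo-larger (∣ M ∣) (∣ N ∣) (∣ N ⊕ M ∣) u (sidon-two J M N sidon (Bad.per bN) (Bad.large bN)) tightN)

-- Iterated sumsets

pu-thin⊥ : ∀ bv v b av a u → bv + u ≤ v + b → 1 + b ≤ u + a → v + a ≤ av → av ≤ bv → ⊥
pu-thin⊥ bv v b av a u q1 q2 q3 q4 = linear⊥ 0 (+-mono-≤ q1 (+-mono-≤ q2 (+-mono-≤ q3 q4))) (eq bv v b av a u)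
  where
  eq : ∀ bv v b av a u → ((bv + u) + ((1 + b) + ((v + a) + av))) ≡ suc (((v + b) + ((u + a) + (av + bv))) + 0)
  eq = solve-∀

pu-fibres : ∀ a u w f g → a + (u + u) ≤ w + (f + g) → 1 + w ≤ u + a → 1 + u ≤ f + g
pu-fibres a u w f g q1 q2 = linear (1 + u) (f + g) 0 (+-mono-≤ q1 q2) (eq a u w f g)
  where
  eq : ∀ a u w f g → (1 + u) + ((w + (f + g)) + (u + a)) + 0 ≡ (f + g) + ((a + (u + u)) + (1 + w))
  eq = solve-∀

pu-other : ∀ f g u → 1 + u ≤ f + g → 2 * f ≤ u → 1 + u ≤ 2 * g
pu-other f g u q1 q2 = linear (1 + u) (2 * g) 1 (+-mono-≤ q1 (+-mono-≤ q1 q2)) (eq f g u)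
  where
  eq : ∀ f g u → (1 + u) + ((f + g) + ((f + g) + u)) + 1 ≡ (2 * g) + ((1 + u) + ((1 + u) + (2 * f)))
  eq = solve-∀

pu-half : ∀ a b f u → a + u ≤ b + f → 2 * f ≤ u → 2 * a + u ≤ 2 * b
pu-half a b f u q1 q2 = linear (2 * a + u) (2 * b) 0 (+-mono-≤ q1 (+-mono-≤ q1 q2)) (eq a b f u)
  where
  eq : ∀ a b f u → (2 * a + u) + ((b + f) + ((b + f) + u)) + 0 ≡ (2 * b) + ((a + u) + ((a + u) + (2 * f)))
  eq = solve-∀

pu-slack⊥ : ∀ o a b u m → 1 + o ≤ (3 + m) * a → (3 + m) * (2 * a + u) ≤ (3 + m) * (2 * b) → (3 + m) * b ≤ o + u → ⊥
pu-slack⊥ o a b u m q1 q2 q3 = linear⊥ (1 + u + m * u) (+-mono-≤ q1 (+-mono-≤ q1 (+-mono-≤ q2 (+-mono-≤ q3 q3)))) (eq o a b u m)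
  where
  eq : ∀ o a b u m → ((1 + o) + ((1 + o) + (((3 + m) * (2 * a + u)) + (((3 + m) * b) + ((3 + m) * b))))) ≡ suc ((((3 + m) * a) + (((3 + m) * a) + (((3 + m) * (2 * b)) + ((o + u) + (o + u))))) + (1 + u + m * u))
  eq = solve-∀

pu-alt : ∀ o x b u m c → m * b ≤ x → c + x ≤ o → b ≤ c + u → b + m * b ≤ o + u
pu-alt o x b u m c q1 q2 q3 = linear (b + m * b) (o + u) 0 (+-mono-≤ q1 (+-mono-≤ q2 q3)) (eq o x b u m c)
  where
  eq : ∀ o x b u m c → (b + m * b) + (x + (o + (c + u))) + 0 ≡ (o + u) + ((m * b) + ((c + x) + b))
  eq = solve-∀

pu-small : ∀ o x b u c → c + x ≤ o → b ≤ c + u → o ≤ x + u → b ≤ 2 * u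
pu-small o x b u c q1 q2 q3 = linear b (2 * u) 0 (+-mono-≤ q1 (+-mono-≤ q2 q3)) (eq o x b u c)
  where
  eq : ∀ o x b u c → b + (o + ((c + u) + (x + u))) + 0 ≡ (2 * u) + ((c + x) + (b + o))
  eq = solve-∀

pu-top : ∀ x y b u o m → x + b ≤ y + u → m * b ≤ x → o + u ≤ b + m * b → o ≤ y
pu-top x y b u o m q1 q2 q3 = linear o y 0 (+-mono-≤ q1 (+-mono-≤ q2 q3)) (eq x y b u o m)
  where
  eq : ∀ x y b u o m → o + ((y + u) + (x + (b + m * b))) + 0 ≡ y + ((x + b) + ((m * b) + (o + u)))
  eq = solve-∀

pu-grow : ∀ x y b u k → x + b ≤ y + u → 2 * u ≤ b → k ≤ x → u + k ≤ y
pu-grow x y b u k q1 q2 q3 = linear (u + k) y 0 (+-mono-≤ q1 (+-mono-≤ q2 q3)) (eq x y b u k)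
  where
  eq : ∀ x y b u k → (u + k) + ((y + u) + (b + x)) + 0 ≡ y + ((x + b) + ((2 * u) + k))
  eq = solve-∀

module Iterated (G : D.FiniteAbelianGroup) (e : ℕ) .{{_ : NonZero e}}
                (exponent : ∀ g → D.FiniteAbelianGroup._·_ G e g ≡ D.FiniteAbelianGroup.ε G) where

  open FiniteSets G
  open KneserTheorem G
  open SidonSets G e exponent

  fold : ℕ → Subset → Sub → Subset
  fold zero    A J = set J
  fold (suc j) A J = A ⊕ fold j A J

  fold-periodic : ∀ j A J → Periodic J (fold j A J)
  fold-periodic zero    A J = set-periodic {J} J (λ p → p)
  fold-periodic (suc j) A J = ⊕-periodicʳ J A (fold-periodic j A J)

  fold-multiple : ∀ j {A} J {a} → a ∈ A → j · a ∈ fold j A J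
  fold-multiple zero    J a∈ = ε∈ J
  fold-multiple (suc j) J a∈ = ⊕⁺ a∈ (fold-multiple j J a∈)

  fold-prepend : ∀ j {A} J k {a y} → a ∈ A → y ∈ fold k A J → (j · a) ∙ y ∈ fold (j + k) A J
  fold-prepend zero    {A} J k {y = y} a∈ y∈ = subst (_∈ fold k A J) (sym (identityˡ y)) y∈
  fold-prepend (suc j) {A} J k {a} {y} a∈ y∈ =
    subst (_∈ fold (suc j + k) A J) (sym (assoc a (j · a) y)) (⊕⁺ a∈ (fold-prepend j J k a∈ y∈))

  fold-closure : ∀ j A {H J} → H ≤ₛ J → fold j (A ⊕ set J) J ⊂ fold j A H ⊕ set J
  fold-closure zero A {H} {J} H≤J {x} p = closure-intro J (ε∈ H) (coset⁺ J (subst (_∈ set J) (solve 1 (λ x → x ⊜ (neg nil ⊞ x)) refl x) p))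
  fold-closure (suc j) A {H} {J} H≤J p with ⊕⁻ p
  ... | _ , _ , p₁ , p₂ , refl with ⊕⁻ p₁ | ⊕⁻ (fold-closure j A {H} {J} H≤J p₂)
  ...   | a , k , a∈ , k∈ , refl | b , l , b∈ , l∈ , refl =
          subst (_∈ fold (suc j) A H ⊕ set J) (interchange a b k l) (⊕⁺ (⊕⁺ a∈ b∈) (∙∈ J k∈ l∈))

  fold-nonempty : ∀ j {A} J → Nonempty A → Nonempty (fold j A J)
  fold-nonempty zero    J neA = ε , ε∈ J
  fold-nonempty (suc j) J neA = ⊕-nonempty neA (fold-nonempty j J neA)

  upTo : C → Sub → ℕ → Subset
  upTo x J zero    = λ _ → false
  upTo x J (suc k) = coset J (k · x) ∪ upTo x J k

  upTo⁻ : ∀ x J k {g} → g ∈ upTo x J k → ∃ λ i → i < k × g ∈ coset J (i · x)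
  upTo⁻ x J (suc k) p with ∪⁻ {coset J (k · x)} p
  ... | inj₁ q = k , ≤-refl , q
  ... | inj₂ q with upTo⁻ x J k q
  ...   | i , lt , r = i , m≤n⇒m≤1+n lt , r

  distinct-multiples : ∀ x J k → (∃ λ d → 1 ≤ d × d < k × d · x ∈ set J) ⊎ k * ‖ J ‖ ≤ ∣ upTo x J k ∣
  distinct-multiples x J zero = inj₂ z≤n
  distinct-multiples x J (suc k) with distinct-multiples x J k
  ... | inj₁ (d , ge , lt , p) = inj₁ (d , ge , m≤n⇒m≤1+n lt , p)
  ... | inj₂ ge with search (coset J (k · x) ∩ upTo x J k)
  ...   | inj₂ none = inj₂ (≤-trans (+-mono-≤ (≤-reflexive (sym (card-coset J (k · x)))) ge)
    (≤-reflexive (sym (card-∪-disjoint (coset J (k · x)) (upTo x J k) λ {g} p q → absurd (∩⁺ p q) (none g)))))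
  ...   | inj₁ (g , p) with upTo⁻ x J k (∩ʳ {coset J (k · x)} p)
  ...     | i , lt , q = inj₁ (k ∸ i , m<n⇒0<n∸m lt , s≤s (m∸n≤m k i) , subst (_∈ set J) eq (coset⁻ J (coset-trans J q (coset-sym J (∩ˡ p)))))
    where
    eq : (i · x) ⁻¹ ∙ (k · x) ≡ (k ∸ i) · x
    eq = trans (cong (λ j → (i · x) ⁻¹ ∙ (j · x)) (sym (m+[n∸m]≡n (<⇒≤ lt))))
      (trans (cong ((i · x) ⁻¹ ∙_) (·-+ i (k ∸ i) x)) (solve 2 (λ y w → (neg y ⊞ (y ⊞ w)) ⊜ w) refl (i · x) ((k ∸ i) · x)))

  -- The cosets of n + 1 multiples of `x` cannot all be distinct modulo `J`.
  small-order : ∀ n J x → order ≤ n * ‖ J ‖ → ∃ λ d → 1 ≤ d × d ≤ n × d · x ∈ set J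
  small-order n J x le with distinct-multiples x J (suc n)
  ... | inj₁ (d , ge , s≤s lt , p) = d , ge , lt , p
  ... | inj₂ ge = ⊥-elim (<-irrefl refl (≤-trans (+-monoˡ-≤ (n * ‖ J ‖) (‖‖>0 J)) (≤-trans ge (≤-trans (card≤order _) le))))

  multiple-gap′ : ∀ J n B → Periodic J B → order < n * ∣ B ∣ → order + ‖ J ‖ ≤ n * ∣ B ∣
  multiple-gap′ J n B per lt with periodic-card J B per | periodic-card J full (full-periodic J)
  ... | l , eq | k , eq′ rewrite eq = begin
    order + u        ≡⟨ cong (_+ u) ord ⟩
    k * u + u        ≡⟨ +-comm (k * u) u ⟩
    suc k * u        ≤⟨ *-monoˡ-≤ u (*-cancelʳ-< u k (n * l) (≤-trans (≤-reflexive (cong suc (sym ord))) (≤-trans lt (≤-reflexive (sym (*-assoc n l u)))))) ⟩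
    n * l * u        ≡⟨ *-assoc n l u ⟩
    n * (l * u)      ∎
    where
    open ≤-Reasoning
    u = ‖ J ‖
    ord : order ≡ k * u
    ord = trans (sym ∣full∣) eq′

  -- `cyclic` bounds the order of a cyclic quotient by n. It is supplied by the first item of the
  -- theorem, and by the second one when the complement has prime order.
  module Cover (H : Sub) (A : Subset) (perA : Periodic H A) (m : ℕ) (big : order < (3 + m) * ∣ A ∣)
    (generating : ∀ V → H ≤ₛ V → ‖ V ‖ < order → ∀ a → A ⊂ coset V a → ⊥)
    (cyclic : ∀ J → H ≤ₛ J → ‖ J ‖ < order → ∀ x → order ≤ ‖ gen x J ‖ → order ≤ (3 + m) * ‖ J ‖)
    {z : C} (z∉ : z ∉ fold (3 + m) A H) where

    n : ℕ
    n = 3 + m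

    neA : Nonempty A
    neA with search A
    ... | inj₁ p = p
    ... | inj₂ none = ⊥-elim (n≮0 (≤-trans big (≤-reflexive (trans (cong (n *_) (card-empty none)) (*-zeroʳ n)))))

    -- `above` says that `J` is maximal with |A + J| < |J| + |A|. Maximality makes B = A + J satisfy
    -- `NoFat`, and the inequality itself makes any two J-fibres of `A` large together.
    module Level (J : Sub) (H≤J : H ≤ₛ J) (J< : ‖ J ‖ < order) (fat : ∣ A ⊕ set J ∣ < ‖ J ‖ + ∣ A ∣)
                 (above : ∀ V → J ≤ₛ V → ‖ J ‖ < ‖ V ‖ → ‖ V ‖ < order → ∣ A ⊕ set V ∣ < ‖ V ‖ + ∣ A ∣ → ⊥) where

      u = ‖ J ‖
      B = A ⊕ set J

      perB : Periodic J B
      perB = closure-periodic {J} A J (λ p → p)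

      neB : Nonempty B
      neB = proj₁ neA , ⊂⊕ J (proj₂ neA)

      thin : NoFat J B
      thin V J≤V J<V V< with ‖ V ‖ + ∣ B ∣ ≤? ∣ B ⊕ set V ∣
      ... | yes p = p
      ... | no np = ⊥-elim (pu-thin⊥ (∣ B ⊕ set V ∣) (‖ V ‖) (∣ B ∣) (∣ A ⊕ set V ∣) (∣ A ∣) u
              (periodic-gap₃ J (B ⊕ set V) (set V) B (closure-periodic {J} B V J≤V) (set-periodic {J} V J≤V) perB (≰⇒> np))
              fat (≮⇒≥ (above V J≤V J<V V<)) (card-closure-mono V V (⊂⊕ J) (λ p → p)))

      other : ∀ c → ∃ λ a → a ∈ A × a ∉ coset J c
      other c with ⊂-or-escape A (coset J c)
      ... | inj₁ inc = ⊥-elim (generating J H≤J J< c inc)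
      ... | inj₂ q = q

      bigB : u < ∣ B ∣
      bigB with other (proj₁ neA)
      ... | a , a∈ , a∉ = ≤-trans (≤-reflexive (cong suc (sym (card-coset J (proj₁ neA)))))
        (≤-trans (≤-reflexive (+-comm 1 _)) (≤-trans (+-monoʳ-≤ _ (card-positive (coset-refl J a)))
          (card-disjoint B (periodic-coset J perB (proj₂ neB)) (periodic-coset J perB (⊂⊕ J a∈))
            λ p q → absurd (coset-trans J p (coset-sym J q)) a∉)))

      open Growth J B perB neB thin using (growth)

      foldB : ℕ → Subset
      foldB j = fold j B J

      fibre-size : C → ℕ
      fibre-size p = ∣ A ∩ coset J p ∣

      two-fibres : ∀ {p q} → p ∈ A → q ∈ A → q ∉ coset J p → u < fibre-size p + fibre-size q
      two-fibres {p} {q} p∈ q∈ q∉ = pu-fibres (∣ A ∣) u (∣ B ∣) (fibre-size p) (fibre-size q)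
        (≤-trans (+-monoˡ-≤ _ (card≤closure A H)) (≤-trans (fill-cosets A J H H≤J p∈ q∈ q∉)
          (+-monoʳ-≤ (∣ B ∣) (+-mono-≤ (card-closure _ H (per p)) (card-closure _ H (per q)))))) fat
        where
        per : ∀ p → Periodic H (A ∩ coset J p)
        per p = ∩-periodic H perA (coset-periodic {H} J p H≤J)

      fibres-fill : ∀ {p q} → u < fibre-size p + fibre-size q → coset J (p ∙ q) ⊂ A ⊕ A
      fibres-fill {p} {q} lt {w} w∈ = ⊕-mono ∩ˡ ∩ˡ (pigeonhole {A ∩ coset J p} {A ∩ coset J q} (coset J p) w (∩ʳ {A}) refl⊂
        (≤-trans (≤-reflexive (cong suc (card-coset J p))) lt))
        where
        refl⊂ : reflect w (A ∩ coset J q) ⊂ coset J p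
        refl⊂ {y} r with reflect⁻ {w} {A ∩ coset J q} r
        ... | f , f∈ , eq = coset⁺ J (subst (_∈ set J) (solve 4 (λ p q y f → ((neg (p ⊞ q) ⊞ (y ⊞ f)) ⊞ (neg f ⊞ q)) ⊜ (neg p ⊞ y)) refl p q y f)
              (∙∈ J (subst (λ v → (p ∙ q) ⁻¹ ∙ v ∈ set J) eq (coset⁻ J w∈)) (coset⁻ J (coset-sym J (∩ʳ {A} f∈)))))

      -- Two summands already fill a J-coset, so the other 1 + m need to be lifted from `B` to `A`
      -- only modulo `J`; the error is absorbed by the filled coset.
      conclude : ∀ {p q w} → coset J (p ∙ q) ⊂ A ⊕ A → w ∈ foldB (suc m) → z ∈ coset J ((p ∙ q) ∙ w) → ⊥
      conclude {p} {q} {w} fills w∈ z∈ with ⊕⁻ (fold-closure (suc m) A {H} {J} H≤J w∈)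
      ... | y , k , y∈ , k∈ , refl = absurd (⊕-assoc⁻ (subst (_∈ A ⊕ A ⊕ fold (suc m) A H) (solve 2 (λ z y → ((z ⊟ y) ⊞ y) ⊜ z) refl z y)
              (⊕⁺ (fills (coset⁺ J (subst (_∈ set J) (solve 4 (λ p y k z → ((neg (p ⊞ (y ⊞ k)) ⊞ z) ⊞ k) ⊜ (neg p ⊞ (z ⊟ y))) refl (p ∙ q) y k z)
                (∙∈ J (coset⁻ J z∈) k∈)))) y∈))) z∉

      -- Brings to the front a summand outside the J-coset of `b`, if there is one.
      mix : ∀ j b {w} → w ∈ foldB (suc j) →
            (∃ λ q → ∃ λ w′ → q ∈ B × q ∉ coset J b × w′ ∈ foldB j × w ≡ q ∙ w′) ⊎ w ∈ coset J (suc j · b)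
      mix j b p with ⊕⁻ p
      ... | q , w′ , q∈ , w′∈ , refl with member? (coset J b) q
      ...   | inj₂ q∉ = inj₁ (q , w′ , q∈ , q∉ , w′∈ , refl)
      mix zero b p | q , w′ , q∈ , w′∈ , refl | inj₁ qb = inj₂ (coset-∙ J qb (coset⁺ J (subst (_∈ set J) (solve 1 (λ x → x ⊜ (neg nil ⊞ x)) refl w′) w′∈)))
      mix (suc j) b p | q , w′ , q∈ , w′∈ , refl | inj₁ qb with mix j b w′∈
      ... | inj₂ r = inj₂ (coset-∙ J qb r)
      ... | inj₁ (r , v , r∈ , r∉ , v∈ , refl) = inj₁ (r , q ∙ v , r∈ , r∉ , ⊕⁺ q∈ v∈ , solve 3 (λ q r v → (q ⊞ (r ⊞ v)) ⊜ (r ⊞ (q ⊞ v))) refl q r v)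

      mixed : ∀ {b q w} → b ∈ B → q ∈ B → q ∉ coset J b → w ∈ foldB (suc m) → z ∈ coset J (b ∙ (q ∙ w)) → ⊥
      mixed {b} {q} {w} b∈ q∈ q∉ w∈ z∈ with closure-coset J b∈ | closure-coset J q∈
      ... | b′ , b′∈ , bb′ | q′ , q′∈ , qq′ = conclude {b′} {q′}
              (fibres-fill (two-fibres b′∈ q′∈ (∉-intro λ r → absurd (coset-trans J (coset-sym J bb′) (coset-trans J r qq′)) q∉))) w∈
              (coset-trans J (coset-∙ J (coset-∙ J bb′ qq′) (coset-refl J w)) (subst (λ v → z ∈ coset J v) (sym (assoc b q w)) z∈))

      pure : ∀ {a} → a ∈ A → u < 2 * fibre-size a → z ∈ coset J (n · a) → ⊥
      pure {a} a∈ lt z∈ = conclude {a} {a} (fibres-fill (≤-trans lt (≤-reflexive (cong (fibre-size a +_) (+-identityʳ _)))))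
        (fold-multiple (suc m) J (⊂⊕ J a∈)) (subst (λ v → z ∈ coset J v) (sym (assoc a a _)) z∈)

      -- A second representation of n·c modulo `J`, using a summand from another J-coset.
      Alternative : C → Set
      Alternative c = ∃ λ q → ∃ λ w → q ∈ B × q ∉ coset J c × w ∈ foldB (2 + m) × n · c ≡ q ∙ w

      -- A representation of `z` with two different J-classes lifts to `A`, and so does one by n
      -- equal classes whose fibre exceeds |J|/2. Only n·c with a small fibre at c remains. There
      -- the alternative is either mixed, or constant in a class whose fibre is large, as two
      -- distinct fibres together exceed |J|.
      lift : z ∈ foldB n → (∀ {c} → c ∈ A → 2 * fibre-size c ≤ u → (Alternative c → ⊥) → ⊥) → ⊥
      lift zB alt with ⊕⁻ zB
      ... | b , w , b∈ , w∈ , z≡ with mix (suc m) b w∈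
      ...   | inj₁ (q , w′ , q∈ , q∉ , w′∈ , refl) = mixed b∈ q∈ q∉ w′∈ (subst (z ∈_) (cong (coset J) z≡) (coset-refl J z))
      ...   | inj₂ wb with closure-coset J b∈
      ...     | c , c∈ , bc = go (u <? 2 * fibre-size c)
        where
        multiple : ∀ k {x y} → y ∈ coset J x → k · y ∈ coset J (k · x)
        multiple zero    p = coset-refl J ε
        multiple (suc k) p = coset-∙ J p (multiple k p)
        z∈ : z ∈ coset J (n · c)
        z∈ = coset-trans J (multiple n bc) (subst (_∈ coset J (n · b)) (sym z≡) (coset-∙ J (coset-refl J b) wb))
        go : _ → ⊥
        go (yes lt) = pure c∈ lt z∈
        go (no ge) = alt c∈ (≮⇒≥ ge) use
          where
          use : Alternative c → ⊥
          use (q , w , q∈ , q∉ , w∈ , eq) with mix (suc m) q w∈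
          ... | inj₁ (r , w′ , r∈ , r∉ , w′∈ , refl) = mixed q∈ r∈ r∉ w′∈ (subst (λ v → z ∈ coset J v) eq z∈)
          ... | inj₂ wq with closure-coset J q∈
          ...   | q′ , q′∈ , qq′ = pure q′∈ (pu-other (fibre-size c) (fibre-size q′) u
                    (two-fibres c∈ q′∈ (∉-intro λ r → absurd (coset-trans J r qq′) q∉)) (≮⇒≥ ge))
                    (coset-trans J (multiple n qq′) (coset-trans J (coset-∙ J (coset-refl J q) wq) (subst (λ v → z ∈ coset J v) eq z∈)))

      full-intro : ∀ {Y} → order ≤ ∣ Y ∣ → ∀ x → x ∈ Y
      full-intro {Y} le x = ⊂-antisym {Y} {full} (λ _ → full⁺) (≤-trans (≤-reflexive ∣full∣) le) full⁺

      cyclic-case : ∀ x → order ≤ ‖ gen x J ‖ → ⊥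
      cyclic-case x cyc = lift (full-intro (reach n (≤-refl)) z) alternative
        where
        small : order ≤ n * u
        small = cyclic J H≤J J< x cyc
        2u≤B : 2 * u ≤ ∣ B ∣
        2u≤B = ≤-trans (≤-reflexive (cong (u +_) (+-identityʳ u))) (periodic-gap J (set J) B (set-periodic {J} J (λ p → p)) perB bigB)
        -- `B` contains at least two J-cosets, so every summand gains at least |J| until the group
        -- is full; n summands suffice because |G/J| ≤ n.
        steps : ∀ j → order ≤ ∣ foldB j ∣ ⊎ suc j * u ≤ ∣ foldB j ∣
        steps zero = inj₂ (≤-reflexive (+-identityʳ u))
        steps (suc j) with order ≤? ∣ foldB (suc j) ∣ | steps j
        ... | yes p | _ = inj₁ p
        ... | no np | inj₁ p = ⊥-elim (np (≤-trans p (card≤⊕ (foldB j) (proj₂ neB))))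
        ... | no np | inj₂ p = inj₂ (pu-grow (∣ foldB j ∣) (∣ foldB (suc j) ∣) (∣ B ∣) u (suc j * u)
                (≤-trans (growth (foldB j) (fold-nonempty j J neB) (fold-periodic j B J) (∉-intro λ r → absurd (⊕-comm r) (proj₂ miss)))
                  (+-monoˡ-≤ u (card-mono ⊕-comm))) 2u≤B p)
          where miss = missing (foldB (suc j)) (≰⇒> np)
        reach : ∀ j → n ≤ j → order ≤ ∣ foldB j ∣
        reach j le with steps j
        ... | inj₁ p = p
        ... | inj₂ p = ⊥-elim (<-irrefl refl (≤-trans (+-monoˡ-≤ (n * u) (‖‖>0 J)) (≤-trans (*-monoˡ-≤ u (s≤s le)) (≤-trans p (≤-trans (card≤order _) small)))))
        alternative : ∀ {c} → c ∈ A → 2 * fibre-size c ≤ u → (Alternative c → ⊥) → ⊥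
        alternative {c} c∈ _ k with other c
        ... | c′ , c′∈ , c′∉ with small-order n J (c ⁻¹ ∙ c′) small
        -- The difference c′ - c has order d ≤ n modulo `J`, so n·c and d·c′ + (n - d)·c agree
        -- there; one of the d summands c′ is split off.
        ...   | suc d , _ , d≤n , j∈ = k (c′ , c′ ⁻¹ ∙ (n · c) , ⊂⊕ J c′∈ , c′∉ , w∈ , solve 2 (λ q x → x ⊜ (q ⊞ (neg q ⊞ x))) refl c′ (n · c))
          where
          ·-∙ : ∀ k x y → k · (x ∙ y) ≡ (k · x) ∙ (k · y)
          ·-∙ zero    x y = sym (identityˡ ε)
          ·-∙ (suc k) x y = trans (cong ((x ∙ y) ∙_) (·-∙ k x y)) (interchange x y (k · x) (k · y))
          ·-⁻¹ : ∀ k x → (k · x) ∙ (k · (x ⁻¹)) ≡ ε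
          ·-⁻¹ k x = trans (sym (·-∙ k x (x ⁻¹))) (trans (cong (k ·_) (inverseʳ x)) (·-ε k))
          l = n ∸ suc d
          l+d : l + suc d ≡ n
          l+d = m∸n+n≡m d≤n
          j = suc d · (c ⁻¹ ∙ c′)
          eq : c′ ⁻¹ ∙ (n · c) ≡ ((d · c′) ∙ (l · c)) ∙ j ⁻¹
          eq = trans (cong (λ i → c′ ⁻¹ ∙ (i · c)) (sym l+d)) (trans (cong (c′ ⁻¹ ∙_) (·-+ l (suc d) c))
            (trans (solve 5 (λ q L D D′ Q → (neg q ⊞ (L ⊞ D)) ⊜ (((neg q ⊞ Q) ⊞ L) ⊞ ((neg (D′ ⊞ Q)) ⊞ (D ⊞ D′)))) refl
                 c′ (l · c) (suc d · c) (suc d · (c ⁻¹)) (suc d · c′))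
              (trans (cong₂ (λ s t → ((c′ ⁻¹ ∙ (suc d · c′)) ∙ (l · c)) ∙ (s ∙ t)) (cong _⁻¹ (sym (·-∙ (suc d) (c ⁻¹) c′))) (·-⁻¹ (suc d) c))
                (solve 4 (λ q Q L J → (((neg q ⊞ (q ⊞ Q)) ⊞ L) ⊞ (neg J ⊞ nil)) ⊜ ((Q ⊞ L) ⊞ neg J)) refl c′ (d · c′) (l · c) j))))
          w∈ : c′ ⁻¹ ∙ (n · c) ∈ foldB (2 + m)
          w∈ = subst₂ (λ i v → v ∈ foldB i) (suc-injective (trans (sym (+-suc d l)) (trans (+-comm d (suc l)) (trans (cong suc refl) (trans (sym (+-suc l d)) l+d))))) (sym eq)
            (fold-periodic (d + l) B J (⁻¹∈ J j∈) (fold-prepend d J l (⊂⊕ J c′∈) (fold-multiple l J (⊂⊕ J c∈))))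

      notBad : ∀ Y → Bad J B Y → ⊥
      notBad = VosperTheorem.Vosper.vosper G e exponent J B perB bigB thin cyclic-case

      -- While at least two J-cosets are missing, a step gaining less than |B| would make the
      -- previous sumset bad.
      linear-growth : ∀ j → ∣ foldB (suc j) ∣ + u < order → suc j * ∣ B ∣ ≤ ∣ foldB (suc j) ∣
      linear-growth zero _ = ≤-trans (≤-reflexive (+-identityʳ _)) (card≤closure B J)
      linear-growth (suc j) lt with suc (suc j) * ∣ B ∣ ≤? ∣ foldB (suc (suc j)) ∣
      ... | yes p = p
      ... | no np = ⊥-elim (notBad Y (record
              { per = fold-periodic (suc j) B J ; large = ≤-trans bigB (card≤closure′)
              ; room = ≤-trans (s≤s (+-monoˡ-≤ u (card-mono ⊕-comm))) lt
              ; tight = ≤-trans (s≤s (card-mono ⊕-comm)) (≤-trans (≰⇒> np) (≤-trans (≤-reflexive (+-comm (∣ B ∣) _)) (+-monoˡ-≤ (∣ B ∣) ih))) }))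
        where
        Y = foldB (suc j)
        ih : suc j * ∣ B ∣ ≤ ∣ Y ∣
        ih = linear-growth j (≤-trans (s≤s (+-monoˡ-≤ u (card≤⊕ Y (proj₂ neB)))) lt)
        card≤closure′ : ∣ B ∣ ≤ ∣ Y ∣
        card≤closure′ = ≤-trans (m≤m+n _ _) ih

      B-large : order + u ≤ n * ∣ B ∣
      B-large = multiple-gap′ J n B perB (≤-trans big (*-monoʳ-≤ n (card≤closure A J)))

      -- Linear growth up to n would exceed the group by `B-large`. If it holds up to n - 1, the
      -- last step loses at most |J|, which the surplus in `B-large` covers. If it stops earlier, (n
      -- - 1)B misses at most |J| elements and |B| > |J|, so pigeonhole applies.
      full-fold : order ≤ ∣ foldB n ∣
      full-fold with ∣ foldB n ∣ + u <? order
      ... | yes lt = ⊥-elim (<-irrefl refl (≤-trans lt (≤-trans (m≤m+n order u) (≤-trans B-large (≤-trans (linear-growth (2 + m) lt) (m≤m+n _ u))))))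
      ... | no ge with order ≤? ∣ foldB n ∣
      ...   | yes p = p
      ...   | no np with ∣ foldB (2 + m) ∣ + u <? order
      ...     | yes lt = pu-top (∣ foldB (2 + m) ∣) (∣ foldB n ∣) (∣ B ∣) u order (2 + m)
                (≤-trans (growth (foldB (2 + m)) (fold-nonempty (2 + m) J neB) (fold-periodic (2 + m) B J)
                  (∉-intro λ r → absurd (⊕-comm r) (proj₂ (missing (foldB n) (≰⇒> np))))) (+-monoˡ-≤ u (card-mono ⊕-comm)))
                (linear-growth (suc m) lt) B-large
      ...     | no ge′ = ⊥-elim (absurd (pigeonhole-full {B} {foldB (2 + m)} y
                (≤-trans (s≤s (≮⇒≥ ge′)) (≤-trans (≤-reflexive (trans (cong suc (+-comm _ u)) refl)) (+-monoˡ-≤ _ bigB)))) y∉)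
        where
        y = proj₁ (missing (foldB n) (≰⇒> np))
        y∉ = proj₂ (missing (foldB n) (≰⇒> np))

      refuted : ⊥
      refuted = lift (full-intro full-fold z) alternative
        where
        alternative : ∀ {c} → c ∈ A → 2 * fibre-size c ≤ u → (Alternative c → ⊥) → ⊥
        alternative {c} c∈ small k = cases (∣ foldB (2 + m) ∣ + u <? order)
          where
          -- Without an alternative, `Q` is disjoint from n·c - (n - 1)B, so the two sizes together
          -- are at most |G|.
          Q = B ∖ coset J c
          Q-size : ∣ B ∣ ≤ ∣ Q ∣ + u
          Q-size = ≤-reflexive (sym (card-remove-coset J B perB (⊂⊕ J c∈)))
          disjoint : ∣ Q ∣ + ∣ foldB (2 + m) ∣ ≤ order
          disjoint = ≤-trans (≤-reflexive (cong (∣ Q ∣ +_) (sym (card-reflect (n · c) (foldB (2 + m))))))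
            (≤-trans (card-disjoint full (λ _ → full⁺) (λ _ → full⁺) λ p q → hit p (reflect⁻ {n · c} {foldB (2 + m)} q)) (≤-reflexive ∣full∣))
            where
            hit : ∀ {q} → q ∈ Q → (∃ λ w → w ∈ foldB (2 + m) × n · c ≡ q ∙ w) → ⊥
            hit {q} q∈ (w , w∈ , eq) = k (q , w , ∖ˡ q∈ , ∖ʳ q∈ , w∈ , eq)
          cases : _ → ⊥
          -- Disjointness and linear growth give n|B| ≤ |G| + |J|. The small fibre at c means |B| ≥
          -- |A| + |J|/2, so n|A| + n|J|/2 ≤ |G| + |J|, against |G| < n|A|.
          cases (yes lt) = pu-slack⊥ order (∣ A ∣) (∣ B ∣) u m big
            (*-monoʳ-≤ (3 + m) (pu-half (∣ A ∣) (∣ B ∣) (fibre-size c) u cover small))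
            (pu-alt order (∣ foldB (2 + m) ∣) (∣ B ∣) u (2 + m) (∣ Q ∣) (linear-growth (suc m) lt) disjoint Q-size)
            where
            cover : ∣ A ∣ + u ≤ ∣ B ∣ + fibre-size c
            cover = ≤-trans (≤-reflexive (trans (cong (∣ A ∣ +_) (sym (card-coset J c))) (sym (card-∪∩ A (coset J c)))))
              (+-monoˡ-≤ _ (card-mono (∪-elim (⊂⊕ J) (periodic-coset J perB (⊂⊕ J c∈)))))
          -- Now |Q| ≤ |J|, so `B` is a union of two J-cosets. Their difference generates G modulo
          -- `J`, which is the cyclic case, or else `A` lies in a proper coset.
          cases (no ge) with other c
          ... | c′ , c′∈ , c′∉ = two (order ≤? ‖ V ‖)
            where
            x = c ⁻¹ ∙ c′
            V = gen x J
            B≤ : ∣ B ∣ ≤ 2 * u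
            B≤ = pu-small order (∣ foldB (2 + m) ∣) (∣ B ∣) u (∣ Q ∣) disjoint Q-size (≮⇒≥ ge)
            two : _ → ⊥
            two (yes cyc) = cyclic-case x cyc
            two (no lt) = generating V (λ p → J≤gen x J (H≤J p)) (≰⇒> lt) c λ a∈ → inside (⊂⊕ J a∈)
              where
              P = coset J c ∪ coset J c′
              P⊂B : P ⊂ B
              P⊂B = ∪-elim (periodic-coset J perB (⊂⊕ J c∈)) (periodic-coset J perB (⊂⊕ J c′∈))
              B⊂P : B ⊂ P
              B⊂P = ⊂-antisym P⊂B (≤-trans B≤ (≤-reflexive (sym (trans (card-∪-disjoint (coset J c) (coset J c′)
                      (λ p q → absurd (coset-trans J p (coset-sym J q)) c′∉)) (cong₂ _+_ (card-coset J c) (trans (card-coset J c′) (sym (+-identityʳ u))))))))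
              inside : B ⊂ coset V c
              inside p with ∪⁻ (B⊂P p)
              ... | inj₁ q = coset-mono {J} {V} (J≤gen x J) q
              ... | inj₂ q = coset-trans V (coset⁺ V (x∈gen x J)) (coset-mono {J} {V} (J≤gen x J) q)

    refute : ∀ k J → order ≤ k + ‖ J ‖ → H ≤ₛ J → ‖ J ‖ < order → ∣ A ⊕ set J ∣ < ‖ J ‖ + ∣ A ∣ → ⊥
    refute zero J le _ J< _ = <-irrefl refl (≤-trans J< le)
    refute (suc k) J le H≤J J< fat = Level.refuted J H≤J J< fat λ V J≤V J<V V< fatV →
      refute k V (≤-trans le (≤-trans (≤-reflexive (sym (+-suc k (‖ J ‖)))) (+-monoʳ-≤ k J<V))) (λ p → J≤V (H≤J p)) V< fatV

    impossible : ‖ H ‖ < order → ⊥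
    impossible H< = refute order H (m≤m+n order _) (λ p → p) H<
      (≤-trans (s≤s (card-closure A H perA)) (+-monoˡ-≤ (∣ A ∣) (‖‖>0 H)))

-- The main theorem

fi-one : ∀ b h o x n → h + (b + 0) ≤ x + (n + 0) * h → x + h ≤ o → b + 2 * h ≤ o + n * h
fi-one b h o x n q1 q2 = linear (b + 2 * h) (o + n * h) 0 (+-mono-≤ q1 q2) (eq b h o x n)
  where
  eq : ∀ b h o x n → (b + 2 * h) + ((x + (n + 0) * h) + o) + 0 ≡ (o + n * h) + ((h + (b + 0)) + (x + h))
  eq = solve-∀

fi-two : ∀ n a h o b → n * a ≤ b → b + 2 * h ≤ o + n * h → n * a + 2 * h ≤ o + n * h
fi-two n a h o b q1 q2 = linear (n * a + 2 * h) (o + n * h) 0 (+-mono-≤ q1 q2) (eq n a h o b)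
  where
  eq : ∀ n a h o b → (n * a + 2 * h) + (b + (o + n * h)) + 0 ≡ (o + n * h) + ((n * a) + (b + 2 * h))
  eq = solve-∀

fi-three : ∀ h o n a b → h * (o + n) + n * a ≤ n * h * a + b → b + 2 * h ≤ o + n * h → h * o + 2 * h + n * a ≤ n * h * a + o
fi-three h o n a b q1 q2 = linear (h * o + 2 * h + n * a) (n * h * a + o) 0 (+-mono-≤ q1 q2) (eq h o n a b)
  where
  eq : ∀ h o n a b → (h * o + 2 * h + n * a) + ((n * h * a + b) + (o + n * h)) + 0 ≡ (n * h * a + o) + ((h * (o + n) + n * a) + (b + 2 * h))
  eq = solve-∀

fi-trivial⊥ : ∀ o n a → 1 * o + 2 * 1 + n * a ≤ n * 1 * a + o → ⊥
fi-trivial⊥ o n a q1 = linear⊥ 1 q1 (eq o n a)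
  where
  eq : ∀ o n a → (1 * o + 2 * 1 + n * a) ≡ suc ((n * 1 * a + o) + 1)
  eq = solve-∀

fi-large : ∀ o n a h → (2 + h) * o + 2 * (2 + h) + n * a ≤ n * (2 + h) * a + o → 1 + (1 + h) * o ≤ (1 + h) * (n * a)
fi-large o n a h q1 = linear (1 + (1 + h) * o) ((1 + h) * (n * a)) (3 + 2 * h) q1 (eq o n a h)
  where
  eq : ∀ o n a h → (1 + (1 + h) * o) + (n * (2 + h) * a + o) + (3 + 2 * h) ≡ ((1 + h) * (n * a)) + ((2 + h) * o + 2 * (2 + h) + n * a)
  eq = solve-∀

fi-room : ∀ n a h o → n * a + 2 * h ≤ o + n * h → n * (2 * h) ≤ n * a → (2 + n) * h ≤ o
fi-room n a h o q1 q2 = linear ((2 + n) * h) o 0 (+-mono-≤ q1 q2) (eq n a h o)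
  where
  eq : ∀ n a h o → ((2 + n) * h) + ((o + n * h) + (n * a)) + 0 ≡ o + ((n * a + 2 * h) + (n * (2 * h)))
  eq = solve-∀

fi-lone⊥ : ∀ n h t o b → n * h + h * t ≤ b → b + 2 * h ≤ o + n * h → 1 + o ≤ h * (2 + t) → ⊥
fi-lone⊥ n h t o b q1 q2 q3 = linear⊥ 0 (+-mono-≤ q1 (+-mono-≤ q2 q3)) (eq n h t o b)
  where
  eq : ∀ n h t o b → ((n * h + h * t) + ((b + 2 * h) + (1 + o))) ≡ suc ((b + ((o + n * h) + (h * (2 + t)))) + 0)
  eq = solve-∀

fi-two⊥ : ∀ o a → 2 * o + 2 * 2 + 3 * a ≤ 3 * 2 * a + o → 3 * a + 2 * 2 ≤ o + 3 * 2 → ⊥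
fi-two⊥ o a q1 q2 = linear⊥ 1 (+-mono-≤ q1 q2) (eq o a)
  where
  eq : ∀ o a → ((2 * o + 2 * 2 + 3 * a) + (3 * a + 2 * 2)) ≡ suc (((3 * 2 * a + o) + (o + 3 * 2)) + 1)
  eq = solve-∀

fi-cover⊥ : ∀ v b r t o x → v + (b + 0) ≤ x + (r + 0) * v → r * v + v * t ≤ b → x + v ≤ o → 1 + o ≤ v * (2 + t) → ⊥
fi-cover⊥ v b r t o x q1 q2 q3 q4 = linear⊥ 0 (+-mono-≤ q1 (+-mono-≤ q2 (+-mono-≤ q3 q4))) (eq v b r t o x)
  where
  eq : ∀ v b r t o x → ((v + (b + 0)) + ((r * v + v * t) + ((x + v) + (1 + o)))) ≡ suc (((x + (r + 0) * v) + (b + (o + (v * (2 + t))))) + 0)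
  eq = solve-∀

fi-index : ∀ t w d r → t * (1 + w) + 1 ≤ (1 + w) + d → (2 + r) * ((2 + w) + d) + 1 ≤ (t + (1 + r)) * (2 + w) → 3 + (1 + r) * d ≤ t
fi-index t w d r q1 q2 = linear (3 + (1 + r) * d) t 0 (+-mono-≤ q1 q2) (eq t w d r)
  where
  eq : ∀ t w d r → (3 + (1 + r) * d) + (((1 + w) + d) + ((t + (1 + r)) * (2 + w))) + 0 ≡ t + ((t * (1 + w) + 1) + ((2 + r) * ((2 + w) + d) + 1))
  eq = solve-∀

fi-index⊥ : ∀ t w d r → t * (1 + w) + 1 ≤ (1 + w) + d → (1 + w) * (3 + (1 + r) * d) ≤ (1 + w) * t → ⊥
fi-index⊥ t w d r q1 q2 = linear⊥ (2 + 2 * w + d * r + d * w + d * r * w) (+-mono-≤ q1 q2) (eq t w d r)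
  where
  eq : ∀ t w d r → ((t * (1 + w) + 1) + ((1 + w) * (3 + (1 + r) * d))) ≡ suc ((((1 + w) + d) + ((1 + w) * t)) + (2 + 2 * w + d * r + d * w + d * r * w))
  eq = solve-∀

fi-prime⊥ : ∀ n k m → n * k + 2 ≤ (1 + m * n) + n → 1 + (1 + m * n) ≤ n * k → n * (1 + k) ≤ n * (1 + m) → ⊥
fi-prime⊥ n k m _ q2 q3 = linear⊥ 1 (+-mono-≤ q2 q3) (eq n k m)
  where
  eq : ∀ n k m → ((1 + (1 + m * n)) + (n * (1 + k))) ≡ suc (((n * k) + (n * (1 + m))) + 1)
  eq = solve-∀

-- Here k and μ count the V-cosets in A + V and in U, and r + 2 is the index of U. With k = 2 + w
-- and μ = k + d, `small` gives t(1 + w) ≤ w + d, so the second inequality forces t ≥ 3 + (1 + r)d,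
-- which is too large for the first.
index-contradiction : ∀ t r k μ → 2 ≤ k → k ≤ μ → t * k + 2 ≤ μ + t → suc (suc (suc r) * μ) ≤ (t + suc r) * k → ⊥
index-contradiction t r (suc (suc w)) μ (s≤s (s≤s _)) k≤μ small large with m≤n⇒∃[o]m+o≡n k≤μ
... | d , refl = fi-index⊥ t w d r first (*-monoʳ-≤ (1 + w) (fi-index t w d r first
        (≤-trans (≤-reflexive (+-comm _ 1)) large)))
  where
  first : t * (1 + w) + 1 ≤ (1 + w) + d
  first = linear (t * (1 + w) + 1) ((1 + w) + d) 0 small (eq t w d)
    where
    eq : ∀ t w d → t * (1 + w) + 1 + (2 + w + d + t) + 0 ≡ (1 + w) + d + (t * (2 + w) + 2)
    eq = solve-∀

prime-divisor : ∀ h → 2 ≤ h → ∃ λ q → Prime q × q ∣ h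
prime-divisor h@(suc _) le with factorise h
... | record { factors = [] ; isFactorisation = eq } = ⊥-elim (<-irrefl refl (≤-trans le (≤-reflexive eq)))
... | record { factors = q ∷ qs ; isFactorisation = eq ; factorsPrime = pq ∷ _ } = q , pq , subst (q ∣_) (sym eq) (m∣m*n _)

module Theorem (G : D.FiniteAbelianGroup) (e : ℕ) .{{_ : NonZero e}}
               (exponent : ∀ g → D.FiniteAbelianGroup._·_ G e g ≡ D.FiniteAbelianGroup.ε G) where

  open FiniteSets G
  open KneserTheorem G
  open Sequences G
  open SidonSets G e exponent
  open Iterated G e exponent

  trivial : Sub
  trivial = record
    { set = zeroSet ; ε∈ = zero⁺
    ; ∙∈ = λ p q → subst (_∈ zeroSet) (sym (trans (cong₂ _∙_ (zero⁻ p) (zero⁻ q)) (identityˡ ε))) zero⁺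
    ; ⁻¹∈ = λ p → subst (_∈ zeroSet) (sym (trans (cong _⁻¹ (zero⁻ p)) (trans (sym (identityˡ _)) (inverseʳ ε)))) zero⁺ }

  fold-mono : ∀ j {A B H J} → A ⊂ B → H ≤ₛ J → fold j A H ⊂ fold j B J
  fold-mono zero    f g = g
  fold-mono (suc j) {H = H} {J} f g = ⊕-mono f (fold-mono j {H = H} {J} f g)

  -- As in `dgm-sets`, recursing modulo the stabiliser of the whole sum keeps one and the same
  -- period at all stages.
  fold-kneser : ∀ t {A} J → Nonempty A → ∃ λ V → J ≤ₛ V × Periodic V (fold t (A ⊕ set J) J) ×
                t * ∣ A ⊕ set V ∣ + ‖ V ‖ ≤ ∣ fold t (A ⊕ set J) J ∣ + t * ‖ V ‖
  fold-kneser zero J neA = J , (λ p → p) , set-periodic {J} J (λ p → p) , ≤-reflexive (sym (+-identityʳ _))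
  fold-kneser (suc t) {A} J neA with fold-kneser t {A} (stab ((A ⊕ set J) ⊕ fold t (A ⊕ set J) J)) neA
  ... | V′ , V≤V′ , per , ineq = V , J≤V , stab-periodic Y ,
      combine (∣ A ⊕ set V ∣) (∣ Y′ ∣) (∣ Y ∣) (‖ V ‖) t
        (≤-trans (+-mono-≤ (card-closure-mono V W (⊂⊕ J) V≤W) (card≤closure Y′ W))
          (≤-trans (kneser neB neY′) (+-mono-≤ (card-mono BY⊂Y) (card-mono W≤V))))
        (≤-trans (+-mono-≤ (*-monoʳ-≤ t (card-closure-mono V V′ (λ p → p) V≤V′)) (card-mono V≤V′))
          (≤-trans ineq (+-monoʳ-≤ (∣ Y′ ∣) (*-monoʳ-≤ t (card-mono V′≤V)))))
    where
    B = A ⊕ set J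
    Y = B ⊕ fold t B J
    V = stab Y
    Y′ = fold t (A ⊕ set V) V
    W = stab (B ⊕ Y′)
    J≤V : J ≤ₛ V
    J≤V = stab-maximal J Y (⊕-periodicʳ J B (fold-periodic t B J))
    neB : Nonempty B
    neB = proj₁ neA , ⊂⊕ J (proj₂ neA)
    neY′ : Nonempty Y′
    neY′ = fold-nonempty t V (proj₁ neA , ⊂⊕ V (proj₂ neA))
    BY⊂Y : B ⊕ Y′ ⊂ Y
    BY⊂Y p = closure⊂ V (stab-periodic Y) (⊕-mono (λ q → q) (fold-mono t {H = J} {J} (⊂⊕ J) (λ q → q)))
      (⊕-assoc (⊕-mono (λ q → q) (fold-closure t A {J} {V} J≤V) p))
    Y⊂BY : Y ⊂ B ⊕ Y′
    Y⊂BY = ⊕-mono (λ q → q) (fold-mono t {H = J} {V} (⊕-mono (λ q → q) J≤V) J≤V)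
    V≤W : V ≤ₛ W
    V≤W = stab-maximal V (B ⊕ Y′) (⊕-periodicʳ V B (fold-periodic t _ V))
    W≤V : W ≤ₛ V
    W≤V h∈ = stab-complete Y λ p → BY⊂Y (stab-periodic (B ⊕ Y′) h∈ (Y⊂BY p))
    V′≤V : V′ ≤ₛ V
    V′≤V h∈ = stab-complete Y λ p → BY⊂Y (⊕-periodicʳ V′ B per h∈ (Y⊂BY p))
    combine : ∀ a y′ y v t → a + y′ ≤ y + v → t * a + v ≤ y′ + t * v → (a + t * a) + v ≤ y + (v + t * v)
    combine a y′ y v t p q = linear ((a + t * a) + v) (y + (v + t * v)) 0 (+-mono-≤ p q) (eq a y′ y v t)
      where
      eq : ∀ a y′ y v t → ((a + t * a) + v) + ((y + v) + (y′ + t * v)) + 0 ≡ (y + (v + t * v)) + ((a + y′) + (t * a + v))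
      eq = solve-∀

  fold-list : ∀ j {A} H {x} → x ∈ fold j A H → ∃ λ T → length T ≡ j × All (_∈ A) T × x ∈ coset H (σ T)
  fold-list zero H {x} p = [] , refl , [] , coset⁺ H (subst (_∈ set H) (solve 1 (λ x → x ⊜ (neg nil ⊞ x)) refl x) p)
  fold-list (suc j) H p with ⊕⁻ p
  ... | a , y , a∈ , y∈ , refl with fold-list j H y∈
  ...   | T , refl , all , q = a ∷ T , refl , a∈ ∷ all , coset-∙ H (coset-refl H a) q

  extract : ∀ A T → Any (_∈ A) T → ∃ λ y → ∃ λ T′ → y ∈ A × Split T (y ∷ []) T′
  extract A (y ∷ T) (here p) = y , T , p , left (all-right T)
  extract A (x ∷ T) (there p) with extract A T p
  ... | y , T′ , y∈ , s = y , x ∷ T′ , y∈ , right s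

  -- Only the H-cosets matter: terms of `T` are exchanged one at a time for terms of `S` in the same
  -- coset.
  realise : ∀ H S T → (∀ g → count (coset H g) T ≤ count (coset H g) S) →
            ∃ λ U → U ⊆ S × length U ≡ length T × σ U ∈ coset H (σ T)
  realise H [] [] dom = [] , [] , refl , coset-refl H ε
  realise H [] (t ∷ T) dom = ⊥-elim (n≮0 (≤-trans (≤-trans (≤-reflexive (sym (bit-in (coset-refl H t)))) (m≤m+n _ _)) (dom t)))
  realise H (x ∷ S) T dom with count (coset H x) T in eq
  ... | zero with realise H S T dom′
    where
    dom′ : ∀ g → count (coset H g) T ≤ count (coset H g) S
    dom′ g = by-member (coset H g) x
      (λ p → ≤-trans (≤-reflexive (trans (count-coset H T p) eq)) z≤n)
      (λ p → ≤-trans (dom g) (≤-reflexive (cong (_+ count (coset H g) S) (bit-out {coset H g} p))))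
  ...   | U , U⊆ , l , q = U , x ∷ʳ U⊆ , l , q
  realise H (x ∷ S) T dom | suc k with extract (coset H x) T (count-positive (coset H x) T (≤-trans (s≤s z≤n) (≤-reflexive (sym eq))))
  ... | y , T′ , y∈ , s with realise H S T′ dom′
    where
    dom′ : ∀ g → count (coset H g) T′ ≤ count (coset H g) S
    dom′ g = +-cancelˡ-≤ (bit (coset H g x)) _ _ (≤-trans (≤-reflexive (trans (cong (_+ count (coset H g) T′)
      (trans same (sym (+-identityʳ _)))) (sym (split-count (coset H g) s)))) (dom g))
      where
      same : bit (coset H g x) ≡ bit (coset H g y)
      same = ≤-antisym (bit-mono {coset H g} {coset H g} λ p → coset-trans H p y∈)
                       (bit-mono {coset H g} {coset H g} λ p → coset-trans H p (coset-sym H y∈))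
  ...   | U , U⊆ , l , q = x ∷ U , refl ∷ U⊆ , trans (cong suc l) (sym (split-length s)) ,
          subst (λ w → x ∙ σ U ∈ coset H w) (trans (cong (_∙ σ T′) (sym (identityʳ y))) (sym (split-σ s))) (coset-∙ H (coset-sym H y∈) q)

  count-++ : ∀ A S T → count A (S ++ T) ≡ count A S + count A T
  count-++ A []      T = refl
  count-++ A (x ∷ S) T = trans (cong (bit (A x) +_) (count-++ A S T)) (sym (+-assoc (bit (A x)) _ _))

  σ-++ : ∀ S T → σ (S ++ T) ≡ σ S ∙ σ T
  σ-++ []      T = sym (identityˡ _)
  σ-++ (x ∷ S) T = trans (cong (x ∙_) (σ-++ S T)) (sym (assoc x _ _))

  count-none : ∀ A S → All (_∉ A) S → count A S ≡ 0
  count-none A [] [] = refl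
  count-none A (x ∷ S) (p ∷ ps) = cong₂ _+_ (bit-out p) (count-none A S ps)

  ⊆-++⁻ : ∀ X Y {T : List C} → T ⊆ X ++ Y → ∃ λ U → ∃ λ W → T ≡ U ++ W × U ⊆ X × W ⊆ Y
  ⊆-++⁻ [] Y {T} p = [] , T , refl , [] , p
  ⊆-++⁻ (x ∷ X) Y (.x ∷ʳ p) with ⊆-++⁻ X Y p
  ... | U , W , refl , u , w = U , W , refl , x ∷ʳ u , w
  ⊆-++⁻ (x ∷ X) Y (refl ∷ p) with ⊆-++⁻ X Y p
  ... | U , W , refl , u , w = x ∷ U , W , refl , refl ∷ u , w

  beyond-⊆ : ∀ A S → beyond A S ⊆ S
  beyond-⊆ A [] = []
  beyond-⊆ A (x ∷ S) with A x
  ... | true  = x ∷ʳ beyond-⊆ A S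
  ... | false = refl ∷ beyond-⊆ A S

  bound-lower : ∀ V T r → ‖ V ‖ * (r ⊓ length T) ≤ bound V T r
  bound-lower V T r with sublist-of-length (r ⊓ length T) T (m⊓n≤n r (length T))
  ... | U , U⊆ , eq = ≤-trans (≤-reflexive (trans (cong (‖ V ‖ *_) (sym eq)) (sym (count-∑ V U))))
    (∑-mono λ g → ⊓-glb (≤-trans (count≤length (coset V g) U) (≤-trans (≤-reflexive eq) (m⊓n≤m r _))) (count-⊆ (coset V g) U⊆))

  coset-gap : ∀ {Y z} V → Periodic V Y → z ∉ Y → ∣ Y ∣ + ‖ V ‖ ≤ order
  coset-gap {Y} {z} V per z∉ = ≤-trans (≤-reflexive (cong (∣ Y ∣ +_) (sym (card-coset V z))))
    (≤-trans (card-disjoint full (λ _ → full⁺) (λ _ → full⁺) λ p q → absurd (periodic-coset V per p (coset-sym V q)) z∉) (≤-reflexive ∣full∣))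

  divides-order : ∀ V → ∃ λ k → order ≡ k * ‖ V ‖
  divides-order V with periodic-card V full (full-periodic V)
  ... | k , eq = k , trans (sym ∣full∣) eq

  proper-index : ∀ U → ‖ U ‖ < order → ∃ λ r → order ≡ suc (suc r) * ‖ U ‖
  proper-index U lt with divides-order U
  ... | zero , eq = ⊥-elim (n≮0 (≤-trans lt (≤-reflexive eq)))
  ... | suc zero , eq = ⊥-elim (<-irrefl (sym (trans eq (+-identityʳ _))) lt)
  ... | suc (suc r) , eq = r , eq

  dgm-sequence : ∀ n S → n ≤ length S → ∃ λ H → Periodic H (sums n S) ×
                 ‖ H ‖ + (bound H S n + 0) ≤ ∣ sums n S ∣ + (n + 0) * ‖ H ‖
  dgm-sequence n S le with dgm trivial ((S , n) ∷ []) (le ∷ [])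
  ... | H , _ , per , ineq = H , (λ h∈ p → Y⊂ (per h∈ (⊂Y p))) , ≤-trans ineq (+-monoˡ-≤ _ (card-mono Y⊂))
    where
    Y = X ((S , n) ∷ []) ⊕ zeroSet
    Y⊂ : Y ⊂ sums n S
    Y⊂ p with ⊕⁻ p
    ... | _ , b , q , b∈ , refl with ⊕⁻ q
    ...   | a , c , a∈ , c∈ , refl = subst (_∈ sums n S)
            (sym (trans (cong₂ _∙_ (trans (cong (a ∙_) (zero⁻ c∈)) (identityʳ a)) (zero⁻ b∈)) (identityʳ a))) a∈
    ⊂Y : sums n S ⊂ Y
    ⊂Y {x} p = subst (_∈ Y) (trans (identityʳ _) (identityʳ x)) (⊕⁺ (⊕⁺ p zero⁺) zero⁺)

  -- If d·x were in `J` for some 0 < d < e, a Bézout relation between d and e would put `x` in `J`.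
  -- So the first e multiples lie in distinct cosets.
  prime-extension : Prime e → ∀ J {x} → x ∉ set J → ‖ gen x J ‖ ≡ e * ‖ J ‖
  prime-extension pe J {x} x∉ with distinct-multiples x J e
  ... | inj₂ ge = ≤-antisym (card-gen x J) (≤-trans ge (card-mono λ p → spanned (upTo⁻ x J e p)))
    where
    spanned : ∀ {g} → (∃ λ i → i < e × g ∈ coset J (i · x)) → g ∈ genSet x J
    spanned (i , _ , p) = gen⁺ x J i p
  ... | inj₁ (d , 1≤d , d<e , p) = absurd (bezout (coprime-Bézout (prime⇒coprime pe {{>-nonZero 1≤d}} d<e))) x∉
    where
    multiple∈ : ∀ k {y} → y ∈ set J → k · y ∈ set J
    multiple∈ zero    q = ε∈ J
    multiple∈ (suc k) q = ∙∈ J q (multiple∈ k q)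
    e-multiple : ∀ k → (k * e) · x ≡ ε
    e-multiple k = trans (·-* k e x) (trans (cong (k ·_) (exponent x)) (·-ε k))
    bezout : Bézout.Identity 1 e d → x ∈ set J
    bezout (Bézout.-+ k l eq) = subst (_∈ set J) (begin
      l · (d · x)              ≡⟨ sym (·-* l d x) ⟩
      (l * d) · x              ≡⟨ cong (_· x) (sym eq) ⟩
      x ∙ ((k * e) · x)        ≡⟨ trans (cong (x ∙_) (e-multiple k)) (identityʳ x) ⟩
      x                        ∎) (multiple∈ l p)
      where open ≡-Reasoning
    bezout (Bézout.+- k l eq) = subst (_∈ set J) (begin
      (l · (d · x)) ⁻¹                         ≡⟨ cong _⁻¹ (sym (·-* l d x)) ⟩
      ((l * d) · x) ⁻¹                         ≡⟨ solve 2 (λ x y → neg y ⊜ (x ⊟ (x ⊞ y))) refl x ((l * d) · x) ⟩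
      x ∙ (suc (l * d) · x) ⁻¹                 ≡⟨ cong (λ i → x ∙ (i · x) ⁻¹) eq ⟩
      x ∙ ((k * e) · x) ⁻¹                     ≡⟨ cong (λ y → x ∙ y ⁻¹) (e-multiple k) ⟩
      x ∙ ε ⁻¹                                 ≡⟨ solve 1 (λ x → (x ⊟ nil) ⊜ x) refl x ⟩
      x                                        ∎) (⁻¹∈ J (multiple∈ l p))
      where open ≡-Reasoning

  -- The index is a power of e, hence congruent to 1 modulo e - 1.
  prime-index : Prime e → ∀ n → e ≡ suc n → ∀ k J → order ≤ k + ‖ J ‖ → ∃ λ m → order ≡ (1 + m * n) * ‖ J ‖
  prime-index pe n refl k J le with ⊂-or-escape full (set J)
  ... | inj₁ all = 0 , trans (≤-antisym (≤-trans (≤-reflexive (sym ∣full∣)) (card-mono all)) (card≤order (set J))) (sym (+-identityʳ _))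
  prime-index pe n refl zero J le | inj₂ (x , _ , x∉) =
    absurd (⊂-antisym {set J} {full} (λ _ → full⁺) (≤-trans (≤-reflexive ∣full∣) le) full⁺) x∉
  prime-index pe n refl (suc k) J le | inj₂ (x , _ , x∉) with prime-index pe n refl k (gen x J) le′
    where
    J<gen : ‖ J ‖ < ‖ gen x J ‖
    J<gen with ‖ gen x J ‖ ≤? ‖ J ‖
    ... | no lt = ≰⇒> lt
    ... | yes ge = absurd (⊂-antisym (J≤gen x J) ge (x∈gen x J)) x∉
    le′ : order ≤ k + ‖ gen x J ‖
    le′ = ≤-trans le (≤-trans (≤-reflexive (sym (+-suc k _))) (+-monoʳ-≤ k J<gen))
  ... | m , eq = m + m * n + 1 , trans eq (trans (cong ((1 + m * n) *_) (prime-extension pe J x∉)) (arith m n (‖ J ‖)))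
    where
    arith : ∀ m n j → (1 + m * n) * (suc n * j) ≡ (1 + (m + m * n + 1) * n) * j
    arith = solve-∀

  -- Cosets rich in terms, when some element is no n-term sum

  module Main (n : ℕ) (S : List C) (len : length S ≡ order + n)
    (heights : ∀ A → count A S ≤ n * ∣ A ∣)
    (outs : ∀ V → ‖ V ‖ < order → ∀ α → order < ‖ V ‖ * (2 + length (beyond (coset V α) S)))
    {z : C} (z∉ : z ∉ sums n S) (H : Sub) (perY : Periodic H (sums n S))
    (ineq : ‖ H ‖ + (bound H S n + 0) ≤ ∣ sums n S ∣ + (n + 0) * ‖ H ‖) where

    Y : Subset
    Y = sums n S

    h o : ℕ
    h = ‖ H ‖
    o = order

    A : Subset
    A = atLeast H n S

    perA : Periodic H A
    perA = atLeast-periodic H n S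

    neY : Nonempty Y
    neY with sublist-of-length n S (≤-trans (m≤n+m n order) (≤-reflexive (sym len)))
    ... | T , T⊆ , l = σ T , subst (λ k → σ T ∈ sums k S) l (sums⁺ T⊆)

    H< : h < o
    H< = proper H perY neY z∉

    I₁ : bound H S n + 2 * h ≤ o + n * h
    I₁ = fi-one (bound H S n) h o (∣ Y ∣) n ineq (coset-gap H perY z∉)

    a : ℕ
    a = ∣ A ∣

    I₂ : n * a + 2 * h ≤ o + n * h
    I₂ = fi-two n a h o (bound H S n) (≤-trans (≤-reflexive (trans (cong (n *_) (card-∑ A)) (sym (∑-* n (bit ∘ A))))) (∑-mono pt)) I₁
      where
      pt : ∀ g → n * bit (A g) ≤ n ⊓ count (coset H g) S
      pt g = by-member A g
        (λ p → ≤-trans (≤-reflexive (trans (cong (n *_) (bit-in p)) (*-identityʳ n))) (⊓-glb ≤-refl (atLeast⁻ {H} {n} {S} p)))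
        (λ p → ≤-trans (≤-reflexive (trans (cong (n *_) (bit-out p)) (*-zeroʳ n))) z≤n)

    -- The place of the height bound: an H-coset holds at most nh terms, which is used on the cosets
    -- in `A`; elsewhere the minimum in `bound` is the count itself. Over all g the counts add up to
    -- h(o + n).
    I₃ : h * o + 2 * h + n * a ≤ n * h * a + o
    I₃ = fi-three h o n a (bound H S n) sum≤ I₁
      where
      pt : ∀ g → count (coset H g) S + n * bit (A g) ≤ n * h * bit (A g) + (n ⊓ count (coset H g) S)
      pt g = by-member A g
        (λ p → ≤-trans (+-mono-≤ (≤-trans (heights (coset H g)) (≤-reflexive (trans (cong (n *_) (card-coset H g))
                   (sym (trans (cong (n * h *_) (bit-in p)) (*-identityʳ _)))))) (≤-reflexive (trans (cong (n *_) (bit-in p)) (*-identityʳ n))))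
                 (+-monoʳ-≤ (n * h * bit (A g)) (⊓-glb ≤-refl (atLeast⁻ {H} {n} {S} p))))
        (λ p → ≤-trans (≤-reflexive (trans (cong (λ b → count (coset H g) S + n * b) (bit-out p)) (trans (cong (count (coset H g) S +_) (*-zeroʳ n)) (+-identityʳ _))))
                 (≤-trans (⊓-glb (<⇒≤ (≰⇒> λ q → absurd (atLeast⁺ {H} {n} {S} q) p)) ≤-refl) (m≤n+m _ (n * h * bit (A g)))))
      sum≤ : h * (o + n) + n * a ≤ n * h * a + bound H S n
      sum≤ = ≤-trans (≤-reflexive (cong₂ _+_ (trans (cong (h *_) (sym len)) (sym (count-∑ H S))) (trans (cong (n *_) (card-∑ A)) (sym (∑-* n (bit ∘ A))))))
        (≤-trans (≤-reflexive (sym (∑-+ (λ g → count (coset H g) S) (λ g → n * bit (A g))))) (≤-trans (∑-mono pt)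
        (≤-reflexive (trans (∑-+ (λ g → n * h * bit (A g)) (λ g → n ⊓ count (coset H g) S))
          (cong (_+ bound H S n) (trans (∑-* (n * h) (bit ∘ A)) (cong (n * h *_) (sym (card-∑ A)))))))))

    -- `I₃` amounts to (h - 1)o + 2h ≤ (h - 1)na. This is absurd for h = 1, and for h ≥ 2 it yields
    -- `large`.
    2≤h : 2 ≤ h
    2≤h with 2 ≤? h
    ... | yes p = p
    ... | no np = ⊥-elim (fi-trivial⊥ o n a (subst (λ h → h * o + 2 * h + n * a ≤ n * h * a + o) (≤-antisym (s≤s⁻¹ (≰⇒> np)) (‖‖>0 H)) I₃))

    large : o < n * a
    large with m≤n⇒∃[o]m+o≡n 2≤h
    ... | h′ , eq = *-cancelˡ-< (1 + h′) o (n * a) (fi-large o n a h′ (subst (λ h → h * o + 2 * h + n * a ≤ n * h * a + o) (sym eq) I₃))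

    neA : Nonempty A
    neA with search A
    ... | inj₁ p = p
    ... | inj₂ none = ⊥-elim (n≮0 (≤-trans large (≤-reflexive (trans (cong (n *_) (card-empty none)) (*-zeroʳ n)))))

    -- If `A` were the single coset α + H, all terms R outside it would count fully and `bound`
    -- would be at least nh + h|R|. By `I₁` then h(2 + |R|) ≤ |G|, contrary to the hypothesis on
    -- terms outside a proper coset.
    two-large : 2 * h ≤ a
    two-large with ⊂-or-escape A (coset H (proj₁ neA))
    ... | inj₂ (b , b∈ , b∉) = ≤-trans (≤-reflexive (cong₂ _+_ (sym (card-coset H (proj₁ neA))) (trans (+-identityʳ h) (sym (card-coset H b)))))
            (card-disjoint A (periodic-coset H perA (proj₂ neA)) (periodic-coset H perA b∈) λ p q → absurd (coset-trans H p (coset-sym H q)) b∉)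
    ... | inj₁ A⊂ = ⊥-elim (fi-lone⊥ n h (length R) o (bound H S n) lower I₁ (outs H H< α))
      where
      α = proj₁ neA
      R = beyond (coset H α) S
      pt : ∀ g → n * bit (coset H α g) + count (coset H g) R ≤ n ⊓ count (coset H g) S
      pt g = by-member (coset H α) g
        (λ p → ≤-trans (≤-reflexive (cong₂ _+_ (trans (cong (n *_) (bit-in p)) (*-identityʳ n)) (count-none (coset H g) R
                   (All.map (λ {y} q → ∉-intro λ r → absurd (coset-trans H p r) q) (outside-all (coset H α) S)))))
                 (≤-trans (≤-reflexive (+-identityʳ n)) (⊓-glb ≤-refl (atLeast⁻ {H} {n} {S} (periodic-coset H perA (proj₂ neA) p)))))
        (λ p → ≤-trans (≤-reflexive (cong (_+ count (coset H g) R) (trans (cong (n *_) (bit-out p)) (*-zeroʳ n))))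
                 (≤-trans (count-⊆ (coset H g) (beyond-⊆ (coset H α) S)) (⊓-glb (<⇒≤ (≰⇒> λ q → absurd (A⊂ (atLeast⁺ {H} {n} {S} q)) p)) ≤-refl)))
      lower : n * h + h * length R ≤ bound H S n
      lower = ≤-trans (≤-reflexive (cong₂ _+_ (trans (cong (n *_) (trans (sym (card-coset H α)) (card-∑ (coset H α)))) (sym (∑-* n (bit ∘ coset H α)))) (sym (count-∑ H R))))
        (≤-trans (≤-reflexive (sym (∑-+ (λ g → n * bit (coset H α g)) (λ g → count (coset H g) R)))) (∑-mono pt))

    room : (2 + n) * h ≤ o
    room = fi-room n a h o I₂ (*-monoʳ-≤ n two-large)

    -- A coset in `A` holds at least n terms, enough for all of the sum. So `T` may be any elements
    -- of `A`; only `W` has to come from `S`.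
    reachable : ∀ T W → All (_∈ A) T → W ⊆ S → length T + length W ≡ n → z ∈ coset H (σ T ∙ σ W) → ⊥
    reachable T W allT W⊆ eq z∈ with realise H S (T ++ W) dom
      where
      dom : ∀ g → count (coset H g) (T ++ W) ≤ count (coset H g) S
      dom g = by-member A g
        (λ p → ≤-trans (count≤length (coset H g) (T ++ W)) (≤-trans (≤-reflexive (trans (length-++ T) eq)) (atLeast⁻ {H} {n} {S} p)))
        (λ p → ≤-trans (≤-reflexive (trans (count-++ (coset H g) T W) (cong (_+ count (coset H g) W)
                 (count-none (coset H g) T (All.map (λ q → ∉-intro λ r → absurd (periodic-coset H perA q (coset-sym H r)) p) allT)))))
                 (count-⊆ (coset H g) W⊆))
    ... | U , U⊆ , l , q = absurd (periodic-coset H perY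
            (subst (λ k → σ U ∈ sums k S) (trans l (trans (length-++ T) eq)) (sums⁺ U⊆))
            (coset-trans H (coset-sym H q) (subst (λ w → z ∈ coset H w) (sym (σ-++ T W)) z∈))) z∉

    not-in-fold : ∀ {B} → B ⊂ A → z ∈ fold n B H → ⊥
    not-in-fold {B} B⊂A p with fold-list n H p
    ... | T , l , all , q = reachable T [] (All.map B⊂A all) (minimum S) (trans (+-identityʳ _) l)
            (subst (λ w → z ∈ coset H w) (sym (identityʳ (σ T))) q)

    -- `U` is the smallest subgroup with `A` in one coset, of index r + 1. Of the n terms, r are
    -- reserved for reaching every U-coset, and the other t = n - r fill the coset reached.
    module Confined (U : Sub) (H≤U : H ≤ₛ U) (U< : ‖ U ‖ < o) (α : C) (α∈ : α ∈ A) (A⊂ : A ⊂ coset U α)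
                    (minimal : ∀ V → H ≤ₛ V → ‖ V ‖ < ‖ U ‖ → ∀ b → A ⊂ coset V b → ⊥)
                    (r′ : ℕ) (o≡ : o ≡ suc (suc r′) * ‖ U ‖) where

      a≤U : a ≤ ‖ U ‖
      a≤U = ≤-trans (card-mono A⊂) (≤-reflexive (card-coset U α))

      r : ℕ
      r = suc r′

      r<n : suc r < n
      r<n = *-cancelʳ-< (‖ U ‖) (suc r) n (≤-trans (≤-trans (≤-reflexive (cong suc (sym o≡))) large) (*-monoʳ-≤ n a≤U))

      t : ℕ
      t = n ∸ r

      t+r : t + r ≡ n
      t+r = m∸n+n≡m (≤-trans (n≤1+n r) (<⇒≤ r<n))

      B = A ⊕ set H

      B⊂A : B ⊂ A
      B⊂A = closure⊂ H perA (λ p → p)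

      F = fold t B H

      fold⊂ : ∀ j → fold j B H ⊂ coset U (j · α)
      fold⊂ zero {x} p = coset⁺ U (subst (_∈ set U) (solve 1 (λ x → x ⊜ (neg nil ⊞ x)) refl x) (H≤U p))
      fold⊂ (suc j) = ⊕-elim (coset U (suc j · α)) λ p q → coset-∙ U (A⊂ (B⊂A p)) (fold⊂ j q)

      neF : Nonempty F
      neF = fold-nonempty t H (α , ⊂⊕ H α∈)

      -- Otherwise the sumset has a period V properly inside `U`. By minimality of `U` the set A + V
      -- has at least two V-cosets, and Kneser's bound together with |G| < n|A| contradicts
      -- `index-contradiction`.
      fills : ∀ {w} → w ∈ coset U (t · α) → w ∈ F
      fills {w} w∈ with member? F w | fold-kneser t {A} H neA
      ... | inj₁ p | _ = p
      ... | inj₂ w∉ | V , H≤V , per , ineq = ⊥-elim (contradict (periodic-card V (A ⊕ set V) (closure-periodic {V} A V (λ p → p))) (periodic-card V (set U) (set-periodic {V} U V≤U)))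
        where
        V≤U : V ≤ₛ U
        V≤U = period-bound U (fold⊂ t) neF V per
        V<U : ‖ V ‖ < ‖ U ‖
        V<U with ‖ U ‖ ≤? ‖ V ‖
        ... | no lt = ≰⇒> lt
        ... | yes ge = absurd (periodic-coset U (λ u∈ → per (⊂-antisym V≤U ge u∈)) (proj₂ neF) (coset-trans U (coset-sym U (fold⊂ t (proj₂ neF))) w∈)) w∉
        gap : ∣ F ∣ + ‖ V ‖ ≤ ‖ U ‖
        gap = ≤-trans (≤-reflexive (cong (∣ F ∣ +_) (sym (card-coset V w))))
          (≤-trans (card-disjoint (coset U (t · α)) (fold⊂ t) (λ p → coset-trans U w∈ (coset-mono {V} {U} V≤U p))
            λ p q → absurd (periodic-coset V per p (coset-sym V q)) w∉) (≤-reflexive (card-coset U (t · α))))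
        spread : ‖ V ‖ < ∣ A ⊕ set V ∣
        spread with ⊂-or-escape A (coset V α)
        ... | inj₁ inc = ⊥-elim (minimal V H≤V V<U α inc)
        ... | inj₂ (b , b∈ , b∉) = ≤-trans (≤-reflexive (trans (cong suc (sym (card-coset V α))) (+-comm 1 _)))
                (≤-trans (+-monoʳ-≤ _ (card-positive (coset-refl V b))) (card-disjoint (A ⊕ set V) (closure-intro V α∈) (closure-intro V b∈)
                  λ p q → absurd (coset-trans V p (coset-sym V q)) b∉))
        contradict : (∃ λ k → ∣ A ⊕ set V ∣ ≡ k * ‖ V ‖) → (∃ λ μ → ‖ U ‖ ≡ μ * ‖ V ‖) → ⊥
        contradict (k , eqk) (μ , eqμ) = index-contradiction t r′ k μ
          (*-cancelʳ-< v 1 k (≤-trans (≤-reflexive (cong suc (+-identityʳ v))) (≤-trans spread (≤-reflexive eqk))))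
          (*-cancelʳ-≤ k μ v (≤-trans (≤-reflexive (sym eqk)) (≤-trans (card-mono (closure⊂ V (coset-periodic {V} U α V≤U) A⊂))
            (≤-trans (≤-reflexive (card-coset U α)) (≤-reflexive eqμ)))))
          (*-cancelʳ-≤ (t * k + 2) (μ + t) v (scale₁ t k v μ (∣ F ∣) (subst (λ x → t * x + v ≤ ∣ F ∣ + t * v) eqk ineq) (≤-trans gap (≤-reflexive eqμ))))
          (*-cancelʳ-< v (suc (suc r′) * μ) ((t + suc r′) * k) (≤-trans (≤-reflexive (cong suc scale₂)) (≤-trans large scale₃)))
          where
          v = ‖ V ‖
          instance
            v≠0 : NonZero v
            v≠0 = >-nonZero (‖‖>0 V)
          scale₁ : ∀ t k v μ f → t * (k * v) + v ≤ f + t * v → f + v ≤ μ * v → (t * k + 2) * v ≤ (μ + t) * v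
          scale₁ t k v μ f p q = linear ((t * k + 2) * v) ((μ + t) * v) 0 (+-mono-≤ p q) (eq t k v μ f)
            where
            eq : ∀ t k v μ f → (t * k + 2) * v + ((f + t * v) + μ * v) + 0 ≡ (μ + t) * v + ((t * (k * v) + v) + (f + v))
            eq = solve-∀
          scale₂ : suc (suc r′) * μ * v ≡ o
          scale₂ = trans (*-assoc (suc (suc r′)) μ v) (sym (trans o≡ (cong (suc (suc r′) *_) eqμ)))
          scale₃ : n * a ≤ (t + suc r′) * k * v
          scale₃ = ≤-trans (*-mono-≤ (≤-reflexive (sym t+r)) (≤-trans (card≤closure A V) (≤-reflexive eqk))) (≤-reflexive (sym (*-assoc (t + suc r′) k v)))

      T₀ = beyond (coset U α) S
      -- The r copies of α pad the selection: fewer than r terms outside may be needed, and the rest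
      -- are taken from `A`.
      S₂ = replicate r α ++ T₀

      valid₂ : Valid ((S₂ , r) ∷ [])
      valid₂ = ≤-trans (≤-reflexive (sym (length-replicate r))) (≤-trans (m≤m+n _ (length T₀)) (≤-reflexive (sym (length-++ (replicate r α))))) ∷ []

      Y₂ = X ((S₂ , r) ∷ []) ⊕ set U

      count-replicate : ∀ B k {x} → x ∈ B → count B (replicate k x) ≡ k
      count-replicate B zero    p = refl
      count-replicate B (suc k) p = cong₂ _+_ (bit-in p) (count-replicate B k p)

      -- If not, the DeVos-Goddyn-Mohar theorem modulo `U` gives a proper V ≥ U with |V|(2 + min(r,
      -- |R₁|)) ≤ |G|. For |R₁| ≤ r this violates the hypothesis on terms outside α + V; for r ≤
      -- |R₁| it violates |G| = (r + 1)|U| ≤ (r + 1)|V|.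
      spans : ∀ y → y ∈ Y₂
      spans y with member? Y₂ y | dgm U ((S₂ , r) ∷ []) valid₂
      ... | inj₁ p | _ = p
      ... | inj₂ y∉ | V , U≤V , per , ineq = ⊥-elim (fi-cover⊥ (‖ V ‖) (bound V S₂ r) r (r ⊓ length R₁) o (∣ Y₂ ∣) ineq lower
              (coset-gap V per y∉) enough)
        where
        R₁ = beyond (coset V α) S
        V< : ‖ V ‖ < o
        V< = proper V per (⊕-nonempty (X-nonempty valid₂) (ε , ε∈ U)) y∉
        enough : o < ‖ V ‖ * (2 + (r ⊓ length R₁))
        enough with ≤-total r (length R₁)
        ... | inj₂ ge = ≤-trans (outs V V< α) (≤-reflexive (cong (λ k → ‖ V ‖ * (2 + k)) (sym (m≥n⇒m⊓n≡n ge))))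
        ... | inj₁ le = ≤-trans (≤-trans (s≤s (≤-trans (≤-reflexive o≡) (*-monoʳ-≤ (suc r) (card-mono U≤V))))
                (+-monoˡ-≤ (suc r * ‖ V ‖) (‖‖>0 V))) (≤-reflexive (trans (*-comm (2 + r) (‖ V ‖)) (cong (λ k → ‖ V ‖ * (2 + k)) (sym (m≤n⇒m⊓n≡m le)))))
        pt : ∀ g → r * bit (coset V α g) + (r ⊓ count (coset V g) R₁) ≤ r ⊓ count (coset V g) S₂
        pt g = by-member (coset V α) g
          (λ p → ≤-trans (≤-reflexive (cong₂ _+_ (trans (cong (r *_) (bit-in p)) (*-identityʳ r)) (trans (cong (r ⊓_) (count-none (coset V g) R₁
                     (All.map (λ q → ∉-intro λ s → absurd (coset-trans V p s) q) (outside-all (coset V α) S)))) (⊓-zeroʳ r))))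
                   (≤-trans (≤-reflexive (+-identityʳ r)) (⊓-glb ≤-refl (≤-trans (≤-reflexive (sym (count-replicate (coset V g) r (coset-sym V p))))
                     (≤-trans (m≤m+n _ _) (≤-reflexive (sym (count-++ (coset V g) (replicate r α) T₀))))))))
          (λ p → ≤-trans (≤-reflexive (cong (_+ (r ⊓ count (coset V g) R₁)) (trans (cong (r *_) (bit-out p)) (*-zeroʳ r))))
                   (⊓-monoʳ-≤ r (≤-trans (count-⊆ (coset V g) (beyond-⊆ (coset V α) S)) (≤-trans (≤-reflexive (sym (count-outside (coset U α) (coset V g) S
                     λ q → ∉-intro λ s → absurd (coset-trans V (coset-mono {U} {V} U≤V s) (coset-sym V q)) p)))
                     (≤-trans (m≤n+m _ _) (≤-reflexive (sym (count-++ (coset V g) (replicate r α) T₀))))))))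
        lower : r * ‖ V ‖ + ‖ V ‖ * (r ⊓ length R₁) ≤ bound V S₂ r
        lower = ≤-trans (+-mono-≤ (≤-reflexive (trans (cong (r *_) (trans (sym (card-coset V α)) (card-∑ (coset V α)))) (sym (∑-* r (bit ∘ coset V α))))) (bound-lower V R₁ r))
          (≤-trans (≤-reflexive (sym (∑-+ (λ g → r * bit (coset V α g)) (λ g → r ⊓ count (coset V g) R₁)))) (∑-mono pt))

      refuted : ⊥
      refuted with ⊕⁻ (spans ((t · α) ⁻¹ ∙ z))
      ... | x , w , x∈ , w∈ , eq with ⊕⁻ x∈
      ...   | s , ε′ , s∈ , ε′∈ , refl with sums⁻ r S₂ s∈
      ...     | T₂ , T₂⊆ , l₂ , refl with ⊆-++⁻ (replicate r α) T₀ T₂⊆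
      ...       | P , Q , refl , P⊆ , Q⊆ with fold-list t H (fills (coset-∙ʳ U (t · α) w∈))
      ...         | T , l , allT , q = reachable (T ++ P) Q (AllP.++⁺ (All.map B⊂A allT) (all-⊆ P⊆ (AllP.replicate⁺ r α∈)))
                    (⊆-trans Q⊆ (beyond-⊆ (coset U α) S))
                    (trans (cong (_+ length Q) (length-++ T)) (trans (+-assoc (length T) _ _) (trans (cong₂ _+_ l (trans (sym (length-++ P)) l₂)) t+r)))
                    (subst₂ (λ x y → x ∈ coset H y) (sym z≡) rhs (coset-∙ H q (coset-refl H (σ P ∙ σ Q))))
        where
        z≡ : z ≡ ((t · α) ∙ w) ∙ (σ P ∙ σ Q)
        z≡ = trans (solve 2 (λ k z → z ⊜ (k ⊞ (neg k ⊞ z))) refl (t · α) z) (trans (cong ((t · α) ∙_) (trans eq (cong (_∙ w) (trans (cong₂ _∙_ (σ-++ P Q) (zero⁻ ε′∈)) (identityʳ _)))))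
          (solve 3 (λ k s w → (k ⊞ (s ⊞ w)) ⊜ ((k ⊞ w) ⊞ s)) refl (t · α) (σ P ∙ σ Q) w))
        rhs : σ T ∙ (σ P ∙ σ Q) ≡ σ (T ++ P) ∙ σ Q
        rhs = trans (sym (assoc _ _ _)) (cong (_∙ σ Q) (sym (σ-++ T P)))

    n=2 : n ≡ 2 → ⊥
    n=2 refl with ⊕⁻ (pigeonhole-full {A} {A} z (≤-trans large (≤-reflexive (cong (a +_) (+-identityʳ a)))))
    ... | x , y , x∈ , y∈ , eq = reachable (x ∷ y ∷ []) [] (x∈ ∷ y∈ ∷ []) (minimum S) refl
            (subst (λ w → w ∈ coset H (x ∙ (y ∙ ε) ∙ ε)) (sym eq) (subst (λ w → x ∙ y ∈ coset H w)
              (sym (trans (identityʳ _) (cong (x ∙_) (identityʳ y)))) (coset-refl H (x ∙ y))))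

    general : 3 ≤ n → (∀ J → H ≤ₛ J → ‖ J ‖ < o → ∀ x → o ≤ ‖ gen x J ‖ → o ≤ n * ‖ J ‖) → ⊥
    general 3≤n cyclic = confine o ⊤ₛ (λ _ → full⁺) (proj₁ neA) (proj₂ neA) (λ _ → coset⁺ ⊤ₛ full⁺) (≤-reflexive ∣full∣)
      where
      ⊤ₛ : Sub
      ⊤ₛ = record { set = full ; ε∈ = full⁺ ; ∙∈ = λ _ _ → full⁺ ; ⁻¹∈ = λ _ → full⁺ }
      confine : ∀ k U → H ≤ₛ U → ∀ α → α ∈ A → A ⊂ coset U α → ‖ U ‖ ≤ k → ⊥
      confine zero U _ _ _ _ le = <-irrefl refl (≤-trans (‖‖>0 U) le)
      confine (suc k) U H≤U α α∈ A⊂ le with ‖ U ‖ <? o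
      ... | yes lt with proper-index U lt
      ...   | r′ , eq = Confined.refuted U H≤U lt α α∈ A⊂ (λ V H≤V V<U b inc →
              confine k V H≤V α α∈ (λ p → coset-trans V (coset-sym V (inc α∈)) (inc p)) (s≤s⁻¹ (≤-trans V<U le))) r′ eq
      confine (suc k) U H≤U α α∈ A⊂ le | no ge with m≤n⇒∃[o]m+o≡n 3≤n
      ... | m , refl = Cover.impossible H A perA m large
                (λ V H≤V V< b inc → confine k V H≤V α α∈ (λ p → coset-trans V (coset-sym V (inc α∈)) (inc p)) (s≤s⁻¹ (≤-trans (≤-trans V< (≮⇒≥ ge)) le)))
                cyclic {z} (∉-intro (not-in-fold (λ p → p))) H<

    exponent-bounded : 2 ≤ n → e ≤ n → ⊥
    exponent-bounded 2≤n e≤n with m≤n⇒m<n∨m≡n 2≤n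
    ... | inj₂ eq  = n=2 (sym eq)
    ... | inj₁ 3≤n = general 3≤n λ J _ _ x cyc → ≤-trans cyc (≤-trans (card-gen x J) (*-monoˡ-≤ (‖ J ‖) e≤n))

    -- With |G| = (1 + mn)h and |A| = kh, the counting bounds put nk between mn + 2 and mn + n - 1,
    -- where there is no multiple of n.
    exponent-prime : Prime e → e ≡ suc n → ⊥
    exponent-prime pe eq with prime-index pe n eq o H (m≤m+n o h) | periodic-card H A perA
    ... | m , o≡ | k , a≡ = fi-prime⊥ n k m below above (*-monoʳ-≤ n (*-cancelˡ-< n k (suc m) (≤-trans (≤-reflexive (+-comm 1 _))
            (linear (n * k + 1) (n * suc m) 0 below (shift n k m)))))
      where
      instance
        h≠0 : NonZero h
        h≠0 = >-nonZero (‖‖>0 H)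
      shift : ∀ n k m → n * k + 1 + (1 + m * n + n) + 0 ≡ n * suc m + (n * k + 2)
      shift = solve-∀
      below : n * k + 2 ≤ (1 + m * n) + n
      below = *-cancelʳ-≤ (n * k + 2) ((1 + m * n) + n) h (≤-trans (≤-reflexive (trans (left′ n k h) (cong (λ a → n * a + 2 * h) (sym a≡))))
        (≤-trans I₂ (≤-reflexive (trans (cong (_+ n * h) o≡) (sym (*-distribʳ-+ h (1 + m * n) n))))))
        where
        left′ : ∀ n k h → (n * k + 2) * h ≡ n * (k * h) + 2 * h
        left′ = solve-∀
      above : 1 + (1 + m * n) ≤ n * k
      above = *-cancelʳ-< h (1 + m * n) (n * k) (≤-trans (≤-reflexive (cong suc (sym o≡))) (≤-trans large
        (≤-reflexive (trans (cong (n *_) a≡) (sym (*-assoc n k h))))))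

    -- A cyclic G/J has order at most e = n + 1. If it exceeds n, then |J| = p, and the nontrivial H
    -- ≤ J equals `J`; but then |G| = (n + 1)h, against `room`.
    prime-complement : ∀ p → Prime p → 2 ≤ n → e ≡ suc n → o ≡ p * e → ⊥
    prime-complement p pp 2≤n e≡ o≡ with m≤n⇒m<n∨m≡n 2≤n
    ... | inj₂ eq  = n=2 (sym eq)
    ... | inj₁ 3≤n = general 3≤n cyclic
      where
      cyclic : ∀ J → H ≤ₛ J → ‖ J ‖ < o → ∀ x → o ≤ ‖ gen x J ‖ → o ≤ n * ‖ J ‖
      cyclic J H≤J J< x cyc with o ≤? n * ‖ J ‖ | divides-order J | periodic-card H (set J) (set-periodic {H} J H≤J)
      ... | yes le | _ | _ = le
      ... | no gt | k , o≡k | l , J≡l = ⊥-elim (irreducible (prime⇒irreducible pp (divides l (trans (sym J≡p) J≡l))))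
        where
        o≤ : o ≤ suc n * ‖ J ‖
        o≤ = ≤-trans cyc (≤-trans (card-gen x J) (≤-reflexive (cong (_* ‖ J ‖) e≡)))
        instance
          J≠0 : NonZero (‖ J ‖)
          J≠0 = >-nonZero (‖‖>0 J)
        k≡ : k ≡ suc n
        k≡ = ≤-antisym (*-cancelʳ-≤ k (suc n) (‖ J ‖) (≤-trans (≤-reflexive (sym o≡k)) o≤))
               (*-cancelʳ-< (‖ J ‖) n k (≤-trans (≰⇒> gt) (≤-reflexive o≡k)))
        J≡p : ‖ J ‖ ≡ p
        J≡p = *-cancelˡ-≡ (‖ J ‖) p (suc n) (trans (cong (_* ‖ J ‖) (sym k≡)) (trans (sym o≡k) (trans o≡ (trans (cong (p *_) e≡) (*-comm p (suc n))))))
        irreducible : h ≡ 1 ⊎ h ≡ p → ⊥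
        irreducible (inj₁ h≡1) = <-irrefl (sym h≡1) 2≤h
        irreducible (inj₂ h≡p) = <-irrefl refl (≤-trans (+-monoˡ-≤ (suc n * h) (‖‖>0 H)) (≤-trans room
          (≤-trans o≤ (≤-reflexive (cong (suc n *_) (trans J≡p (sym h≡p)))))))

    -- A prime divisor of h ≥ 2 divides |G|, so h ≥ p, and `room` is violated.
    smallest-prime : ∀ p → Prime p → (∀ q → Prime q → q ∣ o → p ≤ q) → o < (2 + n) * p → ⊥
    smallest-prime p pp least lt with prime-divisor h 2≤h | divides-order H
    ... | q , pq , q∣h | k , eq = <-irrefl refl (≤-trans lt (≤-trans (*-monoʳ-≤ (2 + n)
            (≤-trans (least q pq (∣-trans q∣h (divides k eq))) (∣⇒≤ {{>-nonZero (‖‖>0 H)}} q∣h))) room))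

    -- Here `I₃` reads |G| + 4 ≤ 3|A|, while `I₂` reads 3|A| ≤ |G| + 2.
    three-two : n ≡ 3 → h ≡ 2 → ⊥
    three-two n≡ h≡ = fi-two⊥ o a
      (subst₂ (λ n h → h * o + 2 * h + n * a ≤ n * h * a + o) n≡ h≡ I₃) (subst₂ (λ n h → n * a + 2 * h ≤ o + n * h) n≡ h≡ I₂)

    order<12 : 2 ≤ n → o < 12 → ⊥
    order<12 2≤n o<12 with m≤n⇒m<n∨m≡n 2≤n
    ... | inj₂ eq  = n=2 (sym eq)
    ... | inj₁ 3≤n with 4 ≤? n | 3 ≤? h
    -- By `room`, |G| ≥ 12 when n ≥ 4 and h ≥ 2, and |G| ≥ 15 when n = 3 and h ≥ 3.
    ...   | yes 4≤n | _ = <-irrefl refl (≤-trans o<12 (≤-trans (*-mono-≤ (s≤s (s≤s 4≤n)) 2≤h) room))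
    ...   | no _ | yes 3≤h = <-irrefl refl (≤-trans o<12 (≤-trans (m≤n+m 12 3) (≤-trans (*-mono-≤ (s≤s (s≤s 3≤n)) 3≤h) room)))
    ...   | no n<4 | no h<3 = three-two (≤-antisym (s≤s⁻¹ (≰⇒> n<4)) 3≤n) (≤-antisym (s≤s⁻¹ (≰⇒> h<3)) 2≤h)

    order-16 : 2 ≤ n → e ≡ 4 → o ≡ 16 → ⊥
    order-16 2≤n e≡ o≡ with 4 ≤? n | m≤n⇒m<n∨m≡n 2≤n
    ... | yes 4≤n | _ = exponent-bounded 2≤n (≤-trans (≤-reflexive e≡) 4≤n)
    ... | no _ | inj₂ eq = n=2 (sym eq)
    ... | no n<4 | inj₁ 3≤n with 4 ≤? h | 3 ≤? h | divides-order H
    -- For n = 3 and h ≥ 4, `room` gives |G| ≥ 20; h = 3 is excluded because it does not divide 16.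
    ...   | yes 4≤h | _ | _ = <-irrefl refl (≤-trans (m≤n+m 17 3) (≤-trans (*-mono-≤ (s≤s (s≤s 3≤n)) 4≤h) (≤-trans room (≤-reflexive o≡))))
    ...   | no _ | no h<3 | _ = three-two (≤-antisym (s≤s⁻¹ (≰⇒> n<4)) 3≤n) (≤-antisym (s≤s⁻¹ (≰⇒> h<3)) 2≤h)
    ...   | no h<4 | yes 3≤h | k , eq = no-third k (trans (sym o≡) (trans eq (cong (k *_) (≤-antisym (s≤s⁻¹ (≰⇒> h<4)) 3≤h))))
      where
      no-third : ∀ k → 16 ≡ k * 3 → ⊥
      no-third 0 ()
      no-third 1 ()
      no-third 2 ()
      no-third 3 ()
      no-third 4 ()
      no-third 5 ()
      no-third (suc (suc (suc (suc (suc (suc k)))))) ()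

    exponent≤3 : 2 ≤ n → e ≤ 3 → ⊥
    exponent≤3 2≤n e≤3 with m≤n⇒m<n∨m≡n 2≤n
    ... | inj₂ eq  = n=2 (sym eq)
    ... | inj₁ 3≤n = exponent-bounded 2≤n (≤-trans e≤3 3≤n)

-- From the notions of the statement to Boolean subsets

module Translation (G : D.FiniteAbelianGroup) where

  open FiniteSets G
  open Sequences G

  toSubgroup : Sub → D.FiniteAbelianGroup.Subgroup G
  toSubgroup V = record
    { P = _∈ set V
    ; P? = decide
    ; ε∈ = ε∈ V
    ; ∙-closed = ∙∈ V
    ; ⁻¹-closed = ⁻¹∈ V
    }
    where
    decide : ∀ x → Dec (x ∈ set V)
    decide x with member? (set V) x
    ... | inj₁ p = yes p
    ... | inj₂ p = no λ q → absurd q p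

  countP-bit : ∀ {A : Set} {P : A → Set} (P? : ∀ x → Dec (P x)) (f : A → Bool) →
    (∀ {x} → P x → f x ≡ true) → (∀ {x} → f x ≡ true → P x) →
    ∀ x xs → D.countP P? (x ∷ xs) ≡ bit (f x) + D.countP P? xs
  countP-bit P? f sound complete x xs with P? x | f x in eq
  ... | yes p | true  = refl
  ... | yes p | false = ⊥-elim (true≢false (sound p) eq)
  ... | no ¬p | true  = ⊥-elim (¬p (complete eq))
  ... | no ¬p | false = refl

  card≡ : ∀ V → D.FiniteAbelianGroup.Subgroup.card (toSubgroup V) ≡ ‖ V ‖
  card≡ V = trans (tabulated (λ i → i)) (sym (card-∑ (set V)))
    where
    open D.FiniteAbelianGroup.Subgroup (toSubgroup V) using (P?)
    tabulated : ∀ {k} (f : Fin k → Fin order) → D.countP (λ i → P? (to i)) (tabulate f) ≡ sum (λ i → bit (set V (to (f i))))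
    tabulated {zero}  f = refl
    tabulated {suc k} f = trans (countP-bit (λ i → P? (to i)) (λ i → set V (to i)) holds mem (f fzero) (tabulate (f ∘ fsuc)))
      (cong (bit (set V (to (f fzero))) +_) (tabulated (f ∘ fsuc)))

  outside≡ : ∀ V α S → D.FiniteAbelianGroup.Subgroup.outside (toSubgroup V) α S ≡ length (beyond (coset V α) S)
  outside≡ V α [] = refl
  outside≡ V α (x ∷ S) = trans (countP-bit (λ x → ¬? (inCoset? α x)) (λ x → not (coset V α x)) sound complete x S)
    (trans (cong (bit (not (coset V α x)) +_) (outside≡ V α S)) step)
    where
    open D.FiniteAbelianGroup.Subgroup (toSubgroup V) using (inCoset?)
    sound : ∀ {x} → ¬ (α ⁻¹ ∙ x ∈ set V) → not (coset V α x) ≡ true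
    sound {x} ¬p = cong not (fails (∉-intro {coset V α} {x} λ q → ¬p (coset⁻ V q)))
    complete : ∀ {x} → not (coset V α x) ≡ true → ¬ (α ⁻¹ ∙ x ∈ set V)
    complete {x} p q = absurd (coset⁺ V q) (non (not-true p))
    step : bit (not (coset V α x)) + length (beyond (coset V α) S) ≡ length (beyond (coset V α) (x ∷ S))
    step with coset V α x
    ... | true  = refl
    ... | false = refl

  below-next-multiple : ∀ a b .{{_ : NonZero b}} → a < suc (a / b) * b
  below-next-multiple a b = ≤-trans (≤-reflexive (cong suc (m≡m%n+[m/n]*n a b))) (+-monoˡ-≤ (a / b * b) (m%n<n a b))

  -- The condition |G/V| - 1 ≤ k is put as |G| < |V|(2 + k), free of division and truncated
  -- subtraction.
  outs-from : ∀ S → (∀ (H : D.FiniteAbelianGroup.Subgroup G) → D.FiniteAbelianGroup.Subgroup.Proper H → ∀ α →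
      D.FiniteAbelianGroup.Subgroup.index H ∸ 1 ≤ D.FiniteAbelianGroup.Subgroup.outside H α S) →
    ∀ V → ‖ V ‖ < order → ∀ α → order < ‖ V ‖ * (2 + length (beyond (coset V α) S))
  outs-from S hyp V V< α = ≤-trans (below-next-multiple order card) (≤-trans
      (*-monoˡ-≤ card (s≤s (≤-trans (m≤n+m∸n index 1) (s≤s (≤-trans (hyp K proper α) (≤-reflexive (outside≡ V α S)))))))
      (≤-reflexive (trans (*-comm _ card) (cong (_* (2 + length (beyond (coset V α) S))) (card≡ V)))))
    where
    K = toSubgroup V
    open D.FiniteAbelianGroup.Subgroup K using (card; card-nonZero; index)
    proper : ∃ λ g → ¬ (g ∈ set V)
    proper with ⊂-or-escape full (set V)
    ... | inj₁ f = ⊥-elim (<-irrefl refl (≤-trans V< (≤-trans (≤-reflexive (sym ∣full∣)) (card-mono f))))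
    ... | inj₂ (g , _ , g∉) = g , λ p → absurd p g∉

  v : C → List C → ℕ
  v = D.FiniteAbelianGroup.v G

  heights-from : ∀ n S → (∀ g → v g S ≤ n) → ∀ A → count A S ≤ n * ∣ A ∣
  heights-from n S hyp A = ≤-trans (weighted S) (≤-trans (∑-mono λ g → ≤-trans (*-monoʳ-≤ (bit (A g)) (hyp g)) (≤-reflexive (*-comm (bit (A g)) n)))
    (≤-reflexive (trans (∑-* n (bit ∘ A)) (cong (n *_) (sym (card-∑ A))))))
    where
    v-cons : ∀ g x S → v g (x ∷ S) ≡ bit ⌊ x ≟ g ⌋ + v g S
    v-cons g x S = countP-bit (λ x → x ≟ g) (λ x → ⌊ x ≟ g ⌋) (λ {x} → sound x) (λ {x} → complete x) x S
      where
      sound : ∀ x → x ≡ g → ⌊ x ≟ g ⌋ ≡ true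
      sound x p with x ≟ g
      ... | yes _ = refl
      ... | no ¬p = ⊥-elim (¬p p)
      complete : ∀ x → ⌊ x ≟ g ⌋ ≡ true → x ≡ g
      complete x p with x ≟ g
      ... | yes q = q
    weighted : ∀ S → count A S ≤ ∑ (λ g → bit (A g) * v g S)
    weighted [] = z≤n
    weighted (x ∷ S) = ≤-trans (+-mono-≤ (≤-trans (≤-reflexive point) (∑-single (λ g → bit (A g) * bit ⌊ x ≟ g ⌋) x)) (weighted S))
      (≤-reflexive (trans (sym (∑-+ (λ g → bit (A g) * bit ⌊ x ≟ g ⌋) (λ g → bit (A g) * v g S)))
        (∑-cong λ g → trans (sym (*-distribˡ-+ (bit (A g)) (bit ⌊ x ≟ g ⌋) (v g S))) (cong (bit (A g) *_) (sym (v-cons g x S))))))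
      where
      point : bit (A x) ≡ bit (A x) * bit ⌊ x ≟ x ⌋
      point with x ≟ x
      ... | yes _ = sym (*-identityʳ _)
      ... | no ¬p = ⊥-elim (¬p refl)

  complement : ∀ {U S} → U ⊆ S → ∃ λ T → T ⊆ S × Split S U T
  complement [] = [] , [] , []
  complement (x ∷ʳ p) with complement p
  ... | T , q , s = x ∷ T , refl ∷ q , right s
  complement {x ∷ _} (refl ∷ p) with complement p
  ... | T , q , s = T , x ∷ʳ q , left s

order-⊕C : ∀ {G H e} → G D.≅ H ⊕C[ e ] → D.order G ≡ D.order H * e
order-⊕C {G} {H} {e} (φ , _) = ↔⇒≡ (↔-trans (D.enum G) (↔-trans (↔-sym φ) (↔-trans (↔-sym (D.enum H) ×-↔ ↔-refl) (↔-sym *↔×))))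

open import Defs

theorem1p2 : (G : FiniteAbelianGroup) (n : ℕ) → 2 ≤ n →
    (S : List (Carrier G)) → length S ≡ order G + n → h≤ G S n →
    (∀ (H : Subgroup G) → Subgroup.Proper H → ∀ α →
    Subgroup.index H ∸ 1 ≤ Subgroup.outside H α S) →
    (e : ℕ) → IsExponent G e →
    (e ≤ n
    ⊎ (e ∸ 1 ≤ n × Σ FiniteAbelianGroup (λ H → (G ≅ H ⊕C[ e ]) × (Prime (order H) ⊎ Prime e)))
    ⊎ (Cyclic G × Σ ℕ (λ p → Σ (IsSmallestPrimeDivisor p (order G)) (λ sp →
    (order G / p) ⦃ prime⇒nonZero (proj₁ sp) ⦄ ∸ 1 ≤ n)))
    ⊎ (e ≤ 3 ⊎ order G < 12 ⊎ (e ≡ 4 × order G ≡ 16))) →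
    ∀ g → _∈Σ[_]_ G g (order G) S
theorem1p2 G n 2≤n S len heights outs e (1≤e , exponent , _) cases g = conclude (member? (sums n S) z)
  where
  instance
    e≠0 : NonZero e
    e≠0 = >-nonZero 1≤e
  open FiniteSets G using (member?; _∈_; _∉_; assoc; identityʳ; inverseʳ; solve; _⊜_; _⊞_; _⊟_; neg)
  open Sequences G using (sums; sums⁻; split-length; split-σ)
  open Translation G
  z : Carrier G
  z = _∙_ G (σ G S) (_⁻¹ G g)

  module _ (z∉ : z ∉ sums n S) where
    open Theorem G e exponent

    witness = dgm-sequence n S (≤-trans (m≤n+m n (order G)) (≤-reflexive (sym len)))

    open Main n S len (heights-from n S heights) (outs-from S outs) z∉
      (proj₁ witness) (proj₁ (proj₂ witness)) (proj₂ (proj₂ witness))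

    refute : _ → ⊥
    refute (inj₁ e≤n) = exponent-bounded 2≤n e≤n
    refute (inj₂ (inj₁ (e-1≤n , K , iso , primes))) with e ≤? n
    ... | yes e≤n = exponent-bounded 2≤n e≤n
    ... | no e>n = split primes
      where
      -- The case e ≤ n being settled by the first item, only e = n + 1 is left for the second.
      e≡ : e ≡ suc n
      e≡ = ≤-antisym (≤-trans (m≤n+m∸n e 1) (s≤s e-1≤n)) (≰⇒> e>n)
      split : Prime (order K) ⊎ Prime e → ⊥
      split (inj₁ pK) = prime-complement (order K) pK 2≤n e≡ (order-⊕C {G} {K} {e} iso)
      split (inj₂ pe) = exponent-prime pe e≡
    refute (inj₂ (inj₂ (inj₁ (_ , p , (pp , _ , least) , le)))) = smallest-prime p pp least
      (≤-trans (below-next-multiple (order G) p ⦃ prime⇒nonZero pp ⦄)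
        (*-monoˡ-≤ p (s≤s (≤-trans (m≤n+m∸n ((order G / p) ⦃ prime⇒nonZero pp ⦄) 1) (s≤s le)))))
    refute (inj₂ (inj₂ (inj₂ (inj₁ e≤3)))) = exponent≤3 2≤n e≤3
    refute (inj₂ (inj₂ (inj₂ (inj₂ (inj₁ o<12))))) = order<12 2≤n o<12
    refute (inj₂ (inj₂ (inj₂ (inj₂ (inj₂ (e≡ , o≡)))))) = order-16 2≤n e≡ o≡

  conclude : z ∈ sums n S ⊎ z ∉ sums n S → _∈Σ[_]_ G g (order G) S
  conclude (inj₂ z∉) = ⊥-elim (refute z∉ cases)
  conclude (inj₁ z∈) with sums⁻ n S z∈
  ... | U , U⊆ , lU , σU with complement U⊆
  ...   | T , T⊆ , s = T , T⊆ ,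
          +-cancelˡ-≡ n _ _ (trans (cong (_+ length T) (sym lU)) (trans (sym (split-length s)) (trans len (+-comm (order G) n)))) ,
          σT
    where
    open ≡-Reasoning
    σT : σ G T ≡ g
    σT = begin
      σ G T                                                  ≡⟨ solve 2 (λ u t → t ⊜ ((u ⊞ t) ⊟ u)) refl (σ G U) (σ G T) ⟩
      _∙_ G (_∙_ G (σ G U) (σ G T)) (_⁻¹ G (σ G U))          ≡⟨ cong₂ (λ x y → _∙_ G x (_⁻¹ G y)) (sym (split-σ s)) σU ⟩
      _∙_ G (σ G S) (_⁻¹ G z)                                ≡⟨ solve 2 (λ s g → (s ⊟ (s ⊟ g)) ⊜ g) refl (σ G S) g ⟩
      g                                                      ∎
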